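{- If the univariate binomial basis conjecture holds, then $\#\mathsf P\neq\#\mathsf P^{\mathsf{NP}}$ (and hence, in particular, $\mathsf P\neq\mathsf{NP}$).
   Context: $\#\mathsf P$ is the class of functions $f:\{0,1\}^*\to\mathbb N$ such that there is a nondeterministic polynomial-time Turing machine whose number of accepting computation paths on every input $w$ equals $f(w)$; for an oracle language $A$, $\#\mathsf P^A$ is defined with machines having oracle access to $A$, and $\#\mathsf P^{\mathsf{NP}}$ denotes the functions counting accepting paths of nondeterministic polynomial-time machines with access to an $\mathsf{NP}$ oracle. A univariate polynomial $\psi\in\mathbb Q[x]$ is a closure property of $\#\mathsf P$ if $\psi\circ f\in\#\mathsf P$ for all $f\in\#\mathsf P$; it relativizes if $\psi\circ f\in\#\mathsf P^A$ for every oracle $A$ and every $f\in\#\mathsf P^A$. The univariate binomial basis conjecture states: every univariate polynomial closure property of $\#\mathsf P$ relativizes. -}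

module Defs where

open import Data.Nat as ℕ using (ℕ; zero; suc; _≤_; _>_)
open import Data.Bool using (Bool; true; false)
open import Data.Fin using (Fin; _≟_)
import Data.Fin as Fin
open import Data.List using (List; []; _∷_; length; map; sum; _++_; reverse)
open import Data.List.Relation.Unary.All using (All)
open import Data.Product using (Σ; _×_; _,_)
open import Data.Unit using (⊤)
open import Data.Empty using (⊥)
open import Relation.Binary.PropositionalEquality using (_≡_)
open import Relation.Nullary using (yes; no)
open import Function.Bundles using (_⇔_)
open import Data.Rational as ℚ using (ℚ)
open import Data.Integer using (+_)

Word : Set
Word = List Bool

Language : Set
Language = Word → Bool

∅L : Language
∅L _ = false

Sym : Set
Sym = Fin 3

blank : Sym
blank = Fin.zero

bitSym : Bool → Sym
bitSym false = Fin.suc Fin.zero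
bitSym true  = Fin.suc (Fin.suc Fin.zero)

data Move : Set where
  L R S : Move

record OTM : Set where
  field
    nStates : ℕ
    start accept reject query ansYes ansNo : Fin nStates
    -- nondeterministic transition relation: given state, symbol under the
    -- work-tape head and symbol under the oracle-tape head, a list of
    -- choices (new state, written work symbol, work move, written oracle
    -- symbol, oracle move).  Each list entry is a separate branch.
    δ : Fin nStates → Sym → Sym → List (Fin nStates × Sym × Move × Sym × Move)

-- A tape as a zipper: reversed left part, scanned cell, right part.
record Tape : Set where
  constructor tape
  field
    left  : List Sym
    here  : Sym
    right : List Sym

emptyTape : Tape
emptyTape = tape [] blank []

write : Sym → Tape → Tape
write s (tape l _ r) = tape l s r

move : Move → Tape → Tape
move L (tape [] h r)      = tape [] blank (h ∷ r)
move L (tape (x ∷ l) h r) = tape l x (h ∷ r)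
move R (tape l h [])      = tape (h ∷ l) blank []
move R (tape l h (x ∷ r)) = tape (h ∷ l) x r
move S t = t

contents : Tape → List Sym
contents (tape l h r) = reverse l ++ (h ∷ r)

symsToWord : List Sym → Word
symsToWord [] = []
symsToWord (Fin.zero ∷ xs) = symsToWord xs
symsToWord (Fin.suc Fin.zero ∷ xs) = false ∷ symsToWord xs
symsToWord (Fin.suc (Fin.suc Fin.zero) ∷ xs) = true ∷ symsToWord xs

record Config (M : OTM) : Set where
  constructor config
  field
    state  : Fin (OTM.nStates M)
    work   : Tape
    oracle : Tape

inputTape : Word → Tape
inputTape [] = emptyTape
inputTape (b ∷ w) = tape [] (bitSym b) (map bitSym w)

initConfig : (M : OTM) → Word → Config M
initConfig M w = config (OTM.start M) (inputTape w) emptyTape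

queryStep : (M : OTM) → Language → Config M → Config M
queryStep M A (config q wt ot) with A (symsToWord (contents ot))
... | true  = config (OTM.ansYes M) wt emptyTape
... | false = config (OTM.ansNo M) wt emptyTape

applyChoice : (M : OTM) → Config M →
              (Fin (OTM.nStates M) × Sym × Move × Sym × Move) → Config M
applyChoice M (config _ wt ot) (q' , sw , mw , so , mo) =
  config q' (move mw (write sw wt)) (move mo (write so ot))

succs : (M : OTM) → Config M → List (Config M)
succs M c@(config q wt ot) =
  map (applyChoice M c) (OTM.δ M q (Tape.here wt) (Tape.here ot))

-- all computation paths from c reach accept/reject within t steps
-- (a configuration without any successor is a dead, rejecting path)
HaltsWithin : (M : OTM) → Language → ℕ → Config M → Set
countAcc : (M : OTM) → Language → ℕ → Config M → ℕ
HaltsAll : (M : OTM) → Language → ℕ → List (Config M) → Set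
countAll : (M : OTM) → Language → ℕ → List (Config M) → ℕ

HaltsWithin M A t c with Config.state c ≟ OTM.accept M | Config.state c ≟ OTM.reject M
... | yes _ | _ = ⊤
... | no _ | yes _ = ⊤
... | no _ | no _ with t
...   | zero = ⊥
...   | suc t' with Config.state c ≟ OTM.query M
...     | yes _ = HaltsWithin M A t' (queryStep M A c)
...     | no _  = HaltsAll M A t' (succs M c)

HaltsAll M A t [] = ⊤
HaltsAll M A t (c ∷ cs) = HaltsWithin M A t c × HaltsAll M A t cs

countAcc M A t c with Config.state c ≟ OTM.accept M | Config.state c ≟ OTM.reject M
... | yes _ | _ = 1
... | no _ | yes _ = 0
... | no _ | no _ with t
...   | zero = 0
...   | suc t' with Config.state c ≟ OTM.query M
...     | yes _ = countAcc M A t' (queryStep M A c)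
...     | no _  = countAll M A t' (succs M c)

countAll M A t [] = 0
countAll M A t (c ∷ cs) = countAcc M A t c ℕ.+ countAll M A t cs

poly : ℕ → ℕ → ℕ → ℕ
poly c k n = c ℕ.* (n ℕ.^ k) ℕ.+ c

PolyTimeBound : OTM → Language → ℕ → ℕ → Set
PolyTimeBound M A c k = ∀ w → HaltsWithin M A (poly c k (length w)) (initConfig M w)

accPaths : OTM → Language → ℕ → ℕ → Word → ℕ
accPaths M A c k w = countAcc M A (poly c k (length w)) (initConfig M w)

SharpP^ : Language → (Word → ℕ) → Set
SharpP^ A f = Σ OTM λ M → Σ ℕ λ c → Σ ℕ λ k →
  PolyTimeBound M A c k × (∀ w → accPaths M A c k w ≡ f w)

-- #P  (machines with the empty oracle, i.e. no effective oracle access)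
SharpP : (Word → ℕ) → Set
SharpP = SharpP^ ∅L

NP : Language → Set
NP Lg = Σ OTM λ M → Σ ℕ λ c → Σ ℕ λ k →
  PolyTimeBound M ∅L c k × (∀ w → (Lg w ≡ true) ⇔ (accPaths M ∅L c k w > 0))

Deterministic : OTM → Set
Deterministic M = ∀ q a b → length (OTM.δ M q a b) ≤ 1

P : Language → Set
P Lg = Σ OTM λ M → Deterministic M × (Σ ℕ λ c → Σ ℕ λ k →
  PolyTimeBound M ∅L c k × (∀ w → (Lg w ≡ true) ⇔ (accPaths M ∅L c k w > 0)))

SharpP^NP : (Word → ℕ) → Set
SharpP^NP f = Σ Language λ A → NP A × SharpP^ A f

-- Univariate rational polynomials (coefficient lists, constant term first)

QPoly : Set
QPoly = List ℚ

evalQ : QPoly → ℚ → ℚ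
evalQ [] x = ℚ.0ℚ
evalQ (a ∷ as) x = a ℚ.+ x ℚ.* evalQ as x

toℚ : ℕ → ℚ
toℚ n = + n ℚ./ 1

ComposeIn : Language → QPoly → (Word → ℕ) → Set
ComposeIn A ψ f = Σ (Word → ℕ) λ g → SharpP^ A g × (∀ w → evalQ ψ (toℚ (f w)) ≡ toℚ (g w))

IsClosureProperty : QPoly → Set
IsClosureProperty ψ = ∀ f → SharpP f → ComposeIn ∅L ψ f

Relativizes : QPoly → Set
Relativizes ψ = ∀ (A : Language) f → SharpP^ A f → ComposeIn A ψ f

UnivariateBinomialBasisConjecture : Set
UnivariateBinomialBasisConjecture = ∀ ψ → IsClosureProperty ψ → Relativizes ψ

{-# OPTIONS --safe #-}

-- The polynomial ψ(x) = (x - 1)² = 1 - x + 2 (x choose 2) is a closure property of #P if #P = #P^NP or P = NP, but it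
-- does not relativize, which contradicts the conjecture in either case.
--
-- Closure. Let y range over bit strings that encode computation paths. If f(w) > 0, then ψ(f(w)) is the number of triples
-- (y₁, y₂, y₃) where y₁ is the lexicographically first accepting path and y₂, y₃ are accepting paths other than y₁;
-- if f(w) = 0, then one extra certificate is counted. That a certificate must not be counted is an NP statement, witnessed
-- by simulating a single path, so ψ ∘ f counts the certificates on which an NP oracle, asked once, answers no. If the
-- oracle is in P, then running its decider replaces the query.
--
-- Diagonalization. For an oracle A let f_A(w) be the number of members of A of length |w|, so that ψ ∘ f_A is 1 where A has
-- no such member and 0 where it has one. A machine that has an accepting path while A has no member of length n keeps it
-- when a word of length n that the path did not query is added.
module Submission where

open import Defs
open import Data.Bool as Bool using (Bool; true; false; if_then_else_; not; _∧_; _∨_; T)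
import Data.Bool.Properties as Boolₚ
open import Data.Empty using (⊥; ⊥-elim; ⊥-elim-irr)
open import Data.Fin using (Fin; zero; suc; _≟_; toℕ; fromℕ<; splitAt; join; combine; remQuot; _↑ʳ_)
open import Data.Fin.Patterns
import Data.Fin.Properties as Finₚ
import Data.Integer as ℤ
import Data.Integer.Properties as ℤₚ
open import Data.List using (List; []; _∷_; length; map; head; drop; _++_; reverse; replicate; _ʳ++_)
import Data.List.Properties as Listₚ
open import Data.List.Relation.Unary.All as All using (All; []; _∷_)
import Data.List.Relation.Unary.All.Properties as Allₚ
open import Data.Maybe as Maybe using (Maybe; just; nothing; fromMaybe; _>>=_)
open import Data.Nat using (ℕ; zero; suc; pred; _+_; _*_; _∸_; _^_; _≤_; _<_; _>_; z≤n; s≤s; _≤?_; _<?_; _⊔_; _≡ᵇ_)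
open import Data.Nat.ListAction using (sum)
import Data.Nat.Properties as ℕₚ
open import Data.Nat.Tactic.RingSolver using (solve-∀)
open import Data.Product using (Σ; _×_; _,_; proj₁; proj₂)
open import Data.Rational as ℚ using (ℚ)
import Data.Rational.Properties as ℚₚ
open import Data.Rational.Solver using (module +-*-Solver)
import Data.Rational.Unnormalised as ℚᵘ
import Data.Rational.Unnormalised.Properties as ℚᵘₚ
open import Data.Sum using (_⊎_; inj₁; inj₂)
open import Data.Unit using (⊤; tt)
open import Data.Vec as Vec using (Vec; []; _∷_; lookup; updateAt; tabulate)
import Data.Vec.Properties as Vecₚ
open import Function using (_∘_)
open import Function.Bundles using (_⇔_; mk⇔; Equivalence)
open import Relation.Binary.PropositionalEquality using (_≡_; _≢_; refl; sym; trans; cong; cong₂; subst; subst₂; module ≡-Reasoning)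
open import Relation.Nullary using (yes; no; ¬_; does)

-- Machines from finite state types

-- On the values 0 and 1 this polynomial is the complement, which a relativizing machine cannot
-- compute for the question whether the oracle has a member of a given length. Counting machines
-- cannot subtract either; excluding one distinguished accepting path from two further guesses is
-- what replaces the subtraction of 1, and that the path is the first one is a universal statement,
-- whence the oracle. All numbers of paths must be exact. Accepting paths therefore correspond
-- one-to-one to bit strings of one common length, which the generating machine computes in unary.
-- The machine model has a single work tape, while the machines needed here contain simulations of
-- other machines. They are written as programs on several stacks, and compilation preserves the
-- number of accepting paths at polynomial cost. A program queries at most once on each path, as its
-- last instruction, so a decider that replaces the query never has to return. The diagonalization
-- runs over all machines with an explicit clock, whether or not they respect it, so that no
-- undecidable condition enters the enumeration.

Evaluates : (M : OTM) → Language → ℕ → Config M → ℕ → Set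
Evaluates M A t c n = HaltsWithin M A t c × countAcc M A t c ≡ n

EvaluatesAll : (M : OTM) → Language → ℕ → List (Config M) → ℕ → Set
EvaluatesAll M A t cs n = HaltsAll M A t cs × countAll M A t cs ≡ n

-- A computation that is cut off by the clock counts as 0, so the count alone may change as `t`
-- grows. Halting makes it stable, and this is why the two are carried together.
evaluates-mono : ∀ M A {t t'} c {n} → t ≤ t' → Evaluates M A t c n → Evaluates M A t' c n
evaluatesAll-mono : ∀ M A {t t'} cs {n} → t ≤ t' → EvaluatesAll M A t cs n → EvaluatesAll M A t' cs n
evaluates-mono M A {t} {t'} c t≤t' (h , e) with Config.state c ≟ OTM.accept M | Config.state c ≟ OTM.reject M
... | yes _ | _ = h , e
... | no _ | yes _ = h , e
evaluates-mono M A {suc t} {suc t'} c (s≤s t≤t') (h , e) | no _ | no _ with Config.state c ≟ OTM.query M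
... | yes _ = evaluates-mono M A (queryStep M A c) t≤t' (h , e)
... | no _ = evaluatesAll-mono M A (succs M c) t≤t' (h , e)
evaluatesAll-mono M A [] t≤t' (h , e) = tt , e
evaluatesAll-mono M A (c ∷ cs) t≤t' ((h , hs) , e) =
  (proj₁ p , proj₁ ps) , trans (cong₂ _+_ (proj₂ p) (proj₂ ps)) e
  where
  p = evaluates-mono M A c t≤t' (h , refl)
  ps = evaluatesAll-mono M A cs t≤t' (hs , refl)

-- A retraction onto a finite set suffices to number the states of a machine.
record Finite (X : Set) : Set where
  field
    size : ℕ
    to   : X → Fin size
    from : Fin size → X
    from-to : ∀ x → from (to x) ≡ x

open Finite

retractFinite : ∀ {X Y : Set} → Finite Y → (f : X → Y) (g : Y → X) → (∀ x → g (f x) ≡ x) → Finite X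
retractFinite F f g gf .size = size F
retractFinite F f g gf .to x = to F (f x)
retractFinite F f g gf .from i = g (from F i)
retractFinite F f g gf .from-to x = trans (cong g (from-to F (f x))) (gf x)

finFinite : ∀ n → Finite (Fin n)
finFinite n .size = n
finFinite n .to i = i
finFinite n .from i = i
finFinite n .from-to i = refl

⊎-finite : ∀ {X Y : Set} → Finite X → Finite Y → Finite (X ⊎ Y)
⊎-finite {X} {Y} F G = retractFinite (finFinite (size F + size G)) f g gf
  where
  f : X ⊎ Y → Fin (size F + size G)
  f (inj₁ x) = join (size F) (size G) (inj₁ (to F x))
  f (inj₂ y) = join (size F) (size G) (inj₂ (to G y))
  g : Fin (size F + size G) → X ⊎ Y
  g i with splitAt (size F) i
  ... | inj₁ a = inj₁ (from F a)
  ... | inj₂ b = inj₂ (from G b)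
  gf : ∀ x → g (f x) ≡ x
  gf (inj₁ x) rewrite Finₚ.splitAt-join (size F) (size G) (inj₁ (to F x)) = cong inj₁ (from-to F x)
  gf (inj₂ y) rewrite Finₚ.splitAt-join (size F) (size G) (inj₂ (to G y)) = cong inj₂ (from-to G y)

×-finite : ∀ {X Y : Set} → Finite X → Finite Y → Finite (X × Y)
×-finite {X} {Y} F G = retractFinite (finFinite (size F * size G)) f g gf
  where
  f : X × Y → Fin (size F * size G)
  f (x , y) = combine (to F x) (to G y)
  g : Fin (size F * size G) → X × Y
  g i = from F (proj₁ (remQuot {size F} (size G) i)) , from G (proj₂ (remQuot {size F} (size G) i))
  gf : ∀ x → g (f x) ≡ x
  gf (x , y) = trans (cong (λ ij → from F (proj₁ ij) , from G (proj₂ ij)) (Finₚ.remQuot-combine {size F} (to F x) (to G y)))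
                     (cong₂ _,_ (from-to F x) (from-to G y))

⊤-finite : Finite ⊤
⊤-finite = retractFinite (finFinite 1) (λ _ → 0F) (λ _ → tt) (λ _ → refl)

Bool-finite : Finite Bool
Bool-finite = retractFinite (⊎-finite ⊤-finite ⊤-finite)
  (λ { true → inj₁ tt ; false → inj₂ tt }) (λ { (inj₁ _) → true ; (inj₂ _) → false })
  (λ { true → refl ; false → refl })

-- The bound is irrelevant, so that a state is determined by its index alone while the index can be
-- matched on as a natural number.
record UpTo (K : ℕ) : Set where
  constructor upTo
  field
    index  : ℕ
    .bound : index ≤ K

UpTo-finite : ∀ K → Finite (UpTo K)
UpTo-finite K = retractFinite (finFinite (suc K)) f g gf
  where
  f : UpTo K → Fin (suc K)
  f (upTo i p) = fromℕ< (s≤s p)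
  g : Fin (suc K) → UpTo K
  g i = upTo (toℕ i) (Finₚ.toℕ≤pred[n] i)
  upTo-cong : ∀ {i j} .{p : i ≤ K} .{q : j ≤ K} → i ≡ j → upTo i p ≡ upTo j q
  upTo-cong refl = refl
  gf : ∀ x → g (f x) ≡ x
  gf (upTo i p) = upTo-cong (Finₚ.toℕ-fromℕ< (s≤s p))

data Control (X : Set) : Set where
  acc rej qry : Control X
  st : X → Control X

Action : Set → Set
Action X = Control X × Sym × Move × Sym × Move

module Machine (X : Set) (fin : Finite X) (ini ansY ansN : Control X) (step : X → Sym → Sym → List (Action X)) where

  encode : Control X → Fin (3 + size fin)
  encode acc = 0F
  encode rej = 1F
  encode qry = 2F
  encode (st x) = suc (suc (suc (to fin x)))

  encodeAction : Action X → Fin (3 + size fin) × Sym × Move × Sym × Move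
  encodeAction (x , r) = encode x , r

  transition : Fin (3 + size fin) → Sym → Sym → List (Fin (3 + size fin) × Sym × Move × Sym × Move)
  transition (suc (suc (suc i))) a b = map encodeAction (step (from fin i) a b)
  transition _ a b = []

  machine : OTM
  machine = record
    { nStates = 3 + size fin ; start = encode ini ; accept = 0F ; reject = 1F ; query = 2F
    ; ansYes = encode ansY ; ansNo = encode ansN ; δ = transition }

  -- A record, because `Evaluates` computes away on a given control state and would leave
  -- unification no trace of the state and the tapes.
  record Runs (A : Language) (t : ℕ) (x : Control X) (w o : Tape) (n : ℕ) : Set where
    constructor runs
    field evaluates : Evaluates machine A t (config (encode x) w o) n

  open Runs public

  doAction : Tape → Tape → Action X → Config machine
  doAction w o (x , a , m , b , m') = config (encode x) (move m (write a w)) (move m' (write b o))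

  runs-mono : ∀ {A t t' x w o n} → t ≤ t' → Runs A t x w o n → Runs A t' x w o n
  runs-mono {A} {x = x} {w} {o} p (runs r) = runs (evaluates-mono machine A (config (encode x) w o) p r)

  runs-acc : ∀ {A t w o} → Runs A t acc w o 1
  runs-acc = runs (tt , refl)

  runs-rej : ∀ {A t w o} → Runs A t rej w o 0
  runs-rej = runs (tt , refl)

  runs-qry : ∀ {A t w o n} b → A (symsToWord (contents o)) ≡ b →
             Runs A t (if b then ansY else ansN) w emptyTape n → Runs A (suc t) qry w o n
  runs-qry {A} {t} {w} {o} {n} b e (runs r) = runs (go b e r)
    where
    go : ∀ b → A (symsToWord (contents o)) ≡ b →
         Evaluates machine A t (config (encode (if b then ansY else ansN)) w emptyTape) n →
         Evaluates machine A (suc t) (config (encode qry) w o) n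
    go true e r rewrite e = r
    go false e r rewrite e = r

  succs-step : ∀ x w o →
    succs machine (config (encode (st x)) w o) ≡ map (doAction w o) (step x (Tape.here w) (Tape.here o))
  succs-step x w o rewrite from-to fin x = go (step x (Tape.here w) (Tape.here o))
    where
    go : ∀ as → map (applyChoice machine (config (encode (st x)) w o)) (map encodeAction as) ≡ map (doAction w o) as
    go [] = refl
    go (a ∷ as) = cong (_ ∷_) (go as)

  runs-branch : ∀ {A t x w o n as} → step x (Tape.here w) (Tape.here o) ≡ as →
                EvaluatesAll machine A t (map (doAction w o) as) n →
                Runs A (suc t) (st x) w o n
  runs-branch {A} {t} {x} {w} {o} {n} refl r =
    runs (subst (λ cs → EvaluatesAll machine A t cs n) (sym (succs-step x w o)) r)

  runs-step : ∀ {A t x w o n y a m b m'} →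
              step x (Tape.here w) (Tape.here o) ≡ (y , a , m , b , m') ∷ [] →
              Runs A t y (move m (write a w)) (move m' (write b o)) n →
              Runs A (suc t) (st x) w o n
  runs-step e (runs (h , p)) = runs-branch e ((h , tt) , trans (ℕₚ.+-identityʳ _) p)

-- Stack programs

𝟙 : Bool → ℕ
𝟙 true = 1
𝟙 false = 0

data Instr (k : ℕ) (S : Set) : Set where
  push  : Fin k → Sym → S → Instr k S
  pop   : Fin k → (Maybe Sym → S) → Instr k S
  clear : Fin k → S → Instr k S
  nd    : List S → Instr k S
  emit  : Bool → S → Instr k S
  ask   : Instr k S
  halt  : Bool → Instr k S

-- ask ends the computation: it accepts iff the oracle's answer on the emitted word is polarity.
record Program : Set₁ where
  field
    State    : Set
    finite   : Finite State
    stacks   : ℕ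
    input    : Fin stacks
    start    : State
    polarity : Bool
    instr    : State → Instr stacks State

Store : ℕ → Set
Store k = Vec (List Sym) k

initStore : ∀ {k} → Fin k → Word → Store k
initStore input w = updateAt (Vec.replicate _ []) input (λ _ → map bitSym w)

module _ {k : ℕ} {State : Set} (instr : State → Instr k State) (polarity : Bool) (A : Language) where

  verdict : Word → Bool
  verdict out = if polarity then A out else not (A out)

  -- A derivation is a computation tree whose accepting leaves are counted by the last index. `wait`
  -- builds monotonicity in time into the relation, so that branches of different lengths share one
  -- bound.
  data Yields : ℕ → State → Store k → Word → ℕ → Set
  data YieldsInstr : ℕ → Instr k State → Store k → Word → ℕ → Set
  data YieldsAll : ℕ → List State → Store k → Word → ℕ → Set

  data Yields where
    exec : ∀ {t s σ out n} → YieldsInstr t (instr s) σ out n → Yields (suc t) s σ out n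
    wait : ∀ {t t' s σ out n} → t ≤ t' → Yields t s σ out n → Yields t' s σ out n

  data YieldsInstr where
    push  : ∀ {t s σ out n j v} → Yields t s (updateAt σ j (v ∷_)) out n → YieldsInstr t (push j v s) σ out n
    pop   : ∀ {t σ out n j κ} → Yields t (κ (head (lookup σ j))) (updateAt σ j (drop 1)) out n →
            YieldsInstr t (pop j κ) σ out n
    clear : ∀ {t s σ out n j} → Yields t s (updateAt σ j (λ _ → [])) out n → YieldsInstr t (clear j s) σ out n
    nd    : ∀ {t ss σ out n} → YieldsAll t ss σ out n → YieldsInstr t (nd ss) σ out n
    emit  : ∀ {t s σ out n b} → Yields t s σ (out ++ b ∷ []) n → YieldsInstr t (emit b s) σ out n
    ask   : ∀ {t σ out} → YieldsInstr t ask σ out (𝟙 (verdict out))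
    halt  : ∀ {t σ out b} → YieldsInstr t (halt b) σ out (𝟙 b)

  data YieldsAll where
    []  : ∀ {t σ out} → YieldsAll t [] σ out 0
    _∷_ : ∀ {t s ss σ out n m} → Yields t s σ out n → YieldsAll t ss σ out m → YieldsAll t (s ∷ ss) σ out (n + m)

-- Compilation of stack programs to machines

blanks : ℕ → List Sym
blanks n = replicate n blank

focusL focusR : List Sym → List Sym → Tape
focusL [] r = tape [] blank r
focusL (x ∷ l) r = tape l x r
focusR l [] = tape l blank []
focusR l (x ∷ r) = tape l x r

moveL : ∀ l x r → move L (tape l x r) ≡ focusL l (x ∷ r)
moveL [] x r = refl
moveL (_ ∷ l) x r = refl

moveR : ∀ l x r → move R (tape l x r) ≡ focusR (x ∷ l) r
moveR l x [] = refl
moveR l x (_ ∷ r) = refl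

focusR-blanks : ∀ l b → focusR l (blanks b) ≡ tape l blank (blanks (pred b))
focusR-blanks l zero = refl
focusR-blanks l (suc b) = refl

All-ʳ++ : ∀ {X : Set} {Q : X → Set} {xs ys} → All Q xs → All Q ys → All Q (xs ʳ++ ys)
All-ʳ++ [] qs = qs
All-ʳ++ (q ∷ ps) qs = All-ʳ++ ps (q ∷ qs)

≡ᵇ-yes : ∀ {m n} → m ≡ n → (m ≡ᵇ n) ≡ true
≡ᵇ-yes {zero} refl = refl
≡ᵇ-yes {suc m} refl = ≡ᵇ-yes {m} refl

≡ᵇ-no : ∀ {m n} → m ≢ n → (m ≡ᵇ n) ≡ false
≡ᵇ-no {m} {n} ne with m ≡ᵇ n in e
... | false = refl
... | true = ⊥-elim (ne (ℕₚ.≡ᵇ⇒≡ m n (subst T (sym e) tt)))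

-- All stacks share the work tape as a log that grows to the right: a push appends a block of K bits with a single true bit
-- at the slot of its stack and symbol, and a pop searches leftwards for the last true bit of its stack and resets it, which
-- leaves a block without true bits behind (a hole). The oracle tape first carries the input to the log, then the output.
module Compile (P : Program) where
  open Program P

  -- `K` is the number of pairs of a stack and a symbol. `hole` is the first number that is no slot,
  -- so its block has no true bit.
  K hole : ℕ
  K = stacks * 3
  hole = K

  slot : Fin stacks → Sym → ℕ
  slot j v = toℕ (combine j v)

  hit : Fin stacks → ℕ → Maybe Sym
  hit j i with slot j 0F ℕₚ.≟ i | slot j 1F ℕₚ.≟ i | slot j 2F ℕₚ.≟ i
  ... | yes _ | _ | _ = just 0F
  ... | no _ | yes _ | _ = just 1F
  ... | no _ | no _ | yes _ = just 2F
  ... | no _ | no _ | no _ = nothing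

  slot-injective : ∀ {j v j' v'} → slot j v ≡ slot j' v' → j ≡ j' × v ≡ v'
  slot-injective {j} {v} {j'} {v'} e = Finₚ.combine-injective j v j' v' (Finₚ.toℕ-injective e)

  slot<K : ∀ j v → slot j v < K
  slot<K j v = Finₚ.toℕ<n (combine j v)

  hit-nothing : ∀ {j i} → (∀ v → slot j v ≢ i) → hit j i ≡ nothing
  hit-nothing {j} {i} ne with slot j 0F ℕₚ.≟ i | slot j 1F ℕₚ.≟ i | slot j 2F ℕₚ.≟ i
  ... | yes e | _ | _ = ⊥-elim (ne 0F e)
  ... | no _ | yes e | _ = ⊥-elim (ne 1F e)
  ... | no _ | no _ | yes e = ⊥-elim (ne 2F e)
  ... | no _ | no _ | no _ = refl

  hit-just : ∀ {j i v} → hit j i ≡ just v → slot j v ≡ i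
  hit-just {j} {i} e with slot j 0F ℕₚ.≟ i | slot j 1F ℕₚ.≟ i | slot j 2F ℕₚ.≟ i
  hit-just refl | yes e | _ | _ = e
  hit-just refl | no _ | yes e | _ = e
  hit-just refl | no _ | no _ | yes e = e

  hit-hole : ∀ j → hit j hole ≡ nothing
  hit-hole j = hit-nothing λ v e → ℕₚ.<⇒≢ (slot<K j v) e

  hit-other : ∀ {j j'} v → j ≢ j' → hit j (slot j' v) ≡ nothing
  hit-other v ne = hit-nothing λ v' e → ne (proj₁ (slot-injective e))

  hit-own : ∀ j v → hit j (slot j v) ≡ just v
  hit-own j v with hit j (slot j v) in e
  ... | just v' = cong just (proj₂ (slot-injective {j} {v'} {j} {v} (hit-just e)))
  ... | nothing = ⊥-elim (absurd v e)
    where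
    absurd : ∀ v → hit j (slot j v) ≢ nothing
    absurd v e with slot j 0F ℕₚ.≟ slot j v | slot j 1F ℕₚ.≟ slot j v | slot j 2F ℕₚ.≟ slot j v
    absurd 0F e | no ne | no _ | no _ = ne refl
    absurd 1F e | no _ | no ne | no _ = ne refl
    absurd 2F e | no _ | no _ | no ne = ne refl
    absurd v () | yes _ | _ | _
    absurd v () | no _ | yes _ | _
    absurd v () | no _ | no _ | yes _

  Cont : Set
  Cont = State ⊎ ⊤

  -- `run` executes an instruction at the right end of the log; `wr` writes a block of which `i`
  -- bits are still to come; `scan` moves left through a block of which `i` cells remain; `back`
  -- returns to the right end; `load` and `unload` carry the input to the oracle tape and from there
  -- into the log.
  X : Set
  X = State ⊎ (Cont × Fin K × UpTo K) ⊎ (State × UpTo K) ⊎ State ⊎ ⊤ ⊎ ⊤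

  pattern run s      = inj₁ s
  pattern wr c e i   = inj₂ (inj₁ (c , e , i))
  pattern scan s i   = inj₂ (inj₂ (inj₁ (s , i)))
  pattern back s     = inj₂ (inj₂ (inj₂ (inj₁ s)))
  pattern load       = inj₂ (inj₂ (inj₂ (inj₂ (inj₁ tt))))
  pattern unload     = inj₂ (inj₂ (inj₂ (inj₂ (inj₂ tt))))

  abstract
    X-finite : Finite X
    X-finite = ⊎-finite finite (⊎-finite (×-finite (⊎-finite finite ⊤-finite) (×-finite (finFinite K) (UpTo-finite K)))
      (⊎-finite (×-finite finite (UpTo-finite K)) (⊎-finite finite (⊎-finite ⊤-finite ⊤-finite))))

  K≤ : UpTo K
  K≤ = upTo K ℕₚ.≤-refl

  after : Cont → X
  after (inj₁ s) = run s
  after (inj₂ _) = unload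

  bottomOf : Instr stacks State → State → State
  bottomOf (pop j κ) s = κ nothing
  bottomOf (clear j s') s = s'
  bottomOf _ s = s

  scanOne : Instr stacks State → State → (i : ℕ) → .(suc i ≤ K) → Sym → Action X
  scanOne (pop j κ) s i p b with hit j i
  ... | just v  = st (back (κ (just v))) , 1F , R , b , S
  ... | nothing = st (scan s (upTo i (ℕₚ.<⇒≤ p))) , 2F , L , b , S
  scanOne (clear j s') s i p b with hit j i
  ... | just v  = st (scan s (upTo i (ℕₚ.<⇒≤ p))) , 1F , L , b , S
  ... | nothing = st (scan s (upTo i (ℕₚ.<⇒≤ p))) , 2F , L , b , S
  scanOne _ s i p b = rej , 0F , S , b , S

  runStep : Instr stacks State → State → Sym → Sym → List (Action X)
  runStep (push j v s') s a b = (st (wr (inj₁ s') (combine j v) K≤) , a , S , b , S) ∷ []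
  runStep (pop j κ) s a b = (st (scan s (upTo 0 z≤n)) , a , L , b , S) ∷ []
  runStep (clear j s') s a b = (st (scan s (upTo 0 z≤n)) , a , L , b , S) ∷ []
  runStep (nd ss) s a b = map (λ s' → st (run s') , a , S , b , S) ss
  runStep (emit c s') s a b = (st (run s') , a , S , bitSym c , R) ∷ []
  runStep ask s a b = (qry , a , S , b , S) ∷ []
  runStep (halt true) s a b = (acc , a , S , b , S) ∷ []
  runStep (halt false) s a b = (rej , a , S , b , S) ∷ []

  step : X → Sym → Sym → List (Action X)
  step (run s) a b = runStep (instr s) s a b
  step (wr c e (upTo zero p)) a b = (st (after c) , a , S , b , S) ∷ []
  -- Slots are written in increasing order from left to right, so a leftward scan with `suc i` cells
  -- of a block to go reads slot `i`.
  step (wr c e (upTo (suc i) p)) a b =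
    (st (wr c e (upTo i (ℕₚ.<⇒≤ p))) , bitSym (toℕ e ≡ᵇ (K ∸ suc i)) , R , b , S) ∷ []
  -- Counter 0 is a boundary between blocks, where every scan starts. After the reset, the next cell
  -- is either the last of a block or the blank to the left of the log.
  step (scan s (upTo zero p)) a b = (st (scan s K≤) , a , S , b , S) ∷ []
  step (scan s (upTo (suc i) p)) 0F b = (st (back (bottomOf (instr s) s)) , 0F , R , b , S) ∷ []
  step (scan s (upTo (suc i) p)) 1F b = (st (scan s (upTo i (ℕₚ.<⇒≤ p))) , 1F , L , b , S) ∷ []
  step (scan s (upTo (suc i) p)) 2F b = scanOne (instr s) s i p b ∷ []
  step (back s) 0F b = (st (run s) , 0F , S , b , S) ∷ []
  step (back s) (suc a) b = (st (back s) , suc a , R , b , S) ∷ []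
  step load 0F b = (st unload , 0F , S , b , L) ∷ []
  step load (suc a) b = (st load , 0F , R , suc a , R) ∷ []
  step unload a 0F = (st (run start) , a , S , 0F , S) ∷ []
  -- The oracle tape is emptied from its right end: the last input symbol is pushed first, and the
  -- first one ends up on top.
  step unload a (suc v) = (st (wr (inj₂ tt) (combine input (suc v)) K≤) , a , S , 0F , L) ∷ []

  answer : Bool → Control X
  answer true = acc
  answer false = rej

  open Machine X X-finite (st load) (answer polarity) (answer (not polarity)) step public

  block : ℕ → ℕ → List Sym
  block e zero = []
  block e (suc i) = bitSym (e ≡ᵇ i) ∷ block e i

  tapeLog : List ℕ → List Sym
  tapeLog [] = []
  tapeLog (e ∷ es) = block e K ++ tapeLog es

  project : Fin stacks → List ℕ → List Sym
  project j [] = []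
  project j (e ∷ es) with hit j e
  ... | just v = v ∷ project j es
  ... | nothing = project j es

  delete : Fin stacks → List ℕ → List ℕ
  delete j [] = []
  delete j (e ∷ es) with hit j e
  ... | just v = hole ∷ es
  ... | nothing = e ∷ delete j es

  zap : Fin stacks → ℕ → ℕ
  zap j e with hit j e
  ... | just v = hole
  ... | nothing = e

  -- How many blanks lie to the right of the head depends on how much of the tape was visited
  -- before, so the continuation is required for every number of them. The blanks to the left of the
  -- log are treated in the same way below.
  write-block : ∀ {A t c e l b o n} i o' .{p : i ≤ K} → o' + i ≡ K →
    (∀ b → Runs A t (st (after c)) (tape (block (toℕ e) K ++ l) blank (blanks b)) o n) →
    Runs A (suc i + t) (st (wr c e (upTo i p))) (tape (block (toℕ e) o' ++ l) blank (blanks b)) o n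
  write-block {b = b} zero o' eq r rewrite ℕₚ.+-identityʳ o' | eq = runs-step refl (r b)
  write-block {A} {t} {c} {e} {l} {b} {o} {n} (suc i) o' eq r =
    runs-step refl (subst (λ τ → Runs A (suc i + t) _ τ o n) tape-eq
      (write-block {e = e} i (suc o') (trans (sym (ℕₚ.+-suc o' i)) eq) r))
    where
    offset : o' ≡ K ∸ suc i
    offset = trans (sym (ℕₚ.m+n∸n≡m o' (suc i))) (cong (_∸ suc i) eq)
    tape-eq : tape (block (toℕ e) (suc o') ++ l) blank (blanks (pred b))
              ≡ move R (write (bitSym (toℕ e ≡ᵇ (K ∸ suc i))) (tape (block (toℕ e) o' ++ l) blank (blanks b)))
    tape-eq rewrite moveR (block (toℕ e) o' ++ l) (bitSym (toℕ e ≡ᵇ (K ∸ suc i))) (blanks b)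
                  | focusR-blanks (bitSym (toℕ e ≡ᵇ (K ∸ suc i)) ∷ block (toℕ e) o' ++ l) b | sym offset = refl

  walk-back : ∀ {A t s l o n b} vs → All (_≢ blank) vs →
    Runs A t (st (run s)) (tape (vs ʳ++ l) blank (blanks b)) o n →
    Runs A (suc (length vs) + t) (st (back s)) (focusR l (vs ++ blank ∷ blanks b)) o n
  walk-back [] [] r = runs-step refl r
  walk-back (0F ∷ vs) (ne ∷ _) r = ⊥-elim (ne refl)
  walk-back {A} {t} {s} {l} {o} {n} {b} (suc v ∷ vs) (_ ∷ nes) r =
    runs-step refl (subst (λ τ → Runs A (suc (length vs) + t) (st (back s)) τ o n)
      (sym (moveR l (suc v) (vs ++ blank ∷ blanks b))) (walk-back vs nes r))

  return : ∀ {A t s l o n b} cs → All (_≢ blank) cs →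
    Runs A t (st (run s)) (tape (cs ++ l) blank (blanks b)) o n →
    Runs A (suc (length cs) + t) (st (back s)) (focusR l (cs ʳ++ (blank ∷ blanks b))) o n
  return {A} {t} {s} {l} {o} {n} {b} cs ne r =
    subst₂ (λ τ m → Runs A (suc m + t) (st (back s)) τ o n)
      (cong (focusR l) (sym (Listₚ.ʳ++-defn cs))) (Listₚ.length-reverse cs)
      (walk-back (reverse cs) (All-ʳ++ ne [])
        (subst (λ l' → Runs A t (st (run s)) (tape l' blank (blanks b)) o n)
          (sym (trans (Listₚ.ʳ++-defn (reverse cs)) (cong (_++ l) (Listₚ.reverse-involutive cs)))) r))

  bitSym≢blank : ∀ b → bitSym b ≢ blank
  bitSym≢blank true ()
  bitSym≢blank false ()

  block-nonblank : ∀ e i → All (_≢ blank) (block e i)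
  block-nonblank e zero = []
  block-nonblank e (suc i) = bitSym≢blank (e ≡ᵇ i) ∷ block-nonblank e i

  length-block : ∀ e i → length (block e i) ≡ i
  length-block e zero = refl
  length-block e (suc i) = cong suc (length-block e i)

  -- Serves both kinds of scan: `e'` is `e` where a pop finds nothing, and `zap j e` for a clear.
  -- `cs` collects the cells already passed, which the way back has to cross again.
  scan-block : ∀ {A t s l o n z} e e' →
    (∀ i .(p : suc i ≤ K) b → step (scan s (upTo (suc i) p)) (bitSym (e ≡ᵇ i)) b
                              ≡ (st (scan s (upTo i (ℕₚ.<⇒≤ p))) , bitSym (e' ≡ᵇ i) , L , b , S) ∷ []) →
    ∀ i .{p : i ≤ K} cs →
    Runs A t (st (scan s (upTo 0 z≤n))) (focusL l ((cs ++ block e' i) ʳ++ z)) o n →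
    Runs A (i + t) (st (scan s (upTo i p))) (focusL (block e i ++ l) (cs ʳ++ z)) o n
  scan-block {A} {t} {s} {l} {o} {n} {z} e e' h zero cs r =
    subst (λ cs → Runs A t (st (scan s (upTo 0 z≤n))) (focusL l (cs ʳ++ z)) o n) (Listₚ.++-identityʳ cs) r
  scan-block {A} {t} {s} {l} {o} {n} {z} e e' h (suc i) {p} cs r =
    runs-step (h i p _) (subst (λ τ → Runs A (i + t) (st (scan s (upTo i (ℕₚ.<⇒≤ p)))) τ o n) tape-eq
      (scan-block e e' h i (cs ++ bitSym (e' ≡ᵇ i) ∷ [])
        (subst (λ cs → Runs A t (st (scan s (upTo 0 z≤n))) (focusL l (cs ʳ++ z)) o n)
          (sym (Listₚ.++-assoc cs (bitSym (e' ≡ᵇ i) ∷ []) (block e' i))) r)))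
    where
    tape-eq : focusL (block e i ++ l) ((cs ++ bitSym (e' ≡ᵇ i) ∷ []) ʳ++ z)
              ≡ move L (tape (block e i ++ l) (bitSym (e' ≡ᵇ i)) (cs ʳ++ z))
    tape-eq rewrite moveL (block e i ++ l) (bitSym (e' ≡ᵇ i)) (cs ʳ++ z) | Listₚ.++-ʳ++ cs {bitSym (e' ≡ᵇ i) ∷ []} {z} = refl

  block-zeros : ∀ {e e'} i → i ≤ e → i ≤ e' → block e i ≡ block e' i
  block-zeros zero _ _ = refl
  block-zeros {e} {e'} (suc i) p q = cong₂ _∷_
    (cong bitSym (trans (≡ᵇ-no (ℕₚ.>⇒≢ p)) (sym (≡ᵇ-no (ℕₚ.>⇒≢ q)))))
    (block-zeros i (ℕₚ.<⇒≤ p) (ℕₚ.<⇒≤ q))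

  passing : State → (i : ℕ) → .(suc i ≤ K) → Sym → Bool → Action X
  passing s i p b x = st (scan s (upTo i (ℕₚ.<⇒≤ p))) , bitSym x , L , b , S

  scanOne-hit : ∀ {I j κ s i v b} .{p : suc i ≤ K} → I ≡ pop j κ → hit j i ≡ just v →
    scanOne I s i p b ≡ (st (back (κ (just v))) , 1F , R , b , S)
  scanOne-hit refl h rewrite h = refl

  scanOne-miss : ∀ {I j κ s i b} .{p : suc i ≤ K} → I ≡ pop j κ → hit j i ≡ nothing →
    scanOne I s i p b ≡ (st (scan s (upTo i (ℕₚ.<⇒≤ p))) , 2F , L , b , S)
  scanOne-miss refl h rewrite h = refl

  -- A block has only one true bit, so resetting it leaves the block of `hole`. The cells further
  -- left need not be read, and the head turns back at once.
  find-in-block : ∀ {A t s j κ v l o n b} e → instr s ≡ pop j κ → hit j e ≡ just v →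
    ∀ i .{p : i ≤ K} → e < i → i ≤ K → ∀ cs → All (_≢ blank) cs →
    Runs A t (st (run (κ (just v)))) (tape (cs ++ block hole i ++ l) blank (blanks b)) o n →
    Runs A (i + (suc (length cs + i) + t)) (st (scan s (upTo i p))) (focusL (block e i ++ l) (cs ʳ++ (blank ∷ blanks b))) o n
  find-in-block {A} {t} {s} {j} {κ} {v} {l} {o} {n} {b} e is h (suc i) {p} e<i i≤K cs ne r with e ℕₚ.≟ i
  ... | yes refl rewrite ≡ᵇ-yes {e} refl =
    runs-step (cong (_∷ []) (scanOne-hit is h)) (subst (λ τ → Runs A (i + (suc (length cs + suc i) + t)) (st (back (κ (just v)))) τ o n)
      (sym (moveR (block i i ++ l) 1F (cs ʳ++ (blank ∷ blanks b))))
      (runs-mono (ℕₚ.≤-trans (ℕₚ.+-monoˡ-≤ t (s≤s (ℕₚ.m≤m+n (length cs) (suc i)))) (ℕₚ.m≤n+m _ i))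
        (return cs ne (subst (λ u → Runs A t (st (run (κ (just v)))) (tape (cs ++ u ++ l) blank (blanks b)) o n) holes r))))
    where
    holes : block hole (suc i) ≡ 1F ∷ block i i
    holes = cong₂ _∷_ (cong bitSym (≡ᵇ-no (ℕₚ.>⇒≢ i≤K))) (block-zeros i (ℕₚ.<⇒≤ i≤K) ℕₚ.≤-refl)
  ... | no e≢i rewrite ≡ᵇ-no e≢i =
    runs-step refl (subst₂ (λ τ m → Runs A (i + (suc m + t)) (st (scan s (upTo i (ℕₚ.<⇒≤ p)))) τ o n)
      tape-eq time-eq
      (find-in-block e is h i (ℕₚ.≤∧≢⇒< (ℕₚ.≤-pred e<i) e≢i) (ℕₚ.<⇒≤ i≤K) (cs ++ 1F ∷ [])
        (Allₚ.++⁺ ne ((λ ()) ∷ []))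
        (subst (λ u → Runs A t (st (run (κ (just v)))) (tape u blank (blanks b)) o n) result-eq r)))
    where
    tape-eq : focusL (block e i ++ l) ((cs ++ 1F ∷ []) ʳ++ (blank ∷ blanks b))
              ≡ move L (tape (block e i ++ l) 1F (cs ʳ++ (blank ∷ blanks b)))
    tape-eq rewrite moveL (block e i ++ l) 1F (cs ʳ++ (blank ∷ blanks b)) | Listₚ.++-ʳ++ cs {1F ∷ []} {blank ∷ blanks b} = refl
    time-eq : length (cs ++ 1F ∷ []) + i ≡ length cs + suc i
    time-eq = trans (cong (_+ i) (Listₚ.length-++ cs)) (ℕₚ.+-assoc (length cs) 1 i)
    result-eq : cs ++ block hole (suc i) ++ l ≡ (cs ++ 1F ∷ []) ++ block hole i ++ l
    result-eq rewrite ≡ᵇ-no {hole} {i} (ℕₚ.>⇒≢ i≤K) = sym (Listₚ.++-assoc cs (1F ∷ []) (block hole i ++ l))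

  Q : ℕ
  Q = suc K

  scan-wrap : ∀ {A t s l o n z} →
    Runs A t (st (scan s K≤)) (focusL l z) o n → Runs A (suc t) (st (scan s (upTo 0 z≤n))) (focusL l z) o n
  scan-wrap {l = []} r = runs-step refl r
  scan-wrap {l = x ∷ l} r = runs-step refl r

  -- The left end of the log is recognized only while the counter is positive, so a reset to `K = 0`
  -- would loop forever. The input stack rules this out.
  block-nonempty : Σ ℕ λ i → K ≡ suc i
  block-nonempty = go stacks input
    where
    go : ∀ k → Fin k → Σ ℕ λ i → k * 3 ≡ suc i
    go (suc k) _ = _ , refl

  scan-bottom : ∀ {A t s o n b} a cs → All (_≢ blank) cs →
    (∀ a → Runs A t (st (run (bottomOf (instr s) s))) (tape (cs ++ blanks a) blank (blanks b)) o n) →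
    Runs A (suc (suc (suc (length cs))) + t) (st (scan s (upTo 0 z≤n))) (focusL (blanks a) (cs ʳ++ (blank ∷ blanks b))) o n
  scan-bottom {A} {t} {s} {o} {n} {b} a cs ne r = scan-wrap {l = blanks a} (at-K K ℕₚ.≤-refl (proj₂ block-nonempty) a)
    where
    land : ∀ a → Runs A (suc (length cs) + t) (st (back (bottomOf (instr s) s)))
                   (move R (tape (blanks a) blank (cs ʳ++ (blank ∷ blanks b)))) o n
    land a rewrite moveR (blanks a) blank (cs ʳ++ (blank ∷ blanks b)) = return {l = blanks (suc a)} cs ne (r (suc a))
    at-K : ∀ i .(p : i ≤ K) {i'} → i ≡ suc i' → ∀ a →
      Runs A (suc (suc (length cs) + t)) (st (scan s (upTo i p))) (focusL (blanks a) (cs ʳ++ (blank ∷ blanks b))) o n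
    at-K (suc i) p e zero = runs-step refl (land 0)
    at-K (suc i) p e (suc a) = runs-step refl (land a)

  scan-step-zero : ∀ e i s .(p : suc i ≤ K) b → e ≢ i →
    step (scan s (upTo (suc i) p)) (bitSym (e ≡ᵇ i)) b
      ≡ (st (scan s (upTo i (ℕₚ.<⇒≤ p))) , 1F , L , b , S) ∷ []
  scan-step-zero e i s p b ne rewrite ≡ᵇ-no ne = refl

  hole-other : ∀ {i} → .(suc i ≤ K) → (hole ≡ᵇ i) ≡ false
  hole-other {i} p with hole ℕₚ.≟ i
  ... | no ne = ≡ᵇ-no ne
  ... | yes e = ⊥-elim-irr (ℕₚ.<-irrefl refl (subst (λ i → suc i ≤ K) (sym e) p))

  scanOne-zap : ∀ {I j s' s i b} .{p : suc i ≤ K} → I ≡ clear j s' →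
    scanOne I s i p b ≡ (st (scan s (upTo i (ℕₚ.<⇒≤ p))) , bitSym (zap j i ≡ᵇ i) , L , b , S)
  scanOne-zap {j = j} {s = s} {i = i} {b = b} {p = p} refl with hit j i
  ... | nothing = cong (passing s i p b) (sym (≡ᵇ-yes {i} refl))
  ... | just _ = cong (passing s i p b) (sym (hole-other p))

  zap-other : ∀ j e {i} .(p : suc i ≤ K) → e ≢ i → (zap j e ≡ᵇ i) ≡ false
  zap-other j e p ne with hit j e
  ... | nothing = ≡ᵇ-no ne
  ... | just _ = hole-other p

  scan-step-zap : ∀ e s j s' → instr s ≡ clear j s' → ∀ i .(p : suc i ≤ K) b →
    step (scan s (upTo (suc i) p)) (bitSym (e ≡ᵇ i)) b
      ≡ (st (scan s (upTo i (ℕₚ.<⇒≤ p))) , bitSym (zap j e ≡ᵇ i) , L , b , S) ∷ []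
  scan-step-zap e s j s' is i p b with e ℕₚ.≟ i
  ... | no ne = trans (scan-step-zero e i s p b ne) (cong (λ x → passing s i p b x ∷ []) (sym (zap-other j e p ne)))
  ... | yes refl = trans (cong (λ x → step (scan s (upTo (suc e) p)) (bitSym x) b) (≡ᵇ-yes {e} refl))
                         (cong (_∷ []) (scanOne-zap {s = s} {p = p} is))

  scan-step-miss : ∀ e s j κ → instr s ≡ pop j κ → hit j e ≡ nothing → ∀ i .(p : suc i ≤ K) b →
    step (scan s (upTo (suc i) p)) (bitSym (e ≡ᵇ i)) b
      ≡ (st (scan s (upTo i (ℕₚ.<⇒≤ p))) , bitSym (e ≡ᵇ i) , L , b , S) ∷ []
  scan-step-miss e s j κ is h i p b with e ℕₚ.≟ i
  ... | no ne = trans (scan-step-zero e i s p b ne) (cong (λ x → passing s i p b x ∷ []) (sym (≡ᵇ-no ne)))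
  ... | yes refl = trans (cong (λ x → step (scan s (upTo (suc e) p)) (bitSym x) b) (≡ᵇ-yes {e} refl))
                         (trans (cong (_∷ []) (scanOne-miss {s = s} {p = p} is h)) (cong (λ x → passing s e p b x ∷ []) (sym (≡ᵇ-yes {e} refl))))

-- With the difference made explicit, an inequality between polynomials becomes an identity for the
-- ring solver.
≤-slack : ∀ {m n} k → m + k ≡ n → m ≤ n
≤-slack {m} k e = subst (m ≤_) e (ℕₚ.m≤m+n m k)

word-of-bits : ∀ w ys → symsToWord (map bitSym w ++ ys) ≡ w ++ symsToWord ys
word-of-bits [] ys = refl
word-of-bits (true ∷ w) ys = cong (true ∷_) (word-of-bits w ys)
word-of-bits (false ∷ w) ys = cong (false ∷_) (word-of-bits w ys)

word-of-blanks : ∀ d → symsToWord (blanks d) ≡ []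
word-of-blanks zero = refl
word-of-blanks (suc d) = word-of-blanks d

outTape : Word → ℕ → Tape
outTape out d = tape (map bitSym (reverse out)) blank (blanks d)

outTape-contents : ∀ out d → symsToWord (contents (outTape out d)) ≡ out
outTape-contents out d = begin
  symsToWord (reverse (map bitSym (reverse out)) ++ blanks (suc d))
    ≡⟨ cong (λ u → symsToWord (u ++ blanks (suc d)))
         (trans (sym (Listₚ.reverse-map bitSym (reverse out))) (cong (map bitSym) (Listₚ.reverse-involutive out))) ⟩
  symsToWord (map bitSym out ++ blanks (suc d)) ≡⟨ word-of-bits out (blanks (suc d)) ⟩
  out ++ symsToWord (blanks (suc d)) ≡⟨ cong (out ++_) (word-of-blanks d) ⟩
  out ++ [] ≡⟨ Listₚ.++-identityʳ out ⟩
  out ∎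
  where open ≡-Reasoning

outTape-emit : ∀ out b d → move R (write (bitSym b) (outTape out d)) ≡ outTape (out ++ b ∷ []) (pred d)
outTape-emit out b d = trans (moveR _ (bitSym b) (blanks d)) (trans (focusR-blanks _ d)
  (cong (λ u → tape (map bitSym u) blank (blanks (pred d))) (sym (Listₚ.reverse-++ out (b ∷ [])))))

-- Correctness and running time of the compiled machine

module CompileCorrect (P : Program) where
  open Program P
  open Compile P

  module _ {A : Language} {t : ℕ} {o : Tape} {n : ℕ} where

    -- A block costs at most `Q` steps on the way left, including the reset of the counter, and at
    -- most `Q` on the way back. The 3 pays for the reset and the turn at the left end and for the
    -- last step of `back`.
    scan-pop : ∀ {s j κ b} → instr s ≡ pop j κ → ∀ a bs cs → All (_≢ blank) cs →
      (∀ a → Runs A t (st (run (κ (head (project j bs))))) (tape (cs ++ tapeLog (delete j bs) ++ blanks a) blank (blanks b)) o n) →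
      Runs A (length bs * (2 * Q) + ((3 + length cs) + t)) (st (scan s (upTo 0 z≤n)))
        (focusL (tapeLog bs ++ blanks a) (cs ʳ++ (blank ∷ blanks b))) o n
    scan-pop {s} {j} {κ} {b} is a [] cs ne r = scan-bottom a cs ne λ a →
      subst (λ x → Runs A t (st (run x)) (tape (cs ++ blanks a) blank (blanks b)) o n) (sym bottom) (r a)
      where
      bottom : bottomOf (instr s) s ≡ κ nothing
      bottom rewrite is = refl
    scan-pop {s} {j} {κ} {b} is a (e ∷ bs) cs ne r with hit j e in h
    ... | just v = runs-mono time (scan-wrap {l = (block e K ++ tapeLog bs) ++ blanks a}
          (subst (λ l → Runs A (K + (suc (length cs + K) + t)) (st (scan s K≤)) (focusL l (cs ʳ++ (blank ∷ blanks b))) o n)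
            (sym (Listₚ.++-assoc (block e K) (tapeLog bs) (blanks a)))
            (find-in-block e is h K (subst (_< K) (hit-just h) (slot<K j v)) ℕₚ.≤-refl cs ne
              (subst (λ l → Runs A t (st (run (κ (just v)))) (tape (cs ++ l) blank (blanks b)) o n)
                (Listₚ.++-assoc (block hole K) (tapeLog bs) (blanks a)) (r a)))))
      where
      time : suc (K + (suc (length cs + K) + t)) ≤ suc (length bs) * (2 * Q) + (3 + length cs + t)
      time = ≤-slack (3 + length bs * (2 * Q)) (lem K (length cs) (length bs * (2 * Q)) t)
        where
        lem : ∀ K c x t → suc (K + (suc (c + K) + t)) + (3 + x) ≡ (suc K + (suc K + 0) + x) + (3 + c + t)
        lem = solve-∀
    ... | nothing = runs-mono time (scan-wrap {l = (block e K ++ tapeLog bs) ++ blanks a}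
          (subst (λ l → Runs A _ (st (scan s K≤)) (focusL l (cs ʳ++ (blank ∷ blanks b))) o n)
            (sym (Listₚ.++-assoc (block e K) (tapeLog bs) (blanks a)))
            (scan-block e e (scan-step-miss e s j κ is h) K cs
              (scan-pop is a bs (cs ++ block e K) (Allₚ.++⁺ ne (block-nonblank e K)) λ a →
                (subst (λ l → Runs A t (st (run (κ (head (project j bs))))) (tape l blank (blanks b)) o n)
                  (trans (cong (cs ++_) (Listₚ.++-assoc (block e K) (tapeLog (delete j bs)) (blanks a)))
                    (sym (Listₚ.++-assoc cs (block e K) _))) (r a))))))
      where
      time : suc (K + (length bs * (2 * Q) + (3 + length (cs ++ block e K) + t))) ≤ suc (length bs) * (2 * Q) + (3 + length cs + t)
      time rewrite Listₚ.length-++ cs {block e K} | length-block e K =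
        ≤-slack 1 (lem K (length cs) (length bs * (2 * Q)) t)
        where
        lem : ∀ K c x t → suc (K + (x + (3 + (c + K) + t))) + 1 ≡ (suc K + (suc K + 0) + x) + (3 + c + t)
        lem = solve-∀

    scan-clear : ∀ {s j s' b} → instr s ≡ clear j s' → ∀ a bs cs → All (_≢ blank) cs →
      (∀ a → Runs A t (st (run s')) (tape (cs ++ tapeLog (map (zap j) bs) ++ blanks a) blank (blanks b)) o n) →
      Runs A (length bs * (2 * Q) + ((3 + length cs) + t)) (st (scan s (upTo 0 z≤n)))
        (focusL (tapeLog bs ++ blanks a) (cs ʳ++ (blank ∷ blanks b))) o n
    scan-clear {s} {j} {s'} {b} is a [] cs ne r = scan-bottom a cs ne λ a →
      subst (λ x → Runs A t (st (run x)) (tape (cs ++ blanks a) blank (blanks b)) o n) (sym bottom) (r a)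
      where
      bottom : bottomOf (instr s) s ≡ s'
      bottom rewrite is = refl
    scan-clear {s} {j} {s'} {b} is a (e ∷ bs) cs ne r = runs-mono time (scan-wrap {l = (block e K ++ tapeLog bs) ++ blanks a}
      (subst (λ l → Runs A _ (st (scan s K≤)) (focusL l (cs ʳ++ (blank ∷ blanks b))) o n)
        (sym (Listₚ.++-assoc (block e K) (tapeLog bs) (blanks a)))
        (scan-block e (zap j e) (scan-step-zap e s j s' is) K cs
          (scan-clear is a bs (cs ++ block (zap j e) K) (Allₚ.++⁺ ne (block-nonblank (zap j e) K)) λ a →
            (subst (λ l → Runs A t (st (run s')) (tape l blank (blanks b)) o n)
              (trans (cong (cs ++_) (Listₚ.++-assoc (block (zap j e) K) (tapeLog (map (zap j) bs)) (blanks a)))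
                (sym (Listₚ.++-assoc cs (block (zap j e) K) _))) (r a))))))
      where
      time : suc (K + (length bs * (2 * Q) + (3 + length (cs ++ block (zap j e) K) + t))) ≤ suc (length bs) * (2 * Q) + (3 + length cs + t)
      time rewrite Listₚ.length-++ cs {block (zap j e) K} | length-block (zap j e) K =
        ≤-slack 1 (lem K (length cs) (length bs * (2 * Q)) t)
        where
        lem : ∀ K c x t → suc (K + (x + (3 + (c + K) + t))) + 1 ≡ (suc K + (suc K + 0) + x) + (3 + c + t)
        lem = solve-∀

  record Represents (σ : Store stacks) (bs : List ℕ) : Set where
    constructor represents
    field stack : ∀ j → lookup σ j ≡ project j bs

  open Represents

  project-slot-own : ∀ j v bs → project j (slot j v ∷ bs) ≡ v ∷ project j bs
  project-slot-own j v bs rewrite hit-own j v = refl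

  project-slot-other : ∀ {j j'} v bs → j ≢ j' → project j (slot j' v ∷ bs) ≡ project j bs
  project-slot-other v bs ne rewrite hit-other v ne = refl

  project-hole : ∀ j bs → project j (hole ∷ bs) ≡ project j bs
  project-hole j bs rewrite hit-hole j = refl

  hit-unique : ∀ {j j' e v} → j ≢ j' → hit j' e ≡ just v → hit j e ≡ nothing
  hit-unique {v = v} ne h = trans (cong (hit _) (sym (hit-just h))) (hit-other v ne)

  project-delete-own : ∀ j bs → project j (delete j bs) ≡ drop 1 (project j bs)
  project-delete-own j [] = refl
  project-delete-own j (e ∷ bs) with hit j e in h
  ... | just v = project-hole j bs
  ... | nothing rewrite h = project-delete-own j bs

  project-delete-other : ∀ {j j'} bs → j ≢ j' → project j (delete j' bs) ≡ project j bs
  project-delete-other [] ne = refl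
  project-delete-other {j} {j'} (e ∷ bs) ne with hit j' e in h
  ... | just v rewrite hit-unique ne h = project-hole j bs
  ... | nothing with hit j e
  ...   | just v = cong (v ∷_) (project-delete-other bs ne)
  ...   | nothing = project-delete-other bs ne

  project-zap-own : ∀ j bs → project j (map (zap j) bs) ≡ []
  project-zap-own j [] = refl
  project-zap-own j (e ∷ bs) with hit j e in h
  ... | just v = trans (project-hole j (map (zap j) bs)) (project-zap-own j bs)
  ... | nothing rewrite h = project-zap-own j bs

  project-zap-other : ∀ {j j'} bs → j ≢ j' → project j (map (zap j') bs) ≡ project j bs
  project-zap-other [] ne = refl
  project-zap-other {j} {j'} (e ∷ bs) ne with hit j' e in h
  ... | just v rewrite hit-unique ne h = trans (project-hole j (map (zap j') bs)) (project-zap-other bs ne)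
  ... | nothing with hit j e
  ...   | just v = cong (v ∷_) (project-zap-other bs ne)
  ...   | nothing = project-zap-other bs ne

  represents-update : ∀ {σ bs bs' f} j → Represents σ bs → f (project j bs) ≡ project j bs' →
    (∀ {j'} → j' ≢ j → project j' bs' ≡ project j' bs) → Represents (updateAt σ j f) bs'
  represents-update {σ} {bs} {bs'} {f} j rep own other = represents go
    where
    go : ∀ j' → lookup (updateAt σ j f) j' ≡ project j' bs'
    go j' with j' ≟ j
    ... | yes refl = trans (Vecₚ.lookup∘updateAt j' σ) (trans (cong f (stack rep j')) own)
    ... | no ne = trans (Vecₚ.lookup∘updateAt′ j' j ne σ) (trans (stack rep j') (sym (other ne)))

  length-delete : ∀ j bs → length (delete j bs) ≡ length bs
  length-delete j [] = refl
  length-delete j (e ∷ bs) with hit j e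
  ... | just v = refl
  ... | nothing = cong suc (length-delete j bs)

  C : ℕ
  C = 2 * Q + 4

  -- `N` bounds the length of the log. Holes are never reclaimed, but an instruction adds at most
  -- one block, so during `t` instructions a scan crosses at most `N + t` blocks. The slowdown is
  -- therefore quadratic.
  cost : ℕ → ℕ → ℕ
  cost t N = t * (C * suc (N + t))

  cost-mono : ∀ {t t' N N'} → t ≤ t' → N ≤ N' → cost t N ≤ cost t' N'
  cost-mono p q = ℕₚ.*-mono-≤ p (ℕₚ.*-monoʳ-≤ C (s≤s (ℕₚ.+-mono-≤ q p)))

  cost-step : ∀ {x t N N'} → x ≤ C * suc N → N' ≤ suc N → x + cost t N' ≤ cost (suc t) N
  cost-step {x} {t} {N} {N'} p q = ℕₚ.+-mono-≤
    (ℕₚ.≤-trans p (ℕₚ.*-monoʳ-≤ C (s≤s (ℕₚ.m≤m+n N (suc t)))))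
    (ℕₚ.*-monoʳ-≤ t (ℕₚ.*-monoʳ-≤ C (s≤s (subst (N' + t ≤_) (sym (ℕₚ.+-suc N t)) (ℕₚ.+-monoˡ-≤ t q)))))

  small-step : ∀ {x} N → x ≤ Q + 4 → x ≤ C * suc N
  small-step {x} N p = ℕₚ.≤-trans p (ℕₚ.≤-trans (ℕₚ.+-monoˡ-≤ 4 (ℕₚ.m≤m+n Q (Q + 0)))
    (ℕₚ.≤-trans (ℕₚ.≤-reflexive (sym (ℕₚ.*-identityʳ C))) (ℕₚ.*-monoʳ-≤ C (s≤s (z≤n {N})))))

  scan-step : ∀ {m N} → m ≤ N → suc (m * (2 * Q) + 3) ≤ C * suc N
  scan-step {m} {N} p = ℕₚ.≤-trans (s≤s (ℕₚ.+-monoˡ-≤ 3 (ℕₚ.*-monoˡ-≤ (2 * Q) p)))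
    (≤-slack (2 * Q + 4 * N) (lem Q N))
    where
    lem : ∀ Q N → suc (N * (2 * Q) + 3) + (2 * Q + 4 * N) ≡ (2 * Q + 4) * suc N
    lem = solve-∀

  answered : ∀ {A t w o} b → (polarity ≡ b) → ∀ out → A (symsToWord (contents o)) ≡ A out →
    Runs A (suc t) qry w o (𝟙 (if polarity then A out else not (A out)))
  answered {A} {t} {w} {o} b p out e = runs-qry (A out) e (final polarity (A out))
    where
    final : ∀ p b → Runs A t (if b then answer p else answer (not p)) w emptyTape (𝟙 (if p then b else not b))
    final true true = runs-acc
    final true false = runs-rej
    final false true = runs-rej
    final false false = runs-acc

  module _ {A : Language} where

    compiled : ∀ {t s σ out n bs N} → Yields instr polarity A t s σ out n → Represents σ bs → length bs ≤ N → ∀ a b d →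
      Runs A (cost t N) (st (run s)) (tape (tapeLog bs ++ blanks a) blank (blanks b)) (outTape out d) n
    compiledInstr : ∀ {t s σ out n bs N I} → instr s ≡ I → YieldsInstr instr polarity A t I σ out n → Represents σ bs → length bs ≤ N → ∀ a b d →
      Runs A (cost (suc t) N) (st (run s)) (tape (tapeLog bs ++ blanks a) blank (blanks b)) (outTape out d) n
    compiledAll : ∀ {t ss σ out n bs N} → YieldsAll instr polarity A t ss σ out n → Represents σ bs → length bs ≤ N → ∀ a b d →
      EvaluatesAll machine A (cost t N)
        (map (doAction (tape (tapeLog bs ++ blanks a) blank (blanks b)) (outTape out d))
          (map (λ s → st (run s) , blank , S , blank , S) ss)) n

    compiled (exec y) rep len a b d = compiledInstr refl y rep len a b d
    compiled (wait p y) rep len a b d = runs-mono (cost-mono p ℕₚ.≤-refl) (compiled y rep len a b d)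

    compiledInstr {t} {s} {σ} {out} {n} {bs} {N} is (push {s = s'} {j = j} {v = v} y) rep len a b d =
      runs-mono (cost-step {suc (suc K)} {t} {N} {suc N} (small-step N (≤-slack 3 (lem K))) ℕₚ.≤-refl)
        (runs-step (cong (λ I → runStep I s blank blank) is)
          (write-block {e = combine j v} K 0 refl λ b →
            subst (λ l → Runs A (cost t (suc N)) (st (run s')) (tape l blank (blanks b)) (outTape out d) n)
              (Listₚ.++-assoc (block (slot j v) K) (tapeLog bs) (blanks a))
              (compiled y (represents-update j rep (sym (project-slot-own j v bs)) (project-slot-other v bs)) (s≤s len) a b d)))
      where
      lem : ∀ K → suc (suc K) + 3 ≡ suc K + 4
      lem = solve-∀
    compiledInstr {t} {s} {σ} {out} {n} {bs} {N} is (pop {j = j} {κ = κ} y) rep len a b d =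
      runs-mono (cost-step {suc (length bs * (2 * Q) + 3)} {t} {N} {N} (scan-step len) (ℕₚ.n≤1+n N))
        (runs-step (cong (λ I → runStep I s blank blank) is)
          (subst₂ (λ m τ → Runs A m (st (scan s (upTo 0 z≤n))) τ (outTape out d) n)
            (sym (ℕₚ.+-assoc (length bs * (2 * Q)) 3 (cost t N)))
            (sym (moveL (tapeLog bs ++ blanks a) blank (blanks b)))
            (scan-pop is a bs [] [] λ a →
              subst (λ x → Runs A (cost t N) (st (run (κ (head x)))) (tape (tapeLog (delete j bs) ++ blanks a) blank (blanks b)) (outTape out d) n)
                (stack rep j) (compiled y (represents-update {bs' = delete j bs} j rep (sym (project-delete-own j bs)) (project-delete-other bs))
                  (subst (_≤ N) (sym (length-delete j bs)) len) a b d))))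
    compiledInstr {t} {s} {σ} {out} {n} {bs} {N} is (clear {j = j} y) rep len a b d =
      runs-mono (cost-step {suc (length bs * (2 * Q) + 3)} {t} {N} {N} (scan-step len) (ℕₚ.n≤1+n N))
        (runs-step (cong (λ I → runStep I s blank blank) is)
          (subst₂ (λ m τ → Runs A m (st (scan s (upTo 0 z≤n))) τ (outTape out d) n)
            (sym (ℕₚ.+-assoc (length bs * (2 * Q)) 3 (cost t N)))
            (sym (moveL (tapeLog bs ++ blanks a) blank (blanks b)))
            (scan-clear is a bs [] [] λ a →
              compiled y (represents-update {bs' = map (zap j) bs} j rep (sym (project-zap-own j bs)) (project-zap-other bs))
                (subst (_≤ N) (sym (Listₚ.length-map (zap j) bs)) len) a b d)))
    compiledInstr {t} {s} {N = N} is (nd y) rep len a b d =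
      runs-mono (cost-step {1} {t} {N} {N} (small-step N (s≤s z≤n)) (ℕₚ.n≤1+n N))
        (runs-branch (cong (λ I → runStep I s blank blank) is) (compiledAll y rep len a b d))
    compiledInstr {t} {s} {σ} {out} {n} {bs} {N} is (emit {s = s'} {b = x} y) rep len a b d =
      runs-mono (cost-step {1} {t} {N} {N} (small-step N (s≤s z≤n)) (ℕₚ.n≤1+n N))
        (runs-step (cong (λ I → runStep I s blank blank) is)
          (subst (λ τ → Runs A (cost t N) (st (run s')) (tape (tapeLog bs ++ blanks a) blank (blanks b)) τ n)
            (sym (outTape-emit out x d)) (compiled y rep len a b (pred d))))
    compiledInstr {t} {s} {out = out} {N = N} is ask rep len a b d =
      runs-mono (ℕₚ.≤-trans (s≤s (s≤s z≤n)) (cost-step {2} {t} {N} {N} (small-step N (s≤s (ℕₚ.≤-trans (s≤s z≤n) (ℕₚ.m≤n+m 4 K)))) (ℕₚ.n≤1+n N)))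
        (runs-step (cong (λ I → runStep I s blank blank) is) (answered {t = 0} polarity refl out (cong A (outTape-contents out d))))
    compiledInstr {t} {s} {N = N} is (halt {b = true}) rep len a b d =
      runs-mono (cost-step {1} {t} {N} {N} (small-step N (s≤s z≤n)) (ℕₚ.n≤1+n N))
        (runs-step (cong (λ I → runStep I s blank blank) is) runs-acc)
    compiledInstr {t} {s} {N = N} is (halt {b = false}) rep len a b d =
      runs-mono (cost-step {1} {t} {N} {N} (small-step N (s≤s z≤n)) (ℕₚ.n≤1+n N))
        (runs-step (cong (λ I → runStep I s blank blank) is) runs-rej)

    compiledAll [] rep len a b d = tt , refl
    compiledAll (y ∷ ys) rep len a b d = (proj₁ p , proj₁ ps) , cong₂ _+_ (proj₂ p) (proj₂ ps)
      where
      p = Runs.evaluates (compiled y rep len a b d)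
      ps = compiledAll ys rep len a b d

  initial-log : Word → List ℕ
  initial-log w = map (λ b → slot input (bitSym b)) w

  project-initial : ∀ w → project input (initial-log w) ≡ map bitSym w
  project-initial [] = refl
  project-initial (b ∷ w) = trans (project-slot-own input (bitSym b) (initial-log w)) (cong (bitSym b ∷_) (project-initial w))

  project-initial-other : ∀ {j} w → j ≢ input → project j (initial-log w) ≡ []
  project-initial-other [] ne = refl
  project-initial-other (b ∷ w) ne = trans (project-slot-other (bitSym b) (initial-log w) ne) (project-initial-other w ne)

  initial-represents : ∀ w → Represents (initStore input w) (initial-log w)
  initial-represents w = represents-update {bs = []} input (represents λ j → Vecₚ.lookup-replicate j [])
    (sym (project-initial w)) (λ ne → project-initial-other w ne)

  -- Loading takes `m + 1` steps. Each symbol then takes one step to be read back and `K + 1` to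
  -- write its block, and one more step detects the end.
  total : ℕ → ℕ → ℕ
  total m t = suc m + (m * (K + 2) + suc (cost t m))

  module _ {A : Language} where

    unloading : ∀ {t n a} rs w b d →
      (∀ b d → Runs A t (st (run start)) (tape (tapeLog (initial-log (rs ʳ++ w)) ++ blanks a) blank (blanks b)) (outTape [] d) n) →
      Runs A (length rs * (K + 2) + suc t) (st unload)
        (tape (tapeLog (initial-log w) ++ blanks a) blank (blanks b)) (focusL (map bitSym rs) (blanks d)) n
    unloading [] w b d r = runs-step refl (r b d)
    unloading {t} {n} {a} (x ∷ rs) w b d r = runs-mono time (pushed x refl)
      where
      time : suc (suc K + (length rs * (K + 2) + suc t)) ≤ (K + 2) + length rs * (K + 2) + suc t
      time = ≤-slack 0 (lem K (length rs * (K + 2)) (suc t))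
        where
        lem : ∀ K x t → suc (suc K + (x + t)) + 0 ≡ (K + 2) + x + t
        lem = solve-∀
      written : Runs A (suc K + (length rs * (K + 2) + suc t)) (st (wr (inj₂ tt) (combine input (bitSym x)) K≤))
        (tape (tapeLog (initial-log w) ++ blanks a) blank (blanks b)) (move L (tape (map bitSym rs) blank (blanks d))) n
      written rewrite moveL (map bitSym rs) blank (blanks d) = write-block {e = combine input (bitSym x)} K 0 refl λ b →
        subst (λ l → Runs A _ (st unload) (tape l blank (blanks b)) (focusL (map bitSym rs) (blanks (suc d))) n)
          (Listₚ.++-assoc (block (slot input (bitSym x)) K) (tapeLog (initial-log w)) (blanks a))
          (unloading rs (x ∷ w) b (suc d) r)
      pushed : ∀ y → x ≡ y → Runs A (suc (suc K + (length rs * (K + 2) + suc t))) (st unload)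
        (tape (tapeLog (initial-log w) ++ blanks a) blank (blanks b)) (tape (map bitSym rs) (bitSym x) (blanks d)) n
      pushed true refl = runs-step refl written
      pushed false refl = runs-step refl written

    loading : ∀ {t n} w u a →
      Runs A t (st unload) (tape (blanks (length w + a)) blank []) (focusL (map bitSym (w ʳ++ u)) (blanks 1)) n →
      Runs A (suc (length w) + t) (st load) (focusR (blanks a) (map bitSym w)) (tape (map bitSym u) blank []) n
    loading {t} {n} [] u a r = runs-step refl
      (subst (λ τ → Runs A t (st unload) (tape (blanks a) blank []) τ n) (sym (moveL (map bitSym u) blank [])) r)
    loading {t} {n} (x ∷ w) u a r = step-right x refl
      where
      next : Runs A (suc (length w) + t) (st load) (move R (tape (blanks a) blank (map bitSym w))) (tape (bitSym x ∷ map bitSym u) blank []) n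
      next rewrite moveR (blanks a) blank (map bitSym w) = loading w (x ∷ u) (suc a)
        (subst (λ m → Runs A t (st unload) (tape (blanks m) blank []) (focusL (map bitSym (w ʳ++ (x ∷ u))) (blanks 1)) n)
          (sym (ℕₚ.+-suc (length w) a)) r)
      step-right : ∀ y → x ≡ y → Runs A (suc (suc (length w) + t)) (st load) (focusR (blanks a) (map bitSym (x ∷ w))) (tape (map bitSym u) blank []) n
      step-right true refl = runs-step refl next
      step-right false refl = runs-step refl next

    program-runs : ∀ {t n} w → Yields instr polarity A t start (initStore input w) [] n →
      Runs A (total (length w) t) (st load) (inputTape w) emptyTape n
    program-runs {t} {n} w y = subst (λ τ → Runs A (total (length w) t) (st load) τ emptyTape n) (input-focus w)
      (loading w [] 0 (subst₂ (λ m k → Runs A m (st unload) (tape (blanks k) blank []) (focusL (map bitSym (reverse w)) (blanks 1)) n)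
        (cong (λ m → m * (K + 2) + suc (cost t (length w))) (Listₚ.length-reverse w)) (sym (ℕₚ.+-identityʳ (length w)))
        (unloading (reverse w) [] 0 1 λ b d →
          subst (λ u → Runs A (cost t (length w)) (st (run start)) (tape (tapeLog (initial-log u) ++ blanks (length w)) blank (blanks b)) (outTape [] d) n)
            (sym (Listₚ.reverse-involutive w))
            (compiled y (initial-represents w) (ℕₚ.≤-reflexive (Listₚ.length-map _ w)) (length w) b d))))
      where
      input-focus : ∀ w → focusR [] (map bitSym w) ≡ inputTape w
      input-focus [] = refl
      input-focus (b ∷ w) = refl

-- Polynomial bounds

-- The base `suc n` is positive, so exponents can be raised freely and a constant needs no separate
-- summand, unlike in `poly`.
PolyBounded : (ℕ → ℕ) → Set
PolyBounded τ = Σ ℕ λ c → Σ ℕ λ k → ∀ n → τ n ≤ c * suc n ^ k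

1≤^ : ∀ n k → 1 ≤ suc n ^ k
1≤^ n k = ℕₚ.m^n>0 (suc n) k

^-distribʳ-* : ∀ m n k → (m * n) ^ k ≡ m ^ k * n ^ k
^-distribʳ-* m n zero = refl
^-distribʳ-* m n (suc k) = trans (cong (m * n *_) (^-distribʳ-* m n k)) (lem m n (m ^ k) (n ^ k))
  where
  lem : ∀ m n x y → m * n * (x * y) ≡ (m * x) * (n * y)
  lem = solve-∀

^-extendˡ : ∀ n k k' → suc n ^ k ≤ suc n ^ (k + k')
^-extendˡ n k k' = ℕₚ.^-monoʳ-≤ (suc n) (ℕₚ.m≤m+n k k')

^-extendʳ : ∀ n k k' → suc n ^ k' ≤ suc n ^ (k + k')
^-extendʳ n k k' = ℕₚ.^-monoʳ-≤ (suc n) (ℕₚ.m≤n+m k' k)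

pb-mono : ∀ {σ τ} → (∀ n → σ n ≤ τ n) → PolyBounded τ → PolyBounded σ
pb-mono p (c , k , b) = c , k , λ n → ℕₚ.≤-trans (p n) (b n)

pb-const : ∀ a → PolyBounded (λ _ → a)
pb-const a = a , 0 , λ n → ℕₚ.≤-reflexive (sym (ℕₚ.*-identityʳ a))

pb-id : PolyBounded (λ n → n)
pb-id = 1 , 1 , λ n → ℕₚ.≤-trans (ℕₚ.n≤1+n n) (ℕₚ.≤-reflexive (sym (trans (ℕₚ.+-identityʳ _) (ℕₚ.*-identityʳ (suc n)))))

pb-+ : ∀ {σ τ} → PolyBounded σ → PolyBounded τ → PolyBounded (λ n → σ n + τ n)
pb-+ (c , k , b) (c' , k' , b') = c + c' , k + k' , λ n → ℕₚ.≤-trans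
  (ℕₚ.+-mono-≤ (ℕₚ.≤-trans (b n) (ℕₚ.*-monoʳ-≤ c (^-extendˡ n k k'))) (ℕₚ.≤-trans (b' n) (ℕₚ.*-monoʳ-≤ c' (^-extendʳ n k k'))))
  (ℕₚ.≤-reflexive (sym (ℕₚ.*-distribʳ-+ (suc n ^ (k + k')) c c')))

pb-* : ∀ {σ τ} → PolyBounded σ → PolyBounded τ → PolyBounded (λ n → σ n * τ n)
pb-* (c , k , b) (c' , k' , b') = c * c' , k + k' , λ n → ℕₚ.≤-trans (ℕₚ.*-mono-≤ (b n) (b' n))
  (ℕₚ.≤-reflexive (trans (lem c c' (suc n ^ k) (suc n ^ k')) (cong (c * c' *_) (sym (ℕₚ.^-distribˡ-+-* (suc n) k k')))))
  where
  lem : ∀ c c' x y → c * x * (c' * y) ≡ c * c' * (x * y)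
  lem = solve-∀

pb-^ : ∀ {σ} → PolyBounded σ → ∀ k → PolyBounded (λ n → σ n ^ k)
pb-^ p zero = pb-const 1
pb-^ p (suc k) = pb-* p (pb-^ p k)

pb-suc : ∀ {σ} → PolyBounded σ → PolyBounded (λ n → suc (σ n))
pb-suc p = pb-+ (pb-const 1) p

pb-∘ : ∀ {σ τ} → PolyBounded τ → PolyBounded σ → PolyBounded (λ n → τ (σ n))
pb-∘ {σ} {τ} (c , k , b) p = pb-mono (λ n → b (σ n)) (pb-* (pb-const c) (pb-^ (pb-suc p) k))

pb-poly : ∀ c k → PolyBounded (poly c k)
pb-poly c k = pb-+ (pb-* (pb-const c) (pb-^ pb-id k)) (pb-const c)

-- For positive `n`, `n + 1` is at most `2 * n`, which costs the factor `2 ^ k`. At 0 the additive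
-- constant of `poly` takes over.
pb⇒poly : ∀ {τ} → PolyBounded τ → Σ ℕ λ c → Σ ℕ λ k → ∀ n → τ n ≤ poly c k n
pb⇒poly {τ} (c , k , b) = c * 2 ^ k , k , λ n → ℕₚ.≤-trans (b n) (bound n)
  where
  bound : ∀ n → c * suc n ^ k ≤ poly (c * 2 ^ k) k n
  bound zero = ℕₚ.≤-trans (ℕₚ.*-monoʳ-≤ c (ℕₚ.≤-trans (ℕₚ.≤-reflexive (ℕₚ.^-zeroˡ k)) (1≤^ 1 k))) (ℕₚ.m≤n+m (c * 2 ^ k) _)
  bound (suc n) = ℕₚ.≤-trans (ℕₚ.*-monoʳ-≤ c (ℕₚ.^-monoˡ-≤ k (≤-slack n (lem n))))
    (ℕₚ.≤-trans (ℕₚ.≤-reflexive (trans (cong (c *_) (^-distribʳ-* 2 (suc n) k)) (sym (ℕₚ.*-assoc c (2 ^ k) (suc n ^ k)))))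
      (ℕₚ.m≤m+n _ (c * 2 ^ k)))
    where
    lem : ∀ n → suc (suc n) + n ≡ 2 * suc n
    lem = solve-∀

compile : ∀ P A {τ f} → PolyBounded τ →
  (∀ w → Yields (Program.instr P) (Program.polarity P) A (τ (length w)) (Program.start P) (initStore (Program.input P) w) [] (f w)) → SharpP^ A f
compile P A {τ} {f} pb y = machine , c , k , (λ w → proj₁ (ev w)) , (λ w → proj₂ (ev w))
  where
  open Program P
  open Compile P
  open CompileCorrect P
  pb-total : PolyBounded (λ n → total n (τ n))
  pb-total = pb-+ (pb-suc pb-id) (pb-+ (pb-* pb-id (pb-const (K + 2)))
    (pb-suc (pb-* pb (pb-* (pb-const C) (pb-suc (pb-+ pb-id pb))))))
  c = proj₁ (pb⇒poly pb-total)
  k = proj₁ (proj₂ (pb⇒poly pb-total))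
  ev : ∀ w → Evaluates machine A (poly c k (length w)) (initConfig machine w) (f w)
  ev w = Runs.evaluates (runs-mono (proj₂ (proj₂ (pb⇒poly pb-total)) (length w)) (program-runs w (y w)))

-- Simulation of machines by stack programs

data Kind : Set where
  accepting rejecting querying ordinary : Kind

-- The distinguished states of a machine may coincide, so the tests come in the order of
-- `HaltsWithin` and `countAcc`.
kind : ∀ M → Fin (OTM.nStates M) → Kind
kind M q with q ≟ OTM.accept M | q ≟ OTM.reject M | q ≟ OTM.query M
... | yes _ | _     | _     = accepting
... | no _  | yes _ | _     = rejecting
... | no _  | no _  | yes _ = querying
... | no _  | no _  | no _  = ordinary

kind-accepting : ∀ M {q} → q ≡ OTM.accept M → kind M q ≡ accepting
kind-accepting M {q} e with q ≟ OTM.accept M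
... | yes _ = refl
... | no ne = ⊥-elim (ne e)

kind-rejecting : ∀ M {q} → q ≢ OTM.accept M → q ≡ OTM.reject M → kind M q ≡ rejecting
kind-rejecting M {q} na e with q ≟ OTM.accept M | q ≟ OTM.reject M
... | yes a | _ = ⊥-elim (na a)
... | no _ | yes _ = refl
... | no _ | no ne = ⊥-elim (ne e)

kind-querying : ∀ M {q} → q ≢ OTM.accept M → q ≢ OTM.reject M → q ≡ OTM.query M → kind M q ≡ querying
kind-querying M {q} na nr e with q ≟ OTM.accept M | q ≟ OTM.reject M | q ≟ OTM.query M
... | yes a | _ | _ = ⊥-elim (na a)
... | no _ | yes r | _ = ⊥-elim (nr r)
... | no _ | no _ | yes _ = refl
... | no _ | no _ | no ne = ⊥-elim (ne e)

kind-ordinary : ∀ M {q} → q ≢ OTM.accept M → q ≢ OTM.reject M → q ≢ OTM.query M → kind M q ≡ ordinary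
kind-ordinary M {q} na nr nq with q ≟ OTM.accept M | q ≟ OTM.reject M | q ≟ OTM.query M
... | yes a | _ | _ = ⊥-elim (na a)
... | no _ | yes r | _ = ⊥-elim (nr r)
... | no _ | no _ | yes e = ⊥-elim (nq e)
... | no _ | no _ | no _ = refl

data Outcome (M : OTM) (A : Language) : ℕ → Config M → ℕ → Set where
  accepted : ∀ {t c} → kind M (Config.state c) ≡ accepting → Outcome M A t c 1
  rejected : ∀ {t c} → kind M (Config.state c) ≡ rejecting → Outcome M A t c 0
  queried  : ∀ {t c n} → kind M (Config.state c) ≡ querying →
             Evaluates M A t (queryStep M A c) n → Outcome M A (suc t) c n
  branched : ∀ {t c n} → kind M (Config.state c) ≡ ordinary →
             EvaluatesAll M A t (succs M c) n → Outcome M A (suc t) c n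

outcome : ∀ M A t c n → Evaluates M A t c n → Outcome M A t c n
outcome M A t c n (h , e) with Config.state c ≟ OTM.accept M | Config.state c ≟ OTM.reject M
outcome M A t c n (h , refl) | yes a | _ = accepted (kind-accepting M a)
outcome M A t c n (h , refl) | no na | yes r = rejected (kind-rejecting M na r)
outcome M A (suc t) c n (h , e) | no na | no nr with Config.state c ≟ OTM.query M
... | yes q = queried (kind-querying M na nr q) (h , e)
... | no nq = branched (kind-ordinary M na nr nq) (h , e)

Sym-finite : Finite Sym
Sym-finite = finFinite 3

Move-finite : Finite Move
Move-finite = retractFinite (finFinite 3) (λ { L → 0F ; R → 1F ; S → 2F }) (λ { 0F → L ; 1F → R ; 2F → S })
  (λ { L → refl ; R → refl ; S → refl })

bitValue : Sym → Bool
bitValue 2F = true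
bitValue _ = false

bitValue-bitSym : ∀ b → bitValue (bitSym b) ≡ b
bitValue-bitSym true = refl
bitValue-bitSym false = refl

-- A tape always has a scanned cell, but the stack of the cells from the head on may be empty. `end`
-- lets the empty stack stand for a blank at the right end.
data Holds : Tape → List Sym → List Sym → Set where
  cells : ∀ {l h r} → Holds (tape l h r) l (h ∷ r)
  end   : ∀ {l} → Holds (tape l blank []) l []

orBlank : Maybe Sym → Sym
orBlank = fromMaybe blank

holds-here : ∀ {w l r} → Holds w l r → orBlank (head r) ≡ Tape.here w
holds-here cells = refl
holds-here end = refl

holds-right : ∀ {w l r} → Holds w l r → drop 1 r ≡ Tape.right w
holds-right cells = refl
holds-right end = refl

holds-left : ∀ {w l r} → Holds w l r → l ≡ Tape.left w
holds-left cells = refl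
holds-left end = refl

input-holds : ∀ w → Holds (inputTape w) [] (map bitSym w)
input-holds [] = end
input-holds (b ∷ w) = cells

holds-moveR : ∀ l s r → Holds (move R (tape l s r)) (s ∷ l) r
holds-moveR l s [] = end
holds-moveR l s (x ∷ r) = cells

holds-moveL : ∀ l s r → Holds (move L (tape l s r)) (drop 1 l) (orBlank (head l) ∷ s ∷ r)
holds-moveL [] s r = cells
holds-moveL (x ∷ l) s r = cells

module Simulation (M : OTM) where
  open OTM M using (nStates; δ)

  State : Set
  State = Fin nStates

  Micro : Set
  Micro = (State × Sym) ⊎ ⊤ ⊎
          (State × Sym × Move × Sym × Move) ⊎ (State × Sym × Move) ⊎ (Sym × State × Sym × Move) ⊎
          (State × Sym × Move) ⊎ State ⊎ (Sym × State)

  pattern read q a        = inj₁ (q , a)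
  pattern wipe            = inj₂ (inj₁ tt)
  pattern apply ch        = inj₂ (inj₂ (inj₁ ch))
  pattern popW q so mo    = inj₂ (inj₂ (inj₂ (inj₁ (q , so , mo))))
  pattern pushW x q so mo = inj₂ (inj₂ (inj₂ (inj₂ (inj₁ (x , q , so , mo)))))
  pattern applyO q so mo  = inj₂ (inj₂ (inj₂ (inj₂ (inj₂ (inj₁ (q , so , mo))))))
  pattern popO q          = inj₂ (inj₂ (inj₂ (inj₂ (inj₂ (inj₂ (inj₁ q))))))
  pattern pushO x q       = inj₂ (inj₂ (inj₂ (inj₂ (inj₂ (inj₂ (inj₂ (x , q)))))))

  state-finite : Finite State
  state-finite = finFinite nStates

  micro-finite : Finite Micro
  micro-finite = ⊎-finite (×-finite state-finite Sym-finite) (⊎-finite ⊤-finite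
    (⊎-finite (×-finite state-finite (×-finite Sym-finite (×-finite Move-finite (×-finite Sym-finite Move-finite))))
    (⊎-finite (×-finite state-finite (×-finite Sym-finite Move-finite))
    (⊎-finite (×-finite Sym-finite (×-finite state-finite (×-finite Sym-finite Move-finite)))
    (⊎-finite (×-finite state-finite (×-finite Sym-finite Move-finite))
    (⊎-finite state-finite (×-finite Sym-finite state-finite)))))))

  -- Stacks 1 and 2 hold the cells left of the work head and those from the head on; stacks 3 and 4 do so for the oracle tape.
  module Fragment {r : ℕ} {H : Set} (micro : Micro → H) (ready : State → H) (got : State → Sym → Sym → H) where

    readInstr : State → Instr (5 + r) H
    readInstr q = pop 2F λ m → micro (read q (orBlank m))

    -- The simulated machines have the empty oracle, so a query amounts to resetting the oracle tape
    -- and continuing with the answer no.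
    wipeInstr : Instr (5 + r) H
    wipeInstr = clear 3F (micro wipe)

    microInstr : Micro → Instr (5 + r) H
    microInstr (read q a) = pop 4F λ m → got q a (orBlank m)
    microInstr wipe = clear 4F (ready (OTM.ansNo M))
    microInstr (apply (q , sw , L , so , mo)) = push 2F sw (micro (popW q so mo))
    microInstr (apply (q , sw , R , so , mo)) = push 1F sw (micro (applyO q so mo))
    microInstr (apply (q , sw , S , so , mo)) = push 2F sw (micro (applyO q so mo))
    microInstr (popW q so mo) = pop 1F λ m → micro (pushW (orBlank m) q so mo)
    microInstr (pushW x q so mo) = push 2F x (micro (applyO q so mo))
    microInstr (applyO q so L) = push 4F so (micro (popO q))
    microInstr (applyO q so R) = push 3F so (ready q)
    microInstr (applyO q so S) = push 4F so (ready q)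
    microInstr (popO q) = pop 3F λ m → micro (pushO (orBlank m) q)
    microInstr (pushO x q) = push 4F x (ready q)

    module Correct (instr : H → Instr (5 + r) H) (polarity : Bool) (A : Language)
                   (micro-instr : ∀ m → instr (micro m) ≡ microInstr m) where

      Y : ℕ → H → Store (5 + r) → Word → ℕ → Set
      Y = Yields instr polarity A

      execAs : ∀ {t s σ out n I} → instr s ≡ I → YieldsInstr instr polarity A t I σ out n → Y (suc t) s σ out n
      execAs e y = exec (subst (λ I → YieldsInstr instr polarity A _ I _ _ _) (sym e) y)

      module _ {out : Word} {n : ℕ} {t : ℕ} {x : List Sym} {ρ : Store r} where

        read-yields : ∀ {q w o l₁ r₁ l₂ r₂} → Holds w l₁ r₁ → Holds o l₂ r₂ →
          Y t (got q (Tape.here w) (Tape.here o)) (x ∷ Tape.left w ∷ Tape.right w ∷ Tape.left o ∷ Tape.right o ∷ ρ) out n →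
          YieldsInstr instr polarity A (suc t) (readInstr q) (x ∷ l₁ ∷ r₁ ∷ l₂ ∷ r₂ ∷ ρ) out n
        read-yields h h' y
          rewrite sym (holds-here h) | sym (holds-right h) | sym (holds-left h)
                | sym (holds-here h') | sym (holds-right h') | sym (holds-left h') = pop (execAs (micro-instr _) (pop y))

        wipe-yields : ∀ {l₁ r₁ l₂ r₂} →
          Y t (ready (OTM.ansNo M)) (x ∷ l₁ ∷ r₁ ∷ [] ∷ [] ∷ ρ) out n →
          YieldsInstr instr polarity A (suc t) wipeInstr (x ∷ l₁ ∷ r₁ ∷ l₂ ∷ r₂ ∷ ρ) out n
        wipe-yields y = clear (execAs (micro-instr _) (clear y))

        Arrives : State → Tape → Tape → Set
        Arrives q w o = ∀ {l₁ r₁ l₂ r₂} → Holds w l₁ r₁ → Holds o l₂ r₂ → Y t (ready q) (x ∷ l₁ ∷ r₁ ∷ l₂ ∷ r₂ ∷ ρ) out n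

        applyO-yields : ∀ {q w o l₁ r₁} so mo → Holds w l₁ r₁ → Arrives q w (move mo (write so o)) →
          Y (3 + t) (micro (applyO q so mo)) (x ∷ l₁ ∷ r₁ ∷ Tape.left o ∷ Tape.right o ∷ ρ) out n
        applyO-yields {o = tape l _ r} so L h y = execAs (micro-instr _) (push (execAs (micro-instr _) (pop (execAs (micro-instr _)
          (push (y h (holds-moveL l so r)))))))
        applyO-yields {o = tape l _ r} so R h y = wait (s≤s (ℕₚ.m≤n+m t 2)) (execAs (micro-instr _) (push (y h (holds-moveR l so r))))
        applyO-yields {o = tape l _ r} so S h y = wait (s≤s (ℕₚ.m≤n+m t 2)) (execAs (micro-instr _) (push (y h cells)))

        apply-yields : ∀ {q w o} sw mw so mo → Arrives q (move mw (write sw w)) (move mo (write so o)) →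
          Y (6 + t) (micro (apply (q , sw , mw , so , mo))) (x ∷ Tape.left w ∷ Tape.right w ∷ Tape.left o ∷ Tape.right o ∷ ρ) out n
        apply-yields {w = tape l _ r} {o} sw L so mo y = execAs (micro-instr _) (push (execAs (micro-instr _) (pop (execAs (micro-instr _)
          (push (applyO-yields {o = o} so mo (holds-moveL l sw r) y))))))
        apply-yields {w = tape l _ r} {o} sw R so mo y = wait (s≤s (ℕₚ.m≤n+m (3 + t) 2)) (execAs (micro-instr _)
          (push (applyO-yields {o = o} so mo (holds-moveR l sw r) y)))
        apply-yields {w = tape l _ r} {o} sw S so mo y = wait (s≤s (ℕₚ.m≤n+m (3 + t) 2)) (execAs (micro-instr _)
          (push (applyO-yields {o = o} so mo cells y)))

Yields-goto : ∀ {k S instr polarity A t s s' σ out n} → instr s ≡ nd {k} {S} (s' ∷ []) →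
  Yields instr polarity A t s' σ out n → Yields instr polarity A (suc t) s σ out n
Yields-goto {instr = instr} {polarity} {A} {t} {s} {s'} {σ} {out} {n} e y =
  subst (Yields instr polarity A (suc t) s σ out) (ℕₚ.+-identityʳ n)
    (exec (subst (λ I → YieldsInstr instr polarity A t I σ out (n + 0)) (sym e) (nd (y ∷ []))))

positive : ℕ → Bool
positive zero = false
positive (suc _) = true

-- Instead of asking the oracle, collect the emitted word and run a deterministic decider for the oracle on it.
module Inline (P : Program) (M : OTM) (deterministic : Deterministic M) where
  open Program P
  open Simulation M renaming (State to DState)

  H : Set
  H = State ⊎ Maybe Sym ⊎ DState ⊎ (DState × Sym × Sym) ⊎ Micro

  pattern old s     = inj₁ s
  pattern rewind m  = inj₂ (inj₁ m)
  pattern ready q   = inj₂ (inj₂ (inj₁ q))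
  pattern got q a b = inj₂ (inj₂ (inj₂ (inj₁ (q , a , b))))
  pattern micro m   = inj₂ (inj₂ (inj₂ (inj₂ m)))

  open Fragment {stacks} {H} (λ m → micro m) (λ q → ready q) (λ q a b → got q a b)

  rewindNext : Maybe Sym → H
  rewindNext (just v) = rewind (just v)
  rewindNext nothing = ready (OTM.start M)

  -- Stack 0 collects the output with its last bit on top. Moving it symbol by symbol to stack 2
  -- restores the order and places it on the decider's work tape with the head at the left end.
  lift : Instr stacks State → Instr (5 + stacks) H
  lift (push j v s) = push (5 ↑ʳ j) v (old s)
  lift (pop j κ) = pop (5 ↑ʳ j) λ m → old (κ m)
  lift (clear j s) = clear (5 ↑ʳ j) (old s)
  lift (nd ss) = nd (map inj₁ ss)
  lift (emit b s) = push 0F (bitSym b) (old s)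
  lift ask = pop 0F rewindNext
  lift (halt b) = halt b

  readyInstr : DState → Kind → Instr (5 + stacks) H
  readyInstr q accepting = halt polarity
  readyInstr q rejecting = halt (not polarity)
  readyInstr q querying = wipeInstr
  readyInstr q ordinary = readInstr q

  gotInstr : List (DState × Sym × Move × Sym × Move) → Instr (5 + stacks) H
  -- A configuration without successors is a rejecting path.
  gotInstr [] = halt (not polarity)
  gotInstr (ch ∷ _) = nd (micro (apply ch) ∷ [])

  instr' : H → Instr (5 + stacks) H
  instr' (old s) = lift (instr s)
  instr' (rewind (just v)) = push 2F v (rewind nothing)
  instr' (rewind nothing) = pop 0F rewindNext
  instr' (ready q) = readyInstr q (kind M q)
  instr' (got q a b) = gotInstr (OTM.δ M q a b)
  instr' (micro m) = microInstr m

  program : Program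
  program = record
    { State = H
    ; finite = ⊎-finite finite (⊎-finite (retractFinite (⊎-finite Sym-finite ⊤-finite)
        (λ { (just v) → inj₁ v ; nothing → inj₂ tt }) (λ { (inj₁ v) → just v ; (inj₂ _) → nothing })
        (λ { (just v) → refl ; nothing → refl }))
        (⊎-finite state-finite (⊎-finite (×-finite state-finite (×-finite Sym-finite Sym-finite)) micro-finite)))
    ; stacks = 5 + stacks ; input = 5 ↑ʳ input ; start = old start ; polarity = polarity ; instr = instr' }

  open Correct instr' polarity ∅L (λ _ → refl)

  judge : Bool → Bool
  judge b = if polarity then b else not b

  judge-true : judge true ≡ polarity
  judge-true with polarity
  ... | true = refl
  ... | false = refl

  judge-false : judge false ≡ not polarity
  judge-false with polarity
  ... | true = refl
  ... | false = refl

  as-count : ∀ {t s σ out b b'} → b ≡ b' → Y t s σ out (𝟙 b') → Y t s σ out (𝟙 b)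
  as-count refl y = y

  module _ {out : Word} {x : List Sym} {ρ : Store stacks} where

    -- A deterministic machine has at most one path, so the simulation does not branch and only the
    -- positivity of `n` matters. A step takes at most nine instructions: two for reading, one jump
    -- and six for both tapes; 12 leaves slack.
    decide-yields : ∀ t c {n l₁ r₁ l₂ r₂} → Evaluates M ∅L t c n → Holds (Config.work c) l₁ r₁ → Holds (Config.oracle c) l₂ r₂ →
      Y (t * 12 + 12) (ready (Config.state c)) (x ∷ l₁ ∷ r₁ ∷ l₂ ∷ r₂ ∷ ρ) out (𝟙 (judge (positive n)))
    decide-yields t c {n} ev h h' with outcome M ∅L t c n ev
    ... | accepted e = as-count judge-true
      (wait (ℕₚ.≤-trans (s≤s (z≤n {11})) (ℕₚ.m≤n+m 12 (t * 12))) (execAs {t = 0} (cong (readyInstr _) e) halt))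
    ... | rejected e = as-count judge-false
      (wait (ℕₚ.≤-trans (s≤s (z≤n {11})) (ℕₚ.m≤n+m 12 (t * 12))) (execAs {t = 0} (cong (readyInstr _) e) halt))
    decide-yields (suc t) (config q w o) {n} ev h h' | queried e ev' =
      wait (ℕₚ.m≤n+m (2 + (t * 12 + 12)) 10)
        (execAs (cong (readyInstr q) e) (wipe-yields (decide-yields t (config (OTM.ansNo M) w emptyTape) ev' h end)))
    decide-yields (suc t) (config q w o) {n} ev h h' | branched e ev' =
      wait (ℕₚ.m≤n+m (10 + (t * 12 + 12)) 2)
        (execAs (cong (readyInstr q) e) (read-yields h h' (next (OTM.δ M q (Tape.here w) (Tape.here o)) refl (deterministic q _ _) ev')))
      where
      next : ∀ as → OTM.δ M q (Tape.here w) (Tape.here o) ≡ as → length as ≤ 1 →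
        EvaluatesAll M ∅L t (map (applyChoice M (config q w o)) as) n →
        Y (8 + (t * 12 + 12)) (got q (Tape.here w) (Tape.here o))
          (x ∷ Tape.left w ∷ Tape.right w ∷ Tape.left o ∷ Tape.right o ∷ ρ) out (𝟙 (judge (positive n)))
      next [] e _ (_ , refl) = as-count judge-false
        (wait (s≤s z≤n) (execAs {t = 0} (cong gotInstr e) halt))
      next ((q' , sw , mw , so , mo) ∷ []) e _ ((hlt , _) , p) = wait (ℕₚ.m≤n+m (7 + (t * 12 + 12)) 1)
        (Yields-goto (cong gotInstr e) (apply-yields {w = w} {o} sw mw so mo λ h h' →
          decide-yields t _ (hlt , trans (sym (ℕₚ.+-identityʳ _)) p) h h'))
      next (_ ∷ _ ∷ _) e (s≤s ()) _

  module _ (A : Language) (c k : ℕ) (bound : PolyTimeBound M ∅L c k)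
           (correct : ∀ w → positive (accPaths M ∅L c k w) ≡ A w) where

    slowdown : ℕ → ℕ
    slowdown N = N * 2 + (poly c k N * 12 + 14)

    poly-mono : ∀ {m n} → m ≤ n → poly c k m ≤ poly c k n
    poly-mono p = ℕₚ.+-monoˡ-≤ c (ℕₚ.*-monoʳ-≤ c (ℕₚ.^-monoˡ-≤ k p))

    rewind-yields : ∀ {ρ T} u v → length u * 2 + (poly c k (length (u ʳ++ v)) * 12 + 12) ≤ T →
      YieldsInstr instr' polarity ∅L T (pop 0F rewindNext) (map bitSym u ∷ [] ∷ map bitSym v ∷ [] ∷ [] ∷ ρ) []
        (𝟙 (judge (A (u ʳ++ v))))
    rewind-yields [] v p = pop (wait p (as-count (cong judge (sym (correct v)))
      (decide-yields (poly c k (length v)) (initConfig M v) (bound v , refl) (input-holds v) end)))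
    rewind-yields (x ∷ u) v (s≤s (s≤s p)) = pop (exec (push (exec (rewind-yields u (x ∷ v) p))))

    -- Each emitted bit uses up a step, so `length out + t` never grows. Hence `N` bounds the length
    -- of the word that is finally decided, on every branch.
    inline-yields : ∀ {t s σ out n} N → Yields instr polarity A t s σ out n → length out + t ≤ N →
      Y (t + slowdown N) (old s) (map bitSym (reverse out) ∷ [] ∷ [] ∷ [] ∷ [] ∷ σ) [] n
    inline-instr : ∀ {t s σ out n I} N → instr s ≡ I → YieldsInstr instr polarity A t I σ out n → length out + suc t ≤ N →
      Y (suc (t + slowdown N)) (old s) (map bitSym (reverse out) ∷ [] ∷ [] ∷ [] ∷ [] ∷ σ) [] n
    inline-all : ∀ {t ss σ out n} N → YieldsAll instr polarity A t ss σ out n → length out + t ≤ N →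
      YieldsAll instr' polarity ∅L (t + slowdown N) (map inj₁ ss) (map bitSym (reverse out) ∷ [] ∷ [] ∷ [] ∷ [] ∷ σ) [] n

    inline-yields N (exec y) p = inline-instr N refl y p
    inline-yields {out = out} N (wait {t} {t'} q y) p = wait (ℕₚ.+-monoˡ-≤ (slowdown N) q)
      (inline-yields N y (ℕₚ.≤-trans (ℕₚ.+-monoʳ-≤ (length out) q) p))

    shrink : ∀ {m t N} → m + suc t ≤ N → m + t ≤ N
    shrink {m} {t} p = ℕₚ.≤-trans (ℕₚ.+-monoʳ-≤ m (ℕₚ.n≤1+n t)) p

    inline-instr {out = out} N e (push y) p = execAs (cong lift e) (push (inline-yields N y (shrink {length out} p)))
    inline-instr {out = out} N e (pop y) p = execAs (cong lift e) (pop (inline-yields N y (shrink {length out} p)))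
    inline-instr {out = out} N e (clear y) p = execAs (cong lift e) (clear (inline-yields N y (shrink {length out} p)))
    inline-instr {out = out} N e (nd y) p = execAs (cong lift e) (nd (inline-all N y (shrink {length out} p)))
    inline-instr {t} {σ = σ} {out} {n} N e (emit {s = s'} {b = b} y) p = execAs (cong lift e) (push
      (subst (λ u → Y (t + slowdown N) (old s') (map bitSym u ∷ [] ∷ [] ∷ [] ∷ [] ∷ σ) [] n) (Listₚ.reverse-++ out (b ∷ []))
        (inline-yields N y (subst (_≤ N) (sym (trans (cong (_+ t) (Listₚ.length-++ out)) (ℕₚ.+-assoc (length out) 1 t))) p))))
    inline-instr {t} {s} {σ} {out} N e ask p = as-count (cong (λ w → judge (A w)) (sym (Listₚ.reverse-involutive out)))
      (execAs (cong lift e) (rewind-yields (reverse out) [] time))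
      where
      len : length out ≤ N
      len = ℕₚ.≤-trans (ℕₚ.m≤m+n (length out) (suc t)) p
      time : length (reverse out) * 2 + (poly c k (length (reverse (reverse out))) * 12 + 12) ≤ t + slowdown N
      time rewrite Listₚ.reverse-involutive out | Listₚ.length-reverse out = ℕₚ.≤-trans
        (ℕₚ.+-mono-≤ (ℕₚ.*-monoˡ-≤ 2 len) (ℕₚ.+-mono-≤ (ℕₚ.*-monoˡ-≤ 12 (poly-mono len)) (ℕₚ.m≤m+n 12 2)))
        (ℕₚ.m≤n+m (slowdown N) t)
    inline-instr N e halt p = execAs (cong lift e) halt

    inline-all N [] p = []
    inline-all N (y ∷ ys) p = inline-yields N y p ∷ inline-all N ys p

    inlined : ∀ {τ f} → PolyBounded τ →
      (∀ w → Yields instr polarity A (τ (length w)) start (initStore input w) [] (f w)) → SharpP f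
    inlined {τ} pb y = compile program ∅L {λ n → τ n + slowdown (τ n)}
      (pb-+ pb (pb-∘ {τ} {slowdown} (pb-+ (pb-* pb-id (pb-const 2)) (pb-+ (pb-* (pb-poly c k) (pb-const 12)) (pb-const 14))) pb))
      λ w → inline-yields (τ (length w)) (y w) ℕₚ.≤-refl

inline : ∀ (Pr : Program) A {τ f} → P A → PolyBounded τ →
  (∀ w → Yields (Program.instr Pr) (Program.polarity Pr) A (τ (length w)) (Program.start Pr) (initStore (Program.input Pr) w) [] (f w)) → SharpP f
inline Pr A (M , det , c , k , bound , decides) = Inline.inlined Pr M det A c k bound correct
  where
  correct : ∀ w → positive (accPaths M ∅L c k w) ≡ A w
  correct w with accPaths M ∅L c k w | A w | decides w
  ... | zero  | false | _ = refl
  ... | zero  | true  | e with () ← Equivalence.to e refl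
  ... | suc _ | true  | _ = refl
  ... | suc _ | false | e with () ← Equivalence.from e (s≤s z≤n)

-- Certificates and objections to them

sumFin : ∀ {n} → (Fin n → ℕ) → ℕ
sumFin {zero} f = 0
sumFin {suc n} f = f 0F + sumFin (f ∘ suc)

≤sumFin : ∀ {n} (f : Fin n → ℕ) i → f i ≤ sumFin f
≤sumFin f 0F = ℕₚ.m≤m+n (f 0F) _
≤sumFin f (suc i) = ℕₚ.≤-trans (≤sumFin (f ∘ suc) i) (ℕₚ.m≤n+m _ (f 0F))

branching : OTM → ℕ
branching M = sumFin λ q → sumFin λ a → sumFin λ b → length (OTM.δ M q a b)

≤branching : ∀ M q a b → length (OTM.δ M q a b) ≤ branching M
≤branching M q a b = ℕₚ.≤-trans (≤sumFin (λ b → length (OTM.δ M q a b)) b)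
  (ℕₚ.≤-trans (≤sumFin (λ a → sumFin λ b → length (OTM.δ M q a b)) a)
    (≤sumFin (λ q → sumFin λ a → sumFin λ b → length (OTM.δ M q a b)) q))

-- Computation paths become bit strings: false takes the first of the pending alternatives, true discards it,
-- and the bits after acceptance have to be false.
data Node (M : OTM) : Set where
  done dead : Node M
  pending   : List (Config M) → Node M

nextOf : ∀ {M} → Kind → Config M → Node M
nextOf accepting c = done
nextOf rejecting c = dead
nextOf {M} querying c = pending (queryStep M ∅L c ∷ [])
nextOf {M} ordinary c = pending (succs M c)

next : ∀ {M} → Config M → Node M
next {M} c = nextOf (kind M (Config.state c)) c

follow : ∀ {M} → Node M → Bool → Node M
follow done false = done
follow done true = dead
follow dead _ = dead
follow (pending []) _ = dead
follow (pending (c ∷ cs)) false = next c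
follow (pending (c ∷ cs)) true = pending cs

isDone : ∀ {M} → Node M → Bool
isDone done = true
isDone dead = false
isDone (pending _) = false

Triple : Set
Triple = Bool × Bool × Bool

-- The objections: some path is accepting (guess); a path below the first one is accepting; the first one is accepting and
-- equals the second or third one; the i-th one is not accepting. Each concerns a single path whose bits come with the triples.
data Mode : Set where
  guess below same₂ same₃ fail₁ fail₂ fail₃ : Mode

data Order : Set where
  lt eq gt : Order

compareBit : Order → Bool → Bool → Order
compareBit eq false true = lt
compareBit eq true false = gt
compareBit o _ _ = o

choices : Mode → Order → Triple → List (Order × Bool)
choices guess o (b₁ , b₂ , b₃) = (o , false) ∷ (o , true) ∷ []
choices below o (b₁ , b₂ , b₃) = (compareBit o false b₁ , false) ∷ (compareBit o true b₁ , true) ∷ []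
choices same₂ o (b₁ , b₂ , b₃) = (compareBit o b₁ b₂ , b₁) ∷ []
choices same₃ o (b₁ , b₂ , b₃) = (compareBit o b₁ b₃ , b₁) ∷ []
choices fail₁ o (b₁ , b₂ , b₃) = (o , b₁) ∷ []
choices fail₂ o (b₁ , b₂ , b₃) = (o , b₂) ∷ []
choices fail₃ o (b₁ , b₂ , b₃) = (o , b₃) ∷ []

isLt isEq : Order → Bool
isLt lt = true
isLt _ = false
isEq eq = true
isEq _ = false

conclude : Mode → Order → Bool → Bool
conclude guess o b = b
conclude below o b = b ∧ isLt o
conclude same₂ o b = b ∧ isEq o
conclude same₃ o b = b ∧ isEq o
conclude fail₁ o b = not b
conclude fail₂ o b = not b
conclude fail₃ o b = not b

modesOf : Bool → List Mode
modesOf false = guess ∷ []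
modesOf true = below ∷ same₂ ∷ same₃ ∷ fail₁ ∷ fail₂ ∷ fail₃ ∷ []

-- Stated on abstract nodes, as the meeting point of two inductions: the program below realizes this
-- number as its number of accepting paths, and the counting of bit strings evaluates it.
modeCount : ∀ {M} → Mode → Order → Node M → List Triple → ℕ
modeCount m o ν [] = 𝟙 (conclude m o (isDone ν))
modeCount m o ν (z ∷ zs) = sum (map (λ ob → modeCount m (proj₁ ob) (follow ν (proj₂ ob)) zs) (choices m o z))

triples : List Bool → List Triple
triples (a ∷ b ∷ c ∷ x) = (a , b , c) ∷ triples x
triples _ = []

-- Certificates: true b for every input bit b, in reverse order, then false s with s selecting the modes, then triples.
objections : OTM → Word → Word → ℕ
objections M r (true ∷ b ∷ x) = objections M (b ∷ r) x
objections M r (false ∷ s ∷ x) = sum (map (λ m → modeCount m eq (next (initConfig M r)) (triples x)) (modesOf s))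
objections M r _ = 0

module Objector (M : OTM) where
  open OTM M using (δ)
  open Simulation M

  D : ℕ
  D = branching M

  -- A node in finite control. The pending alternatives are given by the state and the two scanned
  -- symbols, which determine the list of choices, together with the number of choices already
  -- discarded; the rest of the tapes stays on the stacks.
  CNode : Set
  CNode = ⊤ ⊎ ⊤ ⊎ ⊤ ⊎ (State × Sym × Sym × UpTo D)

  pattern doneC       = inj₁ tt
  pattern deadC       = inj₂ (inj₁ tt)
  pattern askC        = inj₂ (inj₂ (inj₁ tt))
  pattern altC q a b i = inj₂ (inj₂ (inj₂ (q , a , b , i)))

  isDoneC : CNode → Bool
  isDoneC doneC = true
  isDoneC _ = false

  Context : Set
  Context = Mode × Order

  H : Set
  H = ⊤ ⊎ ⊤ ⊎ Sym ⊎ ⊤ ⊎ (Bool ⊎ Bool) ⊎ (Context × State) ⊎ (Context × CNode) ⊎ (Context × CNode × Sym) ⊎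
      (Context × CNode × Sym × Sym) ⊎ (Context × CNode × Triple) ⊎ (Context × CNode × Bool) ⊎ (Context × Micro)

  pattern header         = inj₁ tt
  pattern headerBit      = inj₂ (inj₁ tt)
  pattern headerPush v   = inj₂ (inj₂ (inj₁ v))
  pattern headerEnd      = inj₂ (inj₂ (inj₂ (inj₁ tt)))
  pattern choose s       = inj₂ (inj₂ (inj₂ (inj₂ (inj₁ (inj₁ s)))))
  pattern finish b       = inj₂ (inj₂ (inj₂ (inj₂ (inj₁ (inj₂ b)))))
  pattern ready x q      = inj₂ (inj₂ (inj₂ (inj₂ (inj₂ (inj₁ (x , q))))))
  pattern node x ν       = inj₂ (inj₂ (inj₂ (inj₂ (inj₂ (inj₂ (inj₁ (x , ν)))))))
  pattern node₁ x ν a    = inj₂ (inj₂ (inj₂ (inj₂ (inj₂ (inj₂ (inj₂ (inj₁ (x , ν , a))))))))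
  pattern node₂ x ν a b  = inj₂ (inj₂ (inj₂ (inj₂ (inj₂ (inj₂ (inj₂ (inj₂ (inj₁ (x , ν , a , b)))))))))
  pattern node₃ x ν z    = inj₂ (inj₂ (inj₂ (inj₂ (inj₂ (inj₂ (inj₂ (inj₂ (inj₂ (inj₁ (x , ν , z))))))))))
  pattern bit x ν b      = inj₂ (inj₂ (inj₂ (inj₂ (inj₂ (inj₂ (inj₂ (inj₂ (inj₂ (inj₂ (inj₁ (x , ν , b)))))))))))
  pattern micro x m      = inj₂ (inj₂ (inj₂ (inj₂ (inj₂ (inj₂ (inj₂ (inj₂ (inj₂ (inj₂ (inj₂ (x , m)))))))))))

  module F (x : Context) = Fragment {0} {H} (λ m → micro x m) (λ q → ready x q) (λ q a b → node x (altC q a b (upTo 0 z≤n)))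

  stop : Context → CNode → H
  stop (m , o) ν = finish (conclude m o (isDoneC ν))

  headerNext headerLast : Maybe Sym → H
  headerNext (just 2F) = headerBit
  headerNext (just 1F) = headerEnd
  headerNext _ = finish false
  headerLast (just 2F) = choose true
  headerLast (just 1F) = choose false
  headerLast _ = finish false

  headerCopy : Maybe Sym → H
  headerCopy (just v) = headerPush v
  headerCopy nothing = finish false

  node-next : Context → CNode → Maybe Sym → H
  node-next x ν (just a) = node₁ x ν a
  node-next x ν nothing = stop x ν

  node₁-next : Context → CNode → Sym → Maybe Sym → H
  node₁-next x ν a (just b) = node₂ x ν a b
  node₁-next x ν a nothing = stop x ν

  node₂-next : Context → CNode → Sym → Sym → Maybe Sym → H
  node₂-next x ν a b (just c) = node₃ x ν (bitValue a , bitValue b , bitValue c)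
  node₂-next x ν a b nothing = stop x ν

  -- An alternative is discarded only if it exists, so the number of discarded ones stays within `D`
  -- and the default `deadC` is never reached; see `later-alt`.
  later : State → Sym → Sym → ℕ → CNode
  later q a b i with i ≤? D
  ... | yes p = altC q a b (upTo i p)
  ... | no _ = deadC

  altInstr : Context → State → Sym → Sym → ℕ → List (State × Sym × Move × Sym × Move) → Bool → Instr 5 H
  altInstr x q a b i [] _ = nd (node x deadC ∷ [])
  altInstr x q a b i (ch ∷ _) false = nd (micro x (apply ch) ∷ [])
  altInstr x q a b i (ch ∷ _) true = nd (node x (later q a b (suc i)) ∷ [])

  bitInstr : Context → CNode → Bool → Instr 5 H
  bitInstr x doneC false = nd (node x doneC ∷ [])
  bitInstr x doneC true = nd (node x deadC ∷ [])
  bitInstr x deadC _ = nd (node x deadC ∷ [])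
  bitInstr x askC false = F.wipeInstr x
  bitInstr x askC true = nd (node x deadC ∷ [])
  bitInstr x (altC q a b (upTo i _)) c = altInstr x q a b i (drop i (δ q a b)) c

  readyInstr : Context → State → Kind → Instr 5 H
  readyInstr x q accepting = nd (node x doneC ∷ [])
  readyInstr x q rejecting = nd (node x deadC ∷ [])
  readyInstr x q querying = nd (node x askC ∷ [])
  readyInstr x q ordinary = F.readInstr x q

  instr : H → Instr 5 H
  instr header = pop 0F headerNext
  instr headerBit = pop 0F headerCopy
  instr (headerPush v) = push 2F v header
  instr headerEnd = pop 0F headerLast
  instr (choose s) = nd (map (λ m → ready (m , eq) (OTM.start M)) (modesOf s))
  instr (finish b) = halt b
  instr (ready x q) = readyInstr x q (kind M q)
  instr (node x ν) = pop 0F (node-next x ν)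
  instr (node₁ x ν a) = pop 0F (node₁-next x ν a)
  instr (node₂ x ν a b) = pop 0F (node₂-next x ν a b)
  instr (node₃ (m , o) ν z) = nd (map (λ ob → bit (m , proj₁ ob) ν (proj₂ ob)) (choices m o z))
  instr (bit x ν b) = bitInstr x ν b
  instr (micro x m) = F.microInstr x m

  mode-finite : Finite Mode
  mode-finite = retractFinite (finFinite 7)
    (λ { guess → 0F ; below → 1F ; same₂ → 2F ; same₃ → 3F ; fail₁ → 4F ; fail₂ → 5F ; fail₃ → 6F })
    (λ { 0F → guess ; 1F → below ; 2F → same₂ ; 3F → same₃ ; 4F → fail₁ ; 5F → fail₂ ; 6F → fail₃ })
    (λ { guess → refl ; below → refl ; same₂ → refl ; same₃ → refl ; fail₁ → refl ; fail₂ → refl ; fail₃ → refl })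

  order-finite : Finite Order
  order-finite = retractFinite (finFinite 3) (λ { lt → 0F ; eq → 1F ; gt → 2F }) (λ { 0F → lt ; 1F → eq ; 2F → gt })
    (λ { lt → refl ; eq → refl ; gt → refl })

  H-finite : Finite H
  H-finite = ⊎-finite ⊤-finite (⊎-finite ⊤-finite (⊎-finite Sym-finite (⊎-finite ⊤-finite (⊎-finite (⊎-finite Bool-finite Bool-finite)
    (⊎-finite (×-finite context (state-finite)) (⊎-finite (×-finite context cnode) (⊎-finite (×-finite context (×-finite cnode Sym-finite))
    (⊎-finite (×-finite context (×-finite cnode (×-finite Sym-finite Sym-finite)))
    (⊎-finite (×-finite context (×-finite cnode (×-finite Bool-finite (×-finite Bool-finite Bool-finite))))
    (⊎-finite (×-finite context (×-finite cnode Bool-finite)) (×-finite context micro-finite)))))))))))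
    where
    context : Finite Context
    context = ×-finite mode-finite order-finite
    cnode : Finite CNode
    cnode = ⊎-finite ⊤-finite (⊎-finite ⊤-finite (⊎-finite ⊤-finite
      (×-finite state-finite (×-finite Sym-finite (×-finite Sym-finite (UpTo-finite D))))))

  program : Program
  program = record { State = H ; finite = H-finite ; stacks = 5 ; input = 0F ; start = header ; polarity = true ; instr = instr }

  module C (x : Context) = F.Correct x instr true ∅L (λ _ → refl)

  Y : ℕ → H → Store 5 → ℕ → Set
  Y t s σ n = Yields instr true ∅L t s σ [] n

  data Represents : CNode → List Sym → List Sym → List Sym → List Sym → Node M → Set where
    done-rep : ∀ {l₁ r₁ l₂ r₂} → Represents doneC l₁ r₁ l₂ r₂ done
    dead-rep : ∀ {l₁ r₁ l₂ r₂} → Represents deadC l₁ r₁ l₂ r₂ dead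
    -- The answered query is a pending alternative, to be taken by a further bit. Until then the old
    -- oracle tape stays on its stacks, which are therefore arbitrary here.
    ask-rep  : ∀ {w l₁ r₁ l₂ r₂} → Holds w l₁ r₁ →
               Represents askC l₁ r₁ l₂ r₂ (pending (config (OTM.ansNo M) w emptyTape ∷ []))
    alt-rep  : ∀ {q w o cs} i .(p : i ≤ D) → map (applyChoice M (config q w o)) (drop i (δ q (Tape.here w) (Tape.here o))) ≡ cs →
               Represents (altC q (Tape.here w) (Tape.here o) (upTo i p)) (Tape.left w) (Tape.right w) (Tape.left o) (Tape.right o) (pending cs)

  isDone-rep : ∀ {ν l₁ r₁ l₂ r₂ N} → Represents ν l₁ r₁ l₂ r₂ N → isDoneC ν ≡ isDone N
  isDone-rep done-rep = refl
  isDone-rep dead-rep = refl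
  isDone-rep (ask-rep _) = refl
  isDone-rep (alt-rep _ _ _) = refl

  drop-next : ∀ {X : Set} i (xs : List X) {y ys} → drop i xs ≡ y ∷ ys → drop (suc i) xs ≡ ys × suc i ≤ length xs
  drop-next zero (x ∷ xs) refl = refl , s≤s z≤n
  drop-next (suc i) (x ∷ xs) e = proj₁ (drop-next i xs e) , s≤s (proj₂ (drop-next i xs e))

  later-alt : ∀ q a b i → (p : i ≤ D) → later q a b i ≡ altC q a b (upTo i p)
  later-alt q a b i p with i ≤? D
  ... | yes _ = refl
  ... | no np = ⊥-elim (np p)

  time : List Bool → ℕ
  time xs = length xs * 5 + 4

  stop-yields : ∀ {m o ν l₁ r₁ l₂ r₂ N x t} → Represents ν l₁ r₁ l₂ r₂ N →
    Y (suc t) (stop (m , o) ν) (x ∷ l₁ ∷ r₁ ∷ l₂ ∷ r₂ ∷ []) (𝟙 (conclude m o (isDone N)))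
  stop-yields rep rewrite isDone-rep rep = exec halt

  choices-yields : ∀ {t m ν σ} (g : Order × Bool → ℕ) → (∀ o b → Y t (bit (m , o) ν b) σ (g (o , b))) → ∀ obs →
    YieldsAll instr true ∅L t (map (λ ob → bit (m , proj₁ ob) ν (proj₂ ob)) obs) σ [] (sum (map g obs))
  choices-yields g y [] = []
  choices-yields g y ((o , b) ∷ obs) = y o b ∷ choices-yields g y obs

  modeCount-empty : ∀ m o zs → modeCount {M} m o (pending []) zs ≡ modeCount {M} m o dead zs
  modeCount-empty m o [] = refl
  modeCount-empty m o (z ∷ zs) = refl

  node-yields : ∀ {m o ν l₁ r₁ l₂ r₂ N} xs → Represents ν l₁ r₁ l₂ r₂ N →
    Y (time xs) (node (m , o) ν) (map bitSym xs ∷ l₁ ∷ r₁ ∷ l₂ ∷ r₂ ∷ []) (modeCount m o N (triples xs))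
  bit-yields : ∀ {m o ν l₁ r₁ l₂ r₂ N} b xs → Represents ν l₁ r₁ l₂ r₂ N →
    Y (9 + time xs) (bit (m , o) ν b) (map bitSym xs ∷ l₁ ∷ r₁ ∷ l₂ ∷ r₂ ∷ []) (modeCount m o (follow N b) (triples xs))
  ready-yields : ∀ {m o l₁ r₁ l₂ r₂} q w u xs → Holds w l₁ r₁ → Holds u l₂ r₂ →
    Y (2 + time xs) (ready (m , o) q) (map bitSym xs ∷ l₁ ∷ r₁ ∷ l₂ ∷ r₂ ∷ []) (modeCount m o (next (config {M} q w u)) (triples xs))

  node-yields {m} {o} [] rep = exec (pop (stop-yields {m} {o} rep))
  node-yields {m} {o} (a ∷ []) rep = exec (pop (exec (pop (stop-yields {m} {o} rep))))
  node-yields {m} {o} (a ∷ b ∷ []) rep = exec (pop (exec (pop (exec (pop (stop-yields {m} {o} rep))))))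
  node-yields {m} {o} {ν} {l₁} {r₁} {l₂} {r₂} {N} (a ∷ b ∷ c ∷ xs) rep =
    exec (pop (exec (pop (exec (pop (exec (nd read-triple)))))))
    where
    z : Triple
    z = bitValue (bitSym a) , bitValue (bitSym b) , bitValue (bitSym c)
    z≡ : z ≡ (a , b , c)
    z≡ = cong₂ _,_ (bitValue-bitSym a) (cong₂ _,_ (bitValue-bitSym b) (bitValue-bitSym c))
    read-triple : YieldsAll instr true ∅L (11 + time xs) (map (λ ob → bit (m , proj₁ ob) ν (proj₂ ob)) (choices m o z))
      (map bitSym xs ∷ l₁ ∷ r₁ ∷ l₂ ∷ r₂ ∷ []) [] (modeCount m o N ((a , b , c) ∷ triples xs))
    read-triple rewrite z≡ = choices-yields (λ ob → modeCount m (proj₁ ob) (follow N (proj₂ ob)) (triples xs))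
      (λ o b → wait (ℕₚ.m≤n+m (9 + time xs) 2) (bit-yields b xs rep)) (choices m o (a , b , c))

  bit-yields false xs done-rep = wait (ℕₚ.m≤n+m (1 + time xs) 8) (Yields-goto refl (node-yields xs done-rep))
  bit-yields true xs done-rep = wait (ℕₚ.m≤n+m (1 + time xs) 8) (Yields-goto refl (node-yields xs dead-rep))
  bit-yields b xs dead-rep = wait (ℕₚ.m≤n+m (1 + time xs) 8) (Yields-goto refl (node-yields xs dead-rep))
  bit-yields {m} {o} false xs (ask-rep {w} h) = wait (ℕₚ.m≤n+m (4 + time xs) 5)
    (exec (C.wipe-yields (m , o) (ready-yields (OTM.ansNo M) w emptyTape xs h end)))
  bit-yields {m} {o} true xs (ask-rep h) = wait (ℕₚ.m≤n+m (1 + time xs) 8)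
    (Yields-goto refl (subst (λ k → Y (time xs) (node (m , o) deadC) _ k) (sym (modeCount-empty m o (triples xs))) (node-yields xs dead-rep)))
  bit-yields {m} {o} b xs (alt-rep {q} {w} {u} i p e) = alternatives b (drop i (δ q (Tape.here w) (Tape.here u))) refl e
    where
    σ : Store 5
    σ = map bitSym xs ∷ Tape.left w ∷ Tape.right w ∷ Tape.left u ∷ Tape.right u ∷ []
    alternatives : ∀ {cs} b as → drop i (δ q (Tape.here w) (Tape.here u)) ≡ as →
      map (applyChoice M (config q w u)) (drop i (δ q (Tape.here w) (Tape.here u))) ≡ cs →
      Y (9 + time xs) (bit (m , o) (altC q (Tape.here w) (Tape.here u) (upTo i p)) b) σ (modeCount m o (follow (pending cs) b) (triples xs))
    alternatives b [] e refl = wait (ℕₚ.m≤n+m (1 + time xs) 8)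
      (subst (λ k → Y (1 + time xs) (bit (m , o) (altC q (Tape.here w) (Tape.here u) (upTo i p)) b) σ k)
        (cong (λ as → modeCount {M} m o (follow (pending (map (applyChoice M (config q w u)) as)) b) (triples xs)) (sym e))
        (Yields-goto (cong (λ as → altInstr (m , o) q (Tape.here w) (Tape.here u) i as b) e) (node-yields xs dead-rep)))
    alternatives false ((q' , sw , mw , so , mo) ∷ as) e refl =
      subst (λ k → Y (9 + time xs) (bit (m , o) (altC q (Tape.here w) (Tape.here u) (upTo i p)) false) σ k)
        (cong (λ as → modeCount {M} m o (follow (pending (map (applyChoice M (config q w u)) as)) false) (triples xs)) (sym e))
        (Yields-goto (cong (λ as → altInstr (m , o) q (Tape.here w) (Tape.here u) i as false) e)
          (C.apply-yields (m , o) {w = w} {u} sw mw so mo (ready-yields q' _ _ xs)))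
    alternatives true (ch ∷ as) e refl = wait (ℕₚ.m≤n+m (1 + time xs) 8)
      (subst (λ k → Y (1 + time xs) (bit (m , o) (altC q (Tape.here w) (Tape.here u) (upTo i p)) true) σ k)
        (cong (λ as → modeCount {M} m o (follow (pending (map (applyChoice M (config q w u)) as)) true) (triples xs)) (sym e))
        (Yields-goto (trans (cong (λ as → altInstr (m , o) q (Tape.here w) (Tape.here u) i as true) e)
            (cong (λ ν → nd (node (m , o) ν ∷ [])) (later-alt q (Tape.here w) (Tape.here u) (suc i) i<D)))
          (node-yields xs (alt-rep (suc i) i<D (cong (map (applyChoice M (config q w u))) (proj₁ (drop-next i _ e)))))))
      where
      i<D : suc i ≤ D
      i<D = ℕₚ.≤-trans (proj₂ (drop-next i _ e)) (≤branching M q (Tape.here w) (Tape.here u))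

  ready-yields {m} {o} q w u xs h h' with kind M q in e
  ... | accepting = wait (s≤s (ℕₚ.n≤1+n (time xs))) (Yields-goto (cong (readyInstr (m , o) q) e) (node-yields xs done-rep))
  ... | rejecting = wait (s≤s (ℕₚ.n≤1+n (time xs))) (Yields-goto (cong (readyInstr (m , o) q) e) (node-yields xs dead-rep))
  ... | querying = wait (s≤s (ℕₚ.n≤1+n (time xs))) (Yields-goto (cong (readyInstr (m , o) q) e) (node-yields xs (ask-rep h)))
  ... | ordinary = C.execAs (m , o) (cong (readyInstr (m , o) q) e) (C.read-yields (m , o) h h'
    (node-yields xs (alt-rep 0 z≤n refl)))

  modes-yield : ∀ r x ms → YieldsAll instr true ∅L (2 + time x) (map (λ m → ready (m , eq) (OTM.start M)) ms)
    (map bitSym x ∷ [] ∷ map bitSym r ∷ [] ∷ [] ∷ []) [] (sum (map (λ m → modeCount m eq (next (initConfig M r)) (triples x)) ms))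
  modes-yield r x [] = []
  modes-yield r x (m ∷ ms) = ready-yields (OTM.start M) (inputTape r) emptyTape x (input-holds r) end ∷ modes-yield r x ms

  start-time : ∀ x → 5 + time x ≤ 10 + (length x * 5 + 12)
  start-time x = ℕₚ.+-mono-≤ {5} {10} (ℕₚ.m≤m+n 5 5) (ℕₚ.+-monoʳ-≤ (length x * 5) (ℕₚ.m≤m+n 4 8))

  header-yields : ∀ r x → Y (length x * 5 + 12) header (map bitSym x ∷ [] ∷ map bitSym r ∷ [] ∷ [] ∷ []) (objections M r x)
  header-yields r [] = wait (s≤s (s≤s z≤n)) (exec {t = 1} (pop (exec halt)))
  header-yields r (true ∷ []) = wait (s≤s (s≤s (s≤s z≤n))) (exec {t = 2} (pop (exec (pop (exec halt)))))
  header-yields r (false ∷ []) = wait (s≤s (s≤s (s≤s z≤n))) (exec {t = 2} (pop (exec (pop (exec halt)))))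
  header-yields r (true ∷ true ∷ x) = wait (ℕₚ.m≤n+m (3 + (length x * 5 + 12)) 7)
    (exec (pop (exec (pop (exec (push (header-yields (true ∷ r) x)))))))
  header-yields r (true ∷ false ∷ x) = wait (ℕₚ.m≤n+m (3 + (length x * 5 + 12)) 7)
    (exec (pop (exec (pop (exec (push (header-yields (false ∷ r) x)))))))
  header-yields r (false ∷ true ∷ x) = wait (start-time x) (exec (pop (exec (pop (exec (nd (modes-yield r x (modesOf true))))))))
  header-yields r (false ∷ false ∷ x) = wait (start-time x) (exec (pop (exec (pop (exec (nd (modes-yield r x (modesOf false))))))))

objections-SharpP : ∀ M → SharpP (objections M [])
objections-SharpP M = compile program ∅L {λ n → n * 5 + 12} (pb-+ (pb-* pb-id (pb-const 5)) (pb-const 12)) (header-yields [])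
  where open Objector M

support-NP : ∀ {f} → SharpP f → NP (λ w → positive (f w))
support-NP {f} (M , c , k , bound , count) = M , c , k , bound , λ w → subst (λ n → positive (f w) ≡ true ⇔ n > 0) (sym (count w)) (lem (f w))
  where
  lem : ∀ n → positive n ≡ true ⇔ n > 0
  lem zero = mk⇔ (λ ()) (λ ())
  lem (suc n) = mk⇔ (λ _ → s≤s z≤n) (λ _ → refl)

-- Generation of certificates

marked : Word → Word
marked [] = []
marked (b ∷ w) = true ∷ b ∷ marked w

-- With `s` false the only certificate has all its triples false. This is the extra one for the case
-- without accepting paths, and it has to be counted exactly once.
guesses : Bool → List Bool
guesses true = false ∷ true ∷ []
guesses false = false ∷ []

-- The number of certificates not in A that extend out by m triples, which vary only if s is true.
extensions : Language → Bool → ℕ → Word → ℕ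
extensions A s zero out = 𝟙 (not (A out))
extensions A s (suc m) out = sum (map (λ a → sum (map (λ b → sum (map (λ c →
  extensions A s m (((out ++ a ∷ []) ++ b ∷ []) ++ c ∷ [])) (guesses s))) (guesses s))) (guesses s))

module Generator (C K : ℕ) where

  -- Unary arithmetic on stacks 2 and 3. The counter `i` of `pass` is the number of multiplications
  -- by the input length plus one that are still due. For each tick on stack 2, one tick and another
  -- one per input symbol go to stack 3, while the input travels to stack 1 and back; `refill`
  -- returns the product to stack 2.
  data Phase : Set where
    pass mul tick fwd fwdMove fwdTick bwd bwdMove refill refillTick : Phase

  -- The input is flipped in order to be emitted in reverse: the objector pushes its bits while
  -- reading them, which reverses them again and leaves the input as its simulated tape.
  data Tail : Set where
    flip flipMove output outputMark outputBit separator : Tail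

  phase-finite : Finite Phase
  phase-finite = retractFinite (finFinite 10)
    (λ { pass → 0F ; mul → 1F ; tick → 2F ; fwd → 3F ; fwdMove → 4F ; fwdTick → 5F ; bwd → 6F ; bwdMove → 7F ; refill → 8F ; refillTick → 9F })
    (λ { 0F → pass ; 1F → mul ; 2F → tick ; 3F → fwd ; 4F → fwdMove ; 5F → fwdTick ; 6F → bwd ; 7F → bwdMove ; 8F → refill ; 9F → refillTick })
    (λ { pass → refl ; mul → refl ; tick → refl ; fwd → refl ; fwdMove → refl ; fwdTick → refl ; bwd → refl ; bwdMove → refl ; refill → refl ; refillTick → refl })

  tail-finite : Finite Tail
  tail-finite = retractFinite (finFinite 6)
    (λ { flip → 0F ; flipMove → 1F ; output → 2F ; outputMark → 3F ; outputBit → 4F ; separator → 5F })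
    (λ { 0F → flip ; 1F → flipMove ; 2F → output ; 3F → outputMark ; 4F → outputBit ; 5F → separator })
    (λ { flip → refl ; flipMove → refl ; output → refl ; outputMark → refl ; outputBit → refl ; separator → refl })

  H : Set
  H = UpTo C ⊎ (Phase × UpTo K × Sym) ⊎ (Tail × Sym) ⊎ ⊤ ⊎ Bool ⊎ (Bool × Fin 4) ⊎ (Bool × Fin 3 × Bool) ⊎ ⊤

  pattern seed i      = inj₁ i
  pattern loop p i v  = inj₂ (inj₁ (p , i , v))
  pattern tail p v    = inj₂ (inj₂ (inj₁ (p , v)))
  pattern select      = inj₂ (inj₂ (inj₂ (inj₁ tt)))
  pattern selected s  = inj₂ (inj₂ (inj₂ (inj₂ (inj₁ s))))
  pattern gen s k     = inj₂ (inj₂ (inj₂ (inj₂ (inj₂ (inj₁ (s , k))))))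
  pattern genBit s k b = inj₂ (inj₂ (inj₂ (inj₂ (inj₂ (inj₂ (inj₁ (s , k , b)))))))
  pattern query       = inj₂ (inj₂ (inj₂ (inj₂ (inj₂ (inj₂ (inj₂ tt))))))

  continue : H → (Sym → H) → Maybe Sym → H
  continue h f nothing = h
  continue h f (just v) = f v

  loopInstr : Phase → UpTo K → Sym → Instr 4 H
  loopInstr pass (upTo zero _) v = nd (tail flip v ∷ [])
  loopInstr pass (upTo (suc i) p) v = nd (loop mul (upTo i (ℕₚ.<⇒≤ p)) v ∷ [])
  loopInstr mul i _ = pop 2F (continue (loop refill i 1F) (loop tick i))
  loopInstr tick i _ = push 3F 1F (loop fwd i 1F)
  loopInstr fwd i _ = pop 0F (continue (loop bwd i 1F) (loop fwdMove i))
  loopInstr fwdMove i v = push 1F v (loop fwdTick i 1F)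
  loopInstr fwdTick i _ = push 3F 1F (loop fwd i 1F)
  loopInstr bwd i _ = pop 1F (continue (loop mul i 1F) (loop bwdMove i))
  loopInstr bwdMove i v = push 0F v (loop bwd i 1F)
  loopInstr refill i _ = pop 3F (continue (loop pass i 1F) (loop refillTick i))
  loopInstr refillTick i _ = push 2F 1F (loop refill i 1F)

  tailInstr : Tail → Sym → Instr 4 H
  tailInstr flip _ = pop 0F (continue (tail output 1F) (tail flipMove))
  tailInstr flipMove v = push 1F v (tail flip 1F)
  tailInstr output _ = pop 1F (continue (tail separator 1F) (tail outputMark))
  tailInstr outputMark v = emit true (tail outputBit v)
  tailInstr outputBit v = emit (bitValue v) (tail output 1F)
  tailInstr separator _ = emit false select

  instr : H → Instr 4 H
  instr (seed (upTo zero _)) = nd (loop pass (upTo K ℕₚ.≤-refl) 1F ∷ [])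
  instr (seed (upTo (suc i) p)) = push 2F 1F (seed (upTo i (ℕₚ.<⇒≤ p)))
  instr (loop p i v) = loopInstr p i v
  instr (tail p v) = tailInstr p v
  instr select = nd (selected false ∷ selected true ∷ [])
  instr (selected s) = emit s (gen s 0F)
  instr (gen s 0F) = pop 2F (continue query (λ _ → gen s 3F))
  instr (gen s (suc k)) = nd (map (λ b → genBit s k b) (guesses s))
  instr (genBit s 0F b) = emit b (gen s 0F)
  instr (genBit s 1F b) = emit b (gen s 1F)
  instr (genBit s 2F b) = emit b (gen s 2F)
  instr query = ask

  program : Program
  program = record
    { State = H
    ; finite = ⊎-finite (UpTo-finite C) (⊎-finite (×-finite phase-finite (×-finite (UpTo-finite K) Sym-finite))
        (⊎-finite (×-finite tail-finite Sym-finite) (⊎-finite ⊤-finite (⊎-finite Bool-finite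
        (⊎-finite (×-finite Bool-finite (finFinite 4)) (⊎-finite (×-finite Bool-finite (×-finite (finFinite 3) Bool-finite)) ⊤-finite))))))
    ; stacks = 4 ; input = 0F ; start = seed (upTo C ℕₚ.≤-refl) ; polarity = false ; instr = instr }

  module _ (A : Language) where

    Y : ℕ → H → Store 4 → Word → ℕ → Set
    Y = Yields instr false A

    ticks : ℕ → List Sym
    ticks m = replicate m 1F

    store : Word → Word → ℕ → ℕ → Store 4
    store a b u v = map bitSym a ∷ map bitSym b ∷ ticks u ∷ ticks v ∷ []

    at-store : ∀ {t h σ σ' out n} → σ ≡ σ' → Y t h σ' out n → Y t h σ out n
    at-store refl y = y

    at-time : ∀ {t t' h σ out n} → t ≡ t' → Y t' h σ out n → Y t h σ out n
    at-time refl y = y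

    module _ {out : Word} {n : ℕ} where

      fwd-yields : ∀ {t i s u} a b v → Y t (loop bwd i 1F) (store [] (a ʳ++ b) u (length a + v)) out n →
        Y (length a * 3 + suc t) (loop fwd i s) (store a b u v) out n
      fwd-yields [] b v y = exec (pop y)
      fwd-yields {t} {i} {s} {u} (x ∷ a) b v y = exec (pop (exec (push (exec (push
        (fwd-yields a (x ∷ b) (suc v) (at-store (cong (store [] (a ʳ++ (x ∷ b)) u) (ℕₚ.+-suc (length a) v)) y)))))))

      bwd-yields : ∀ {t i s u v} a b → Y t (loop mul i 1F) (store (b ʳ++ a) [] u v) out n →
        Y (length b * 2 + suc t) (loop bwd i s) (store a b u v) out n
      bwd-yields a [] y = exec (pop y)
      bwd-yields a (x ∷ b) y = exec (pop (exec (push (bwd-yields (x ∷ a) b y))))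

      mul-yields : ∀ {t i s} w u v → Y t (loop refill i 1F) (store w [] 0 (u * suc (length w) + v)) out n →
        Y (u * (5 * length w + 4) + suc t) (loop mul i s) (store w [] u v) out n
      mul-yields w zero v y = exec (pop y)
      mul-yields {t} {i} w (suc u) v y = wait (≤-slack 0 (time-eq (length w) (u * (5 * length w + 4)) (suc t)))
        (exec (pop (exec (push (fwd-yields w [] (suc v) (at-time (cong (λ m → m * 2 + suc (u * (5 * length w + 4) + suc t)) (sym (Listₚ.length-reverse w)))
          (bwd-yields [] (reverse w) (at-store (cong (λ w' → store w' [] u (length w + suc v)) (Listₚ.reverse-involutive w))
            (mul-yields w u (length w + suc v) (at-store (cong (store w [] 0) (ticks-eq (length w) (u * suc (length w)) v)) y))))))))))
        where
        time-eq : ∀ l x t → 2 + (l * 3 + suc (l * 2 + suc (x + t))) + 0 ≡ (5 * l + 4) + x + t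
        time-eq = solve-∀
        ticks-eq : ∀ l x v → x + (l + suc v) ≡ suc l + x + v
        ticks-eq = solve-∀

      refill-yields : ∀ {t i s} w u v → Y t (loop pass i 1F) (store w [] (v + u) 0) out n →
        Y (v * 2 + suc t) (loop refill i s) (store w [] u v) out n
      refill-yields w u zero y = exec (pop y)
      refill-yields {t} {i} w u (suc v) y = exec (pop (exec (push (refill-yields w (suc u) v
        (at-store (cong (λ m → store w [] m 0) (ℕₚ.+-suc v u)) y)))))

      passTime : ℕ → ℕ → ℕ → ℕ
      passTime l zero u = 1
      passTime l (suc i) u = suc (u * (5 * l + 4) + suc (u * suc l * 2 + suc (passTime l i (u * suc l))))

      pass-yields : ∀ {t s} w i .{p : i ≤ K} u → (∀ s → Y t (tail flip s) (store w [] (u * suc (length w) ^ i) 0) out n) →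
        Y (passTime (length w) i u + t) (loop pass (upTo i p) s) (store w [] u 0) out n
      pass-yields {t} {s} w zero u y = Yields-goto refl (at-store (cong (λ m → store w [] m 0) (sym (ℕₚ.*-identityʳ u))) (y s))
      pass-yields {t} {s} w (suc i) u y = wait (≤-slack 0 (time-eq (u * (5 * length w + 4)) (u * suc (length w) * 2) (passTime (length w) i (u * suc (length w))) t))
        (Yields-goto refl (mul-yields w u 0 (at-store (cong (store w [] 0) (ℕₚ.+-identityʳ (u * suc (length w))))
          (refill-yields w 0 (u * suc (length w)) (at-store (cong (λ m → store w [] m 0) (ℕₚ.+-identityʳ (u * suc (length w))))
            (pass-yields w i (u * suc (length w)) λ s → at-store (cong (λ m → store w [] m 0) (ℕₚ.*-assoc u (suc (length w)) (suc (length w) ^ i))) (y s)))))))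
        where
        time-eq : ∀ a b c t → suc (a + suc (b + suc (c + t))) + 0 ≡ suc (a + suc (b + suc c)) + t
        time-eq = solve-∀

      seed-yields : ∀ {t} w i .{p : i ≤ C} u → Y t (loop pass (upTo K ℕₚ.≤-refl) 1F) (store w [] (i + u) 0) out n →
        Y (i + suc t) (seed (upTo i p)) (store w [] u 0) out n
      seed-yields w zero u y = Yields-goto refl y
      seed-yields {t} w (suc i) u y = exec (push (seed-yields w i (suc u)
        (at-store (cong (λ m → store w [] m 0) (ℕₚ.+-suc i u)) y)))

      flip-yields : ∀ {t s u} a b → Y t (tail output 1F) (store [] (a ʳ++ b) u 0) out n →
        Y (length a * 2 + suc t) (tail flip s) (store a b u 0) out n
      flip-yields [] b y = exec (pop y)
      flip-yields (x ∷ a) b y = exec (pop (exec (push (flip-yields a (x ∷ b) y))))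

    output-yields : ∀ {t s u n out} b → Y t (tail separator 1F) (store [] [] u 0) (out ++ marked b) n →
      Y (length b * 3 + suc t) (tail output s) (store [] b u 0) out n
    output-yields {t} {s} {u} {n} {out} [] y = exec (pop (subst (λ o → Y t (tail separator 1F) (store [] [] u 0) o n) (Listₚ.++-identityʳ out) y))
    output-yields {t} {s} {u} {n} {out} (x ∷ b) y = exec (pop (exec (emit (exec (emit
      (subst (λ o → Y (length b * 3 + suc t) (tail output 1F) (store [] b u 0) ((out ++ true ∷ []) ++ o ∷ []) n) (sym (bitValue-bitSym x))
        (output-yields b (subst (λ o → Y t (tail separator 1F) (store [] [] u 0) o n) (sym (assoc out x (marked b))) y))))))))
      where
      assoc : ∀ out x m → ((out ++ true ∷ []) ++ x ∷ []) ++ m ≡ out ++ true ∷ x ∷ m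
      assoc out x m = trans (cong (_++ m) (Listₚ.++-assoc out (true ∷ []) (x ∷ []))) (Listₚ.++-assoc out (true ∷ x ∷ []) m)

    guess-yields : ∀ {t s k σ out} (g : Bool → ℕ) → (∀ b → Y t (genBit s k b) σ out (g b)) → ∀ bs →
      YieldsAll instr false A t (map (λ b → genBit s k b) bs) σ out (sum (map g bs))
    guess-yields g y [] = []
    guess-yields g y (b ∷ bs) = y b ∷ guess-yields g y bs

    gen-yields : ∀ {out} s m → Y (m * 7 + 2) (gen s 0F) (store [] [] m 0) out (extensions A s m out)
    gen-yields s zero = exec (pop (exec ask))
    gen-yields s (suc m) = exec (pop (exec (nd (guess-yields _ (λ a → exec (emit (exec (nd (guess-yields _ (λ b → exec (emit (exec (nd
      (guess-yields _ (λ c → exec (emit (gen-yields s m))) (guesses s)))))) (guesses s)))))) (guesses s)))))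

    generated : Word → ℕ → ℕ
    generated w m = extensions A false m (marked (reverse w) ++ false ∷ false ∷ []) + (extensions A true m (marked (reverse w) ++ false ∷ true ∷ []) + 0)

    select-yields : ∀ {out} m → Y (m * 7 + 5) (tail separator 1F) (store [] [] m 0) out
      (extensions A false m (out ++ false ∷ false ∷ []) + (extensions A true m (out ++ false ∷ true ∷ []) + 0))
    select-yields {out} m = wait (≤-slack 0 (time-eq m)) (exec (emit (exec (nd (branch false ∷ branch true ∷ [])))))
      where
      time-eq : ∀ m → suc (suc (suc (m * 7 + 2))) + 0 ≡ m * 7 + 5
      time-eq = solve-∀
      branch : ∀ s → Y (suc (m * 7 + 2)) (selected s) (store [] [] m 0) (out ++ false ∷ []) (extensions A s m (out ++ false ∷ s ∷ []))
      branch s = exec (emit (subst (λ o → Y (m * 7 + 2) (gen s 0F) (store [] [] m 0) o (extensions A s m (out ++ false ∷ s ∷ [])))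
        (sym (Listₚ.++-assoc out (false ∷ []) (s ∷ []))) (gen-yields s m)))

    -- The form of the bound in `PolyBounded`. With `C` and `K` taken from a bound on the length of
    -- encoded paths, the number of triples suffices for every path.
    ticksFor : ℕ → ℕ
    ticksFor l = C * suc l ^ K

    generationTime : ℕ → ℕ
    generationTime l = C + suc (passTime {[]} {0} l K C + (l * 2 + suc (l * 3 + suc (ticksFor l * 7 + 5))))

    program-yields : ∀ w → Y (generationTime (length w)) (seed (upTo C ℕₚ.≤-refl)) (store w [] 0 0) [] (generated w (ticksFor (length w)))
    program-yields w = seed-yields w C 0 (at-store (cong (λ m → store w [] m 0) (ℕₚ.+-identityʳ C))
      (pass-yields w K C λ s → flip-yields w [] (at-time
        (cong (λ l → l * 3 + suc (ticksFor (length w) * 7 + 5)) (sym (Listₚ.length-reverse w)))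
        (output-yields (reverse w) (select-yields (ticksFor (length w)))))))

    pb-passTime : ∀ i {u : ℕ → ℕ} → PolyBounded u → PolyBounded (λ l → passTime {[]} {0} l i (u l))
    pb-passTime zero p = pb-const 1
    pb-passTime (suc i) p = pb-suc (pb-+ (pb-* p (pb-+ (pb-* (pb-const 5) pb-id) (pb-const 4)))
      (pb-suc (pb-+ (pb-* (pb-* p (pb-suc pb-id)) (pb-const 2)) (pb-suc (pb-passTime i (pb-* p (pb-suc pb-id)))))))

    pb-generationTime : PolyBounded generationTime
    pb-generationTime = pb-+ (pb-const C) (pb-suc (pb-+ (pb-passTime K (pb-const C)) (pb-+ (pb-* pb-id (pb-const 2))
      (pb-suc (pb-+ (pb-* pb-id (pb-const 3)) (pb-suc (pb-+ (pb-* (pb-* (pb-const C) (pb-^ (pb-suc pb-id) K)) (pb-const 7)) (pb-const 5))))))))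

-- Counting bit strings

sumBits : ℕ → (List Bool → ℕ) → ℕ
sumBits zero F = F []
sumBits (suc m) F = sumBits m (F ∘ (false ∷_)) + sumBits m (F ∘ (true ∷_))

count : ℕ → (List Bool → Bool) → ℕ
count m P = sumBits m (𝟙 ∘ P)

sumBits-cong : ∀ m {F G} → (∀ y → length y ≡ m → F y ≡ G y) → sumBits m F ≡ sumBits m G
sumBits-cong zero e = e [] refl
sumBits-cong (suc m) e = cong₂ _+_ (sumBits-cong m λ y l → e (false ∷ y) (cong suc l)) (sumBits-cong m λ y l → e (true ∷ y) (cong suc l))

sumBits-+ : ∀ m F G → sumBits m (λ y → F y + G y) ≡ sumBits m F + sumBits m G
sumBits-+ zero F G = refl
sumBits-+ (suc m) F G = trans (cong₂ _+_ (sumBits-+ m (F ∘ (false ∷_)) (G ∘ (false ∷_))) (sumBits-+ m (F ∘ (true ∷_)) (G ∘ (true ∷_))))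
  (interchange (sumBits m (F ∘ (false ∷_))) (sumBits m (G ∘ (false ∷_))) (sumBits m (F ∘ (true ∷_))) (sumBits m (G ∘ (true ∷_))))
  where
  interchange : ∀ a b c d → a + b + (c + d) ≡ a + c + (b + d)
  interchange = solve-∀

sumBits-*ˡ : ∀ m k F → sumBits m (λ y → k * F y) ≡ k * sumBits m F
sumBits-*ˡ zero k F = refl
sumBits-*ˡ (suc m) k F = trans (cong₂ _+_ (sumBits-*ˡ m k (F ∘ (false ∷_))) (sumBits-*ˡ m k (F ∘ (true ∷_))))
  (sym (ℕₚ.*-distribˡ-+ k (sumBits m (F ∘ (false ∷_))) (sumBits m (F ∘ (true ∷_)))))

sumBits-*ʳ : ∀ m k F → sumBits m (λ y → F y * k) ≡ sumBits m F * k
sumBits-*ʳ m k F = trans (sumBits-cong m λ y _ → ℕₚ.*-comm (F y) k) (trans (sumBits-*ˡ m k F) (ℕₚ.*-comm k (sumBits m F)))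

sumBits-zero : ∀ m → sumBits m (λ _ → 0) ≡ 0
sumBits-zero zero = refl
sumBits-zero (suc m) = cong₂ _+_ (sumBits-zero m) (sumBits-zero m)

count-false : ∀ m {P} → (∀ y → P y ≡ false) → count m P ≡ 0
count-false m e = trans (sumBits-cong m λ y _ → cong 𝟙 (e y)) (sumBits-zero m)

run : ∀ {M} → Node M → List Bool → Bool
run ν [] = isDone ν
run ν (b ∷ y) = run (follow ν b) y

run-dead : ∀ {M} y → run {M} dead y ≡ false
run-dead [] = refl
run-dead (b ∷ y) = run-dead y

run-empty : ∀ {M} y → run {M} (pending []) y ≡ false
run-empty [] = refl
run-empty (b ∷ y) = run-dead y

count-done : ∀ {M} m → count m (run {M} done) ≡ 1
count-done zero = refl
count-done {M} (suc m) = cong₂ _+_ (count-done {M} m) (count-false m run-dead)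

module _ (M : OTM) where

  -- A simulated step consumes at most as many bits as there are alternatives. The successor makes
  -- room for the single alternative after a query, also if the machine has no transitions.
  degree : ℕ
  degree = suc (branching M)

  -- The first bit divides the strings between the first pending alternative and the others, as the
  -- paths are divided. Surplus length changes nothing, because an accepting path continues in a
  -- single way.
  count-next : ∀ t c {n ℓ} → Evaluates M ∅L t c n → t * degree ≤ ℓ → count ℓ (run (next c)) ≡ n
  count-pending : ∀ t cs {n ℓ} → EvaluatesAll M ∅L t cs n → length cs + t * degree ≤ ℓ → count ℓ (run (pending cs)) ≡ n

  count-next t c {n} {ℓ} ev p with outcome M ∅L t c n ev
  ... | accepted e = trans (cong (λ k → count ℓ (run (nextOf k c))) e) (count-done {M} ℓ)
  ... | rejected e = trans (cong (λ k → count ℓ (run (nextOf k c))) e) (count-false ℓ run-dead)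
  count-next (suc t) c {n} {ℓ} ev p | queried e (h , ev') =
    trans (cong (λ k → count ℓ (run (nextOf k c))) e)
      (count-pending t (queryStep M ∅L c ∷ []) ((h , tt) , trans (ℕₚ.+-identityʳ _) ev')
        (ℕₚ.≤-trans (ℕₚ.+-monoˡ-≤ (t * degree) (s≤s z≤n)) p))
  count-next (suc t) c {n} {ℓ} ev p | branched e ev' =
    trans (cong (λ k → count ℓ (run (nextOf k c))) e)
      (count-pending t (succs M c) ev' (ℕₚ.≤-trans (ℕₚ.+-monoˡ-≤ (t * degree) few) p))
    where
    q = Config.state c
    a = Tape.here (Config.work c)
    b = Tape.here (Config.oracle c)
    few : length (succs M c) ≤ degree
    few = subst (_≤ degree) (sym (Listₚ.length-map (applyChoice M c) (OTM.δ M q a b))) (ℕₚ.≤-trans (≤branching M q a b) (ℕₚ.n≤1+n _))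

  count-pending t [] {ℓ = ℓ} (_ , refl) p = count-false ℓ run-empty
  count-pending t (c ∷ cs) {ℓ = suc ℓ} ((h , hs) , e) (s≤s p) = trans (cong₂ _+_
    (count-next t c (h , refl) (ℕₚ.≤-trans (ℕₚ.m≤n+m (t * degree) (length cs)) p)) (count-pending t cs (hs , refl) p)) e

-- Lexicographic order with false below true. The first difference decides and the result is then
-- kept, so the comparison runs in finite control while the triples are read.
compareBits : Order → List Bool → List Bool → Order
compareBits o (a ∷ x) (b ∷ y) = compareBits (compareBit o a b) x y
compareBits o _ _ = o

compareBits-lt : ∀ x y → compareBits lt x y ≡ lt
compareBits-lt [] y = refl
compareBits-lt (a ∷ x) [] = refl
compareBits-lt (a ∷ x) (b ∷ y) = compareBits-lt x y

compareBits-gt : ∀ x y → compareBits gt x y ≡ gt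
compareBits-gt [] y = refl
compareBits-gt (a ∷ x) [] = refl
compareBits-gt (a ∷ x) (b ∷ y) = compareBits-gt x y

_<ᵇ_ _==_ : List Bool → List Bool → Bool
x <ᵇ y = isLt (compareBits eq x y)
x == y = isEq (compareBits eq x y)

π₁ π₂ π₃ : Triple → Bool
π₁ (a , b , c) = a
π₂ (a , b , c) = b
π₃ (a , b , c) = c

module _ {M : OTM} where

  count-guess : ∀ o (ν : Node M) zs → modeCount guess o ν zs ≡ count (length zs) (run ν)
  count-guess o ν [] = refl
  count-guess o ν (z ∷ zs) = cong₂ _+_ (count-guess o (follow ν false) zs) (trans (ℕₚ.+-identityʳ _) (count-guess o (follow ν true) zs))

  count-below : ∀ o (ν : Node M) zs → modeCount below o ν zs ≡ count (length zs) (λ y → run ν y ∧ isLt (compareBits o y (map π₁ zs)))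
  count-below o ν [] = refl
  count-below o ν ((a , b , c) ∷ zs) = cong₂ _+_ (count-below (compareBit o false a) (follow ν false) zs)
    (trans (ℕₚ.+-identityʳ _) (count-below (compareBit o true a) (follow ν true) zs))

  count-same₂ : ∀ o (ν : Node M) zs → modeCount same₂ o ν zs ≡ 𝟙 (run ν (map π₁ zs) ∧ isEq (compareBits o (map π₁ zs) (map π₂ zs)))
  count-same₂ o ν [] = refl
  count-same₂ o ν ((a , b , c) ∷ zs) = trans (ℕₚ.+-identityʳ _) (count-same₂ (compareBit o a b) (follow ν a) zs)

  count-same₃ : ∀ o (ν : Node M) zs → modeCount same₃ o ν zs ≡ 𝟙 (run ν (map π₁ zs) ∧ isEq (compareBits o (map π₁ zs) (map π₃ zs)))
  count-same₃ o ν [] = refl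
  count-same₃ o ν ((a , b , c) ∷ zs) = trans (ℕₚ.+-identityʳ _) (count-same₃ (compareBit o a c) (follow ν a) zs)

  count-fail₁ : ∀ o (ν : Node M) zs → modeCount fail₁ o ν zs ≡ 𝟙 (not (run ν (map π₁ zs)))
  count-fail₁ o ν [] = refl
  count-fail₁ o ν ((a , b , c) ∷ zs) = trans (ℕₚ.+-identityʳ _) (count-fail₁ o (follow ν a) zs)

  count-fail₂ : ∀ o (ν : Node M) zs → modeCount fail₂ o ν zs ≡ 𝟙 (not (run ν (map π₂ zs)))
  count-fail₂ o ν [] = refl
  count-fail₂ o ν ((a , b , c) ∷ zs) = trans (ℕₚ.+-identityʳ _) (count-fail₂ o (follow ν b) zs)

  count-fail₃ : ∀ o (ν : Node M) zs → modeCount fail₃ o ν zs ≡ 𝟙 (not (run ν (map π₃ zs)))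
  count-fail₃ o ν [] = refl
  count-fail₃ o ν ((a , b , c) ∷ zs) = trans (ℕₚ.+-identityʳ _) (count-fail₃ o (follow ν c) zs)

sumTriples : Bool → ℕ → (List Triple → ℕ) → ℕ
sumTriples s zero G = G []
sumTriples s (suc m) G = sum (map (λ a → sum (map (λ b → sum (map (λ c →
  sumTriples s m (λ zs → G ((a , b , c) ∷ zs))) (guesses s))) (guesses s))) (guesses s))

flatten : List Triple → List Bool
flatten [] = []
flatten ((a , b , c) ∷ zs) = a ∷ b ∷ c ∷ flatten zs

triples-flatten : ∀ zs → triples (flatten zs) ≡ zs
triples-flatten [] = refl
triples-flatten (z ∷ zs) = cong (z ∷_) (triples-flatten zs)

sum-cong : ∀ {X : Set} (xs : List X) {f g : X → ℕ} → (∀ x → f x ≡ g x) → sum (map f xs) ≡ sum (map g xs)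
sum-cong [] e = refl
sum-cong (x ∷ xs) e = cong₂ _+_ (e x) (sum-cong xs e)

extensions-triples : ∀ A s m out → extensions A s m out ≡ sumTriples s m (λ zs → 𝟙 (not (A (out ++ flatten zs))))
extensions-triples A s zero out = cong (λ o → 𝟙 (not (A o))) (sym (Listₚ.++-identityʳ out))
extensions-triples A s (suc m) out = sum-cong (guesses s) λ a → sum-cong (guesses s) λ b → sum-cong (guesses s) λ c →
  trans (extensions-triples A s m (((out ++ a ∷ []) ++ b ∷ []) ++ c ∷ []))
    (sumTriples-cong s m λ zs → cong (λ o → 𝟙 (not (A o))) (assoc a b c (flatten zs)))
  where
  sumTriples-cong : ∀ s m {F G} → (∀ zs → F zs ≡ G zs) → sumTriples s m F ≡ sumTriples s m G
  sumTriples-cong s zero e = e []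
  sumTriples-cong s (suc m) e = sum-cong (guesses s) λ a → sum-cong (guesses s) λ b → sum-cong (guesses s) λ c →
    sumTriples-cong s m λ zs → e ((a , b , c) ∷ zs)
  assoc : ∀ a b c x → (((out ++ a ∷ []) ++ b ∷ []) ++ c ∷ []) ++ x ≡ out ++ a ∷ b ∷ c ∷ x
  assoc a b c x = trans (Listₚ.++-assoc ((out ++ a ∷ []) ++ b ∷ []) (c ∷ []) x)
    (trans (Listₚ.++-assoc (out ++ a ∷ []) (b ∷ []) (c ∷ x)) (Listₚ.++-assoc out (a ∷ []) (b ∷ c ∷ x)))

sumTriples-false : ∀ m G {k} → (∀ zs → length zs ≡ m → G zs ≡ k) → sumTriples false m G ≡ k
sumTriples-false zero G e = e [] refl
sumTriples-false (suc m) G e = trans (ℕₚ.+-identityʳ _) (trans (ℕₚ.+-identityʳ _) (trans (ℕₚ.+-identityʳ _)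
  (sumTriples-false m _ λ zs l → e _ (cong suc l))))

-- The certificate interleaves three strings, so that they can be followed at the same time.
-- Exchanging the sums over single bits separates the strings again.
sumTriples-true : ∀ m G {H : List Bool → List Bool → List Bool → ℕ} →
  (∀ zs → length zs ≡ m → G zs ≡ H (map π₁ zs) (map π₂ zs) (map π₃ zs)) →
  sumTriples true m G ≡ sumBits m λ x → sumBits m λ y → sumBits m λ z → H x y z
sumTriples-true zero G e = e [] refl
sumTriples-true (suc m) G {H} e = begin
  sumTriples true (suc m) G
    ≡⟨ (sum-cong (guesses true) λ a → sum-cong (guesses true) λ b → sum-cong (guesses true) λ c →
          sumTriples-true m _ {λ x y z → H (a ∷ x) (b ∷ y) (c ∷ z)} λ zs l → e ((a , b , c) ∷ zs) (cong suc l)) ⟩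
  sum (map (λ a → sum (map (λ b → sum (map (λ c → K a b c) (guesses true))) (guesses true))) (guesses true))
    ≡⟨ cong₂ _+_ (inner false) (trans (ℕₚ.+-identityʳ _) (inner true)) ⟩
  (sumBits (suc m) λ x → sumBits (suc m) λ y → sumBits (suc m) λ z → H x y z) ∎
  where
  open ≡-Reasoning
  K : Bool → Bool → Bool → ℕ
  K a b c = sumBits m λ x → sumBits m λ y → sumBits m λ z → H (a ∷ x) (b ∷ y) (c ∷ z)
  innermost : ∀ a b → sum (map (λ c → K a b c) (guesses true)) ≡ sumBits m λ x → sumBits m λ y → sumBits (suc m) λ z → H (a ∷ x) (b ∷ y) z
  innermost a b = trans (cong (K a b false +_) (ℕₚ.+-identityʳ _)) (sym (trans
    (sumBits-cong m λ x _ → sumBits-+ m (λ y → sumBits m λ z → H (a ∷ x) (b ∷ y) (false ∷ z)) (λ y → sumBits m λ z → H (a ∷ x) (b ∷ y) (true ∷ z)))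
    (sumBits-+ m _ _)))
  inner : ∀ a → sum (map (λ b → sum (map (λ c → K a b c) (guesses true))) (guesses true)) ≡ sumBits m λ x → sumBits (suc m) λ y → sumBits (suc m) λ z → H (a ∷ x) y z
  inner a = trans (cong₂ _+_ (innermost a false) (trans (ℕₚ.+-identityʳ _) (innermost a true))) (sym (sumBits-+ m _ _))

module _ (P : List Bool → Bool) where

  firstIn : ℕ → List Bool → ℕ
  firstIn m y = 𝟙 (P y) * 𝟙 (not (positive (count m λ x → P x ∧ (x <ᵇ y))))

  otherThan : List Bool → List Bool → ℕ
  otherThan x y = 𝟙 (P y ∧ not (x == y))

count-<-head : ∀ m (P : List Bool → Bool) y → count m (λ x → P x ∧ isLt (compareBits gt x y)) ≡ 0
count-<-head m P y = count-false m λ x → trans (cong (λ o → P x ∧ isLt o) (compareBits-gt x y)) (Boolₚ.∧-zeroʳ (P x))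

-- By induction on the first bit: the first member lies in the false half if that half has a member,
-- and otherwise it is the first member of the true half.
sum-first : ∀ m (P : List Bool → Bool) → sumBits m (firstIn P m) ≡ 𝟙 (positive (count m P))
sum-first zero P with P []
... | true = refl
... | false = refl
sum-first (suc m) P = trans (cong₂ _+_ false-part true-part) (either-positive (count m (P ∘ (false ∷_))) (count m (P ∘ (true ∷_))))
  where
  P₀ P₁ : List Bool → Bool
  P₀ = P ∘ (false ∷_)
  P₁ = P ∘ (true ∷_)
  below-count : List Bool → ℕ
  below-count u = count m λ x → P₁ x ∧ (x <ᵇ u)
  false-part : sumBits m (firstIn P (suc m) ∘ (false ∷_)) ≡ 𝟙 (positive (count m P₀))
  false-part = trans (sumBits-cong m λ u _ → cong (λ n → 𝟙 (P₀ u) * 𝟙 (not (positive n)))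
    (trans (cong (count m (λ x → P₀ x ∧ (x <ᵇ u)) +_) (count-<-head m P₁ u)) (ℕₚ.+-identityʳ _))) (sum-first m P₀)
  after-zero : ∀ n → sumBits m (λ u → 𝟙 (P₁ u) * 𝟙 (not (positive (n + below-count u)))) ≡ 𝟙 (not (positive n)) * 𝟙 (positive (count m P₁))
  after-zero zero = trans (sum-first m P₁) (sym (ℕₚ.+-identityʳ _))
  after-zero (suc n) = trans (sumBits-cong m λ u _ → ℕₚ.*-zeroʳ (𝟙 (P₁ u))) (sumBits-zero m)
  true-part : sumBits m (firstIn P (suc m) ∘ (true ∷_)) ≡ 𝟙 (not (positive (count m P₀))) * 𝟙 (positive (count m P₁))
  true-part = trans (sumBits-cong m λ u _ → cong (λ n → 𝟙 (P₁ u) * 𝟙 (not (positive (n + below-count u))))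
    (sumBits-cong m λ x _ → cong 𝟙 (trans (cong (λ o → P₀ x ∧ isLt o) (compareBits-lt x u)) (Boolₚ.∧-identityʳ (P₀ x))))) (after-zero (count m P₀))
  either-positive : ∀ a b → 𝟙 (positive a) + 𝟙 (not (positive a)) * 𝟙 (positive b) ≡ 𝟙 (positive (a + b))
  either-positive zero b = ℕₚ.+-identityʳ _
  either-positive (suc a) b = refl

count-== : ∀ m (P : List Bool → Bool) x → length x ≡ m → count m (λ y → P y ∧ (x == y)) ≡ 𝟙 (P x)
count-== zero P [] l = cong 𝟙 (Boolₚ.∧-identityʳ (P []))
count-== (suc m) P (false ∷ x) l = trans (cong₂ _+_ (count-== m (P ∘ (false ∷_)) x (ℕₚ.suc-injective l))
  (count-false m λ y → trans (cong (λ o → P (true ∷ y) ∧ isEq o) (compareBits-lt x y)) (Boolₚ.∧-zeroʳ (P (true ∷ y))))) (ℕₚ.+-identityʳ _)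
count-== (suc m) P (true ∷ x) l = cong₂ _+_ (count-false m λ y → trans (cong (λ o → P (false ∷ y) ∧ isEq o) (compareBits-gt x y)) (Boolₚ.∧-zeroʳ (P (false ∷ y))))
  (count-== m (P ∘ (true ∷_)) x (ℕₚ.suc-injective l))

sum-others : ∀ m (P : List Bool → Bool) x → length x ≡ m → P x ≡ true → sumBits m (otherThan P x) ≡ count m P ∸ 1
sum-others m P x l e = sym (trans (cong (_∸ 1) split) (ℕₚ.m+n∸n≡m (sumBits m (otherThan P x)) 1))
  where
  part : ∀ p q → 𝟙 p ≡ 𝟙 (p ∧ not q) + 𝟙 (p ∧ q)
  part true true = refl
  part true false = refl
  part false q = refl
  split : count m P ≡ sumBits m (otherThan P x) + 1
  split = trans (sumBits-cong m λ y _ → part (P y) (x == y)) (trans (sumBits-+ m _ _)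
    (cong (sumBits m (otherThan P x) +_) (trans (count-== m P x l) (cong 𝟙 e))))

square : ℕ → ℕ
square n = n * n

-- For fixed `x` the sums over `y` and `z` factor into a square. It may be replaced by a value
-- independent of `x`, since a string outside `P` contributes nothing; then only the number of first
-- members, 0 or 1, remains.
sum-products : ∀ m (P : List Bool → Bool) → (sumBits m λ x → sumBits m λ y → sumBits m λ z → firstIn P m x * (otherThan P x y * otherThan P x z))
                       ≡ 𝟙 (positive (count m P)) * square (count m P ∸ 1)
sum-products m P = begin
  (sumBits m λ x → sumBits m λ y → sumBits m λ z → firstIn P m x * (otherThan P x y * otherThan P x z))
    ≡⟨ (sumBits-cong m λ x _ → trans (sumBits-cong m λ y _ → trans (sumBits-*ˡ m (firstIn P m x) _)
          (cong (firstIn P m x *_) (sumBits-*ˡ m (otherThan P x y) _)))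
          (trans (sumBits-*ˡ m (firstIn P m x) _) (cong (firstIn P m x *_) (sumBits-*ʳ m (sumBits m (otherThan P x)) (otherThan P x))))) ⟩
  (sumBits m λ x → firstIn P m x * square (sumBits m (otherThan P x)))
    ≡⟨ (sumBits-cong m λ x l → on-first x l (P x) refl) ⟩
  (sumBits m λ x → firstIn P m x * square (count m P ∸ 1))
    ≡⟨ sumBits-*ʳ m (square (count m P ∸ 1)) (firstIn P m) ⟩
  sumBits m (firstIn P m) * square (count m P ∸ 1)
    ≡⟨ cong (_* square (count m P ∸ 1)) (sum-first m P) ⟩
  𝟙 (positive (count m P)) * square (count m P ∸ 1) ∎
  where
  open ≡-Reasoning
  on-first : ∀ x → length x ≡ m → ∀ b → P x ≡ b → firstIn P m x * square (sumBits m (otherThan P x)) ≡ firstIn P m x * square (count m P ∸ 1)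
  on-first x l true e = cong (λ n → firstIn P m x * square n) (sum-others m P x l e)
  on-first x l false e rewrite e = refl

-- A certificate survives iff all six counts vanish. The equality objections include `p₁`, but where
-- `p₁` fails both sides are 0 anyway, so the conditions become independent factors.
unobjectionable : ∀ n p₁ p₂ p₃ e₂ e₃ →
  𝟙 (not (positive (n + (𝟙 (p₁ ∧ e₂) + (𝟙 (p₁ ∧ e₃) + (𝟙 (not p₁) + (𝟙 (not p₂) + (𝟙 (not p₃) + 0))))))))
    ≡ 𝟙 p₁ * 𝟙 (not (positive n)) * (𝟙 (p₂ ∧ not e₂) * 𝟙 (p₃ ∧ not e₃))
unobjectionable (suc n) true p₂ p₃ e₂ e₃ = refl
unobjectionable (suc n) false p₂ p₃ e₂ e₃ = refl
unobjectionable zero false p₂ p₃ e₂ e₃ = refl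
unobjectionable zero true true p₃ true e₃ = refl
unobjectionable zero true false p₃ true e₃ = refl
unobjectionable zero true true true false true = refl
unobjectionable zero true true false false true = refl
unobjectionable zero true false p₃ false true = refl
unobjectionable zero true true true false false = refl
unobjectionable zero true true false false false = refl
unobjectionable zero true false p₃ false false = refl

-- Split as the certificates are: `s` false contributes the first summand and `s` true the second.
-- The argument 0 has to be separated because of truncated subtraction.
decrementSquare : ℕ → ℕ
decrementSquare n = 𝟙 (not (positive n)) + 𝟙 (positive n) * square (n ∸ 1)

module _ (M : OTM) where

  objected : Language
  objected x = positive (objections M [] x)

  objections-marked : ∀ r b x → objections M r (marked b ++ x) ≡ objections M (b ʳ++ r) x
  objections-marked r [] x = refl
  objections-marked r (a ∷ b) x = objections-marked (a ∷ r) b x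

  objected-certificate : ∀ w s zs → objected ((marked (reverse w) ++ false ∷ s ∷ []) ++ flatten zs)
                                    ≡ positive (sum (map (λ m → modeCount m eq (next (initConfig M w)) zs) (modesOf s)))
  objected-certificate w s zs = cong positive (trans
    (cong (objections M []) (Listₚ.++-assoc (marked (reverse w)) (false ∷ s ∷ []) (flatten zs)))
    (trans (objections-marked [] (reverse w) (false ∷ s ∷ flatten zs))
      (cong₂ (λ u zs → sum (map (λ m → modeCount m eq (next (initConfig M u)) zs) (modesOf s)))
        (Listₚ.reverse-involutive w) (triples-flatten zs))))

  generated-square : ∀ C K w m → Generator.generated C K objected w m ≡ decrementSquare (count m (run (next (initConfig M w))))
  generated-square C K w m = cong₂ _+_ none (trans (ℕₚ.+-identityʳ _) some)
    where
    ν = next (initConfig M w)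
    none : extensions objected false m (marked (reverse w) ++ false ∷ false ∷ []) ≡ 𝟙 (not (positive (count m (run ν))))
    none = trans (extensions-triples objected false m _) (sumTriples-false m _ λ zs l →
      cong (λ b → 𝟙 (not b)) (trans (objected-certificate w false zs)
        (cong positive (trans (ℕₚ.+-identityʳ _) (trans (count-guess eq ν zs) (cong (λ m → count m (run ν)) l))))))
    some : extensions objected true m (marked (reverse w) ++ false ∷ true ∷ []) ≡ 𝟙 (positive (count m (run ν))) * square (count m (run ν) ∸ 1)
    some = trans (extensions-triples objected true m _) (trans (sumTriples-true m _ {λ x y z → firstIn (run ν) m x * (otherThan (run ν) x y * otherThan (run ν) x z)} λ zs l →
        trans (cong (λ b → 𝟙 (not b)) (trans (objected-certificate w true zs) (cong positive
          (cong₂ _+_ (trans (count-below eq ν zs) (cong (λ m → count m (λ x → run ν x ∧ (x <ᵇ map π₁ zs))) l))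
            (cong₂ _+_ (count-same₂ eq ν zs) (cong₂ _+_ (count-same₃ eq ν zs) (cong₂ _+_ (count-fail₁ eq ν zs)
              (cong₂ _+_ (count-fail₂ eq ν zs) (cong₂ _+_ (count-fail₃ eq ν zs) refl)))))))))
          (unobjectionable (count m (λ x → run ν x ∧ (x <ᵇ map π₁ zs))) (run ν (map π₁ zs)) (run ν (map π₂ zs)) (run ν (map π₃ zs))
            (map π₁ zs == map π₂ zs) (map π₁ zs == map π₃ zs)))
      (sum-products m (run ν)))

-- The polynomial over the rationals

toℚ-unnormalised : ∀ n → ℚ.toℚᵘ (toℚ n) ℚᵘ.≃ ℚᵘ.mkℚᵘ (ℤ.+ n) 0
toℚ-unnormalised n = ℚₚ.toℚᵘ-fromℚᵘ (ℚᵘ.mkℚᵘ (ℤ.+ n) 0)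

toℚ-+ : ∀ m n → toℚ (m + n) ≡ toℚ m ℚ.+ toℚ n
toℚ-+ m n = ℚₚ.toℚᵘ-injective (ℚᵘₚ.≃-trans (toℚ-unnormalised (m + n)) (ℚᵘₚ.≃-trans
  (ℚᵘ.*≡* (cong (ℤ._* ℤ.+ 1) (trans (ℤₚ.pos-+ m n) (sym (cong₂ ℤ._+_ (ℤₚ.*-identityʳ (ℤ.+ m)) (ℤₚ.*-identityʳ (ℤ.+ n)))))))
  (ℚᵘₚ.≃-sym (ℚᵘₚ.≃-trans (ℚₚ.toℚᵘ-homo-+ (toℚ m) (toℚ n)) (ℚᵘₚ.+-cong (toℚ-unnormalised m) (toℚ-unnormalised n))))))

toℚ-* : ∀ m n → toℚ (m * n) ≡ toℚ m ℚ.* toℚ n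
toℚ-* m n = ℚₚ.toℚᵘ-injective (ℚᵘₚ.≃-trans (toℚ-unnormalised (m * n)) (ℚᵘₚ.≃-trans
  (ℚᵘ.*≡* (cong (ℤ._* ℤ.+ 1) (ℤₚ.pos-* m n)))
  (ℚᵘₚ.≃-sym (ℚᵘₚ.≃-trans (ℚₚ.toℚᵘ-homo-* (toℚ m) (toℚ n)) (ℚᵘₚ.*-cong (toℚ-unnormalised m) (toℚ-unnormalised n))))))

toℚ-injective : ∀ {m n} → toℚ m ≡ toℚ n → m ≡ n
toℚ-injective {m} {n} e with ℚᵘₚ.≃-trans (ℚᵘₚ.≃-sym (toℚ-unnormalised m)) (ℚᵘₚ.≃-trans (ℚᵘₚ.≃-reflexive (cong ℚ.toℚᵘ e)) (toℚ-unnormalised n))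
... | ℚᵘ.*≡* p = ℤₚ.+-injective (trans (sym (ℤₚ.*-identityʳ (ℤ.+ m))) (trans p (ℤₚ.*-identityʳ (ℤ.+ n))))

-- (x - 1)², whose binomial basis expansion 1 - x + 2 (x choose 2) has a negative coefficient.
decrementSquareℚ : QPoly
decrementSquareℚ = ℚ.1ℚ ∷ ℚ.- (ℚ.1ℚ ℚ.+ ℚ.1ℚ) ∷ ℚ.1ℚ ∷ []

evalQ-decrementSquare : ∀ n → evalQ decrementSquareℚ (toℚ n) ≡ toℚ (decrementSquare n)
evalQ-decrementSquare zero = refl
evalQ-decrementSquare (suc n) = begin
  evalQ decrementSquareℚ (toℚ (suc n)) ≡⟨ cong (evalQ decrementSquareℚ) (toℚ-+ 1 n) ⟩
  evalQ decrementSquareℚ (ℚ.1ℚ ℚ.+ toℚ n) ≡⟨ expand (toℚ n) ⟩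
  toℚ n ℚ.* toℚ n ≡⟨ toℚ-* n n ⟨
  toℚ (n * n) ≡⟨ cong toℚ (ℕₚ.+-identityʳ (n * n)) ⟨
  toℚ (decrementSquare (suc n)) ∎
  where
  open ≡-Reasoning
  open +-*-Solver
  expand : ∀ x → evalQ decrementSquareℚ (ℚ.1ℚ ℚ.+ x) ≡ x ℚ.* x
  expand = solve 1 (λ x → con ℚ.1ℚ :+ (con ℚ.1ℚ :+ x) :* (con (ℚ.- (ℚ.1ℚ ℚ.+ ℚ.1ℚ)) :+ (con ℚ.1ℚ :+ x) :* (con ℚ.1ℚ :+ (con ℚ.1ℚ :+ x) :* con ℚ.0ℚ)) := x :* x) refl

-- A single program serves both collapses: compiled as it stands it queries the oracle, and with the
-- query inlined it runs without one.
decrementSquare-SharpP^ : ∀ {f} → SharpP f → Σ Language λ A → NP A × SharpP^ A (λ w → decrementSquare (f w)) ×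
  (P A → SharpP (λ w → decrementSquare (f w)))
decrementSquare-SharpP^ {f} (M , c , k , bound , counts) =
  objected M , support-NP (objections-SharpP M) ,
  compile (G.program) (objected M) (G.pb-generationTime (objected M)) yields ,
  λ p → inline G.program (objected M) p (G.pb-generationTime (objected M)) yields
  where
  pb : PolyBounded (λ n → poly c k n * degree M)
  pb = pb-* (pb-poly c k) (pb-const (degree M))
  -- `poly c k n * degree M` bits encode any path of `M` on inputs of length `n`; the generator
  -- computes the constants' monomial bound on this number.
  module G = Generator (proj₁ pb) (proj₁ (proj₂ pb))
  value : ∀ w → G.generated (objected M) w (G.ticksFor (objected M) (length w)) ≡ decrementSquare (f w)
  value w = trans (generated-square M (proj₁ pb) (proj₁ (proj₂ pb)) w (G.ticksFor (objected M) (length w)))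
    (cong decrementSquare (count-next M (poly c k (length w)) (initConfig M w) (bound w , counts w) (proj₂ (proj₂ pb) (length w))))
  yields : ∀ w → Yields G.instr false (objected M) (G.generationTime (objected M) (length w)) (Program.start G.program)
    (initStore (Program.input G.program) w) [] (decrementSquare (f w))
  yields w = subst (Yields G.instr false (objected M) _ _ _ []) (value w) (G.program-yields (objected M) w)

-- The census of an oracle

module Census where

  H : Set
  H = ⊤ ⊎ ⊤ ⊎ Bool ⊎ ⊤

  pattern reading = inj₁ tt
  pattern branch  = inj₂ (inj₁ tt)
  pattern bit b   = inj₂ (inj₂ (inj₁ b))
  pattern query   = inj₂ (inj₂ (inj₂ tt))

  nextState : Maybe Sym → H
  nextState nothing = query
  nextState (just _) = branch

  instr : H → Instr 1 H
  instr reading = pop 0F nextState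
  instr branch = nd (bit false ∷ bit true ∷ [])
  instr (bit b) = emit b reading
  instr query = ask

  program : Program
  program = record { State = H ; finite = ⊎-finite ⊤-finite (⊎-finite ⊤-finite (⊎-finite Bool-finite ⊤-finite)) ; stacks = 1
                   ; input = 0F ; start = reading ; polarity = true ; instr = instr }

  census-yields : ∀ A w out → Yields instr true A (length w * 3 + 2) reading (map bitSym w ∷ []) out (count (length w) (λ y → A (out ++ y)))
  census-yields A [] out = exec (pop (exec (subst (λ o → YieldsInstr instr true A 0 ask ([] ∷ []) out (𝟙 (A o))) (sym (Listₚ.++-identityʳ out)) ask)))
  census-yields A (x ∷ w) out = exec (pop (exec (subst (λ k → YieldsInstr instr true A (suc (length w * 3 + 2)) (instr branch) (map bitSym w ∷ []) out k)
      (cong (count (length w) (λ y → A (out ++ false ∷ y)) +_) (ℕₚ.+-identityʳ _)) (nd (branches false ∷ branches true ∷ [])))))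
    where
    branches : ∀ b → Yields instr true A (suc (length w * 3 + 2)) (bit b) (map bitSym w ∷ []) out (count (length w) (λ y → A (out ++ b ∷ y)))
    branches b = exec (emit (subst (Yields instr true A _ reading _ _)
      (sumBits-cong (length w) λ y _ → cong (λ o → 𝟙 (A o)) (Listₚ.++-assoc out (b ∷ []) y)) (census-yields A w (out ++ b ∷ []))))

census-SharpP^ : ∀ A → SharpP^ A (λ w → count (length w) A)
census-SharpP^ A = compile Census.program A {λ n → n * 3 + 2} (pb-+ (pb-* pb-id (pb-const 3)) (pb-const 2))
  (λ w → Census.census-yields A w [])

-- The diagonal oracle

-- Decoding may be partial: a stage of the construction whose number has no meaning is idle.
record Countable (X : Set) : Set where
  field
    decode : ℕ → Maybe X
    code   : X → ℕ
    decode-code : ∀ x → decode (code x) ≡ just x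

open Countable

-- Cantor's walk along the antidiagonals, from the entry with second coordinate 0 to the one with
-- first coordinate 0.
nextPair : ℕ × ℕ → ℕ × ℕ
nextPair (zero , y) = suc y , zero
nextPair (suc x , y) = x , suc y

unpair : ℕ → ℕ × ℕ
unpair zero = 0 , 0
unpair (suc n) = nextPair (unpair n)

pair : ∀ x y → Σ ℕ λ n → unpair n ≡ (x , y)
pair x y = go (x + y) y x refl
  where
  go : ∀ s y x → x + y ≡ s → Σ ℕ λ n → unpair n ≡ (x , y)
  go s (suc y) x e with go s y (suc x) (trans (sym (ℕₚ.+-suc x y)) e)
  ... | n , p = suc n , cong nextPair p
  go (suc s) zero (suc x) e with go s x 0 (trans (sym (ℕₚ.+-identityʳ x)) (ℕₚ.suc-injective e))
  ... | n , p = suc n , cong nextPair p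
  go s zero zero e = 0 , refl

ℕ-countable : Countable ℕ
ℕ-countable = record { decode = just ; code = λ n → n ; decode-code = λ _ → refl }

finite-countable : ∀ {X} → Finite X → Countable X
finite-countable {X} F = record { decode = dec ; code = λ x → toℕ (Finite.to F x) ; decode-code = correct }
  where
  dec : ℕ → Maybe X
  dec i with i <? Finite.size F
  ... | yes p = just (Finite.from F (fromℕ< p))
  ... | no _ = nothing
  correct : ∀ x → dec (toℕ (Finite.to F x)) ≡ just x
  correct x with toℕ (Finite.to F x) <? Finite.size F
  ... | yes p = cong just (trans (cong (Finite.from F) (Finₚ.fromℕ<-toℕ _ p)) (Finite.from-to F x))
  ... | no np = ⊥-elim (np (Finₚ.toℕ<n (Finite.to F x)))

Σ-countable : ∀ {X : Set} {Z : X → Set} → Countable X → (∀ x → Countable (Z x)) → Countable (Σ X Z)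
Σ-countable {X} {Z} CX CZ = record { decode = λ n → decodePair (unpair n) ; code = λ xz → proj₁ (codes xz) ; decode-code = correct }
  where
  decodePair : ℕ × ℕ → Maybe (Σ X Z)
  decodePair (i , j) = decode CX i >>= λ x → Maybe.map (x ,_) (decode (CZ x) j)
  codes : ∀ xz → Σ ℕ λ n → unpair n ≡ (code CX (proj₁ xz) , code (CZ (proj₁ xz)) (proj₂ xz))
  codes (x , z) = pair (code CX x) (code (CZ x) z)
  correct : ∀ xz → decodePair (unpair (proj₁ (codes xz))) ≡ just xz
  correct (x , z) rewrite proj₂ (codes (x , z)) | decode-code CX x | decode-code (CZ x) z = refl

retractCountable : ∀ {X Z : Set} → Countable X → (f : Z → X) (g : X → Z) → (∀ z → g (f z) ≡ z) → Countable Z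
retractCountable CX f g gf = record { decode = λ n → Maybe.map g (decode CX n) ; code = λ z → code CX (f z)
  ; decode-code = λ z → trans (cong (Maybe.map g) (decode-code CX (f z))) (cong just (gf z)) }

Vec-countable : ∀ {X} → Countable X → ∀ n → Countable (Vec X n)
Vec-countable CX zero = retractCountable ℕ-countable (λ _ → 0) (λ _ → []) (λ { [] → refl })
Vec-countable CX (suc n) = retractCountable (Σ-countable CX λ _ → Vec-countable CX n)
  (λ { (x ∷ xs) → x , xs }) (λ { (x , xs) → x ∷ xs }) (λ { (x ∷ xs) → refl })

List-countable : ∀ {X} → Countable X → Countable (List X)
List-countable CX = retractCountable (Σ-countable ℕ-countable (Vec-countable CX))
  (λ xs → length xs , Vec.fromList xs) (λ nxs → Vec.toList (proj₂ nxs)) Vecₚ.toList∘fromList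

Table : ℕ → Set
Table n = Vec (Vec (Vec (List (Fin n × Sym × Move × Sym × Move)) 3) 3) n

-- The transition function of an `OTM` is replaced by its table, which is countable data. A machine
-- read back from its table agrees with the original only pointwise, hence `countAcc-cong` below.
Machines : Set
Machines = Σ ℕ λ n → Vec (Fin n) 6 × Table n

withTransition : (M : OTM) → (Fin (OTM.nStates M) → Sym → Sym → List (Fin (OTM.nStates M) × Sym × Move × Sym × Move)) → OTM
withTransition M δ' = record M { δ = δ' }

toMachine : Machines → OTM
toMachine (n , (a ∷ b ∷ c ∷ d ∷ e ∷ f ∷ []) , table) = record
  { nStates = n ; start = a ; accept = b ; reject = c ; query = d ; ansYes = e ; ansNo = f
  ; δ = λ q x y → lookup (lookup (lookup table q) x) y }

describe : OTM → Machines
describe M = nStates , (start ∷ accept ∷ reject ∷ query ∷ ansYes ∷ ansNo ∷ []) , tabulate λ q → tabulate λ x → tabulate λ y → δ q x y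
  where open OTM M

Machines-countable : Countable Machines
Machines-countable = Σ-countable ℕ-countable λ n → Σ-countable (Vec-countable (finite-countable (finFinite n)) 6) λ _ →
  Vec-countable (Vec-countable (Vec-countable (List-countable (finite-countable (choice n))) 3) 3) n
  where
  choice : ∀ n → Finite (Fin n × Sym × Move × Sym × Move)
  choice n = ×-finite (finFinite n) (×-finite Sym-finite (×-finite Move-finite (×-finite Sym-finite Move-finite)))

module _ (M : OTM) (δ' : Fin (OTM.nStates M) → Sym → Sym → List (Fin (OTM.nStates M) × Sym × Move × Sym × Move))
         (same : ∀ q a b → δ' q a b ≡ OTM.δ M q a b) (A : Language) where

  private
    M' : OTM
    M' = withTransition M δ'

  countAcc-cong : ∀ t q w o → countAcc M' A t (config q w o) ≡ countAcc M A t (config q w o)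
  countAll-cong : ∀ t q w o ds → countAll M' A t (map (applyChoice M' (config q w o)) ds) ≡ countAll M A t (map (applyChoice M (config q w o)) ds)

  countAcc-cong t q w o with q ≟ OTM.accept M | q ≟ OTM.reject M
  ... | yes _ | _ = refl
  ... | no _ | yes _ = refl
  countAcc-cong zero q w o | no _ | no _ = refl
  countAcc-cong (suc t) q w o | no _ | no _ with q ≟ OTM.query M
  ... | no _ = trans (cong (λ ds → countAll M' A t (map (applyChoice M' (config q w o)) ds)) (same q (Tape.here w) (Tape.here o)))
                     (countAll-cong t q w o (OTM.δ M q (Tape.here w) (Tape.here o)))
  ... | yes _ with A (symsToWord (contents o))
  ...   | true = countAcc-cong t (OTM.ansYes M) w emptyTape
  ...   | false = countAcc-cong t (OTM.ansNo M) w emptyTape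

  countAll-cong t q w o [] = refl
  countAll-cong t q w o ((q' , sw , mw , so , mo) ∷ ds) =
    cong₂ _+_ (countAcc-cong t q' (move mw (write sw w)) (move mo (write so o))) (countAll-cong t q w o ds)

-- Dependence of a computation on its oracle

Agree : Language → Language → List Word → Set
Agree A A' = All (λ q → A q ≡ A' q)

module _ (M : OTM) (A : Language) where

  queryStep-cong : ∀ {A'} q w o → A (symsToWord (contents o)) ≡ A' (symsToWord (contents o)) →
    queryStep M A (config q w o) ≡ queryStep M A' (config q w o)
  queryStep-cong {A'} q w o e with A (symsToWord (contents o)) | A' (symsToWord (contents o))
  queryStep-cong q w o refl | true | true = refl
  queryStep-cong q w o refl | false | false = refl

  -- Collects the words asked on all paths. There may be exponentially many of them, which is
  -- harmless: they serve only to place all later changes of the oracle above their lengths.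
  queries : ∀ t c → Σ (List Word) λ qs → ∀ {A'} → Agree A A' qs → countAcc M A t c ≡ countAcc M A' t c
  queriesAll : ∀ t cs → Σ (List Word) λ qs → ∀ {A'} → Agree A A' qs → countAll M A t cs ≡ countAll M A' t cs

  queries t c with Config.state c ≟ OTM.accept M | Config.state c ≟ OTM.reject M
  ... | yes _ | _ = [] , λ _ → refl
  ... | no _ | yes _ = [] , λ _ → refl
  queries zero c | no _ | no _ = [] , λ _ → refl
  queries (suc t) c@(config q w o) | no _ | no _ with q ≟ OTM.query M
  ... | no _ = queriesAll t (succs M c)
  ... | yes _ = symsToWord (contents o) ∷ proj₁ (queries t (queryStep M A c)) , λ { {A'} (e ∷ es) →
    trans (proj₂ (queries t (queryStep M A c)) es) (cong (countAcc M A' t) (queryStep-cong {A'} q w o e)) }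

  queriesAll t [] = [] , λ _ → refl
  queriesAll t (c ∷ cs) = proj₁ (queries t c) ++ proj₁ (queriesAll t cs) , λ es →
    cong₂ _+_ (proj₂ (queries t c) (Allₚ.++⁻ˡ (proj₁ (queries t c)) es)) (proj₂ (queriesAll t cs) (Allₚ.++⁻ʳ (proj₁ (queries t c)) es))

  -- An accepting path within t steps makes at most t queries, and survives every change of the oracle elsewhere.
  pathQueries : ∀ t c → 0 < countAcc M A t c → Σ (List Word) λ qs → length qs ≤ t × (∀ {A'} → Agree A A' qs → 0 < countAcc M A' t c)
  pathQueriesAll : ∀ t cs → 0 < countAll M A t cs → Σ (List Word) λ qs → length qs ≤ t × (∀ {A'} → Agree A A' qs → 0 < countAll M A' t cs)

  pathQueries t c p with Config.state c ≟ OTM.accept M | Config.state c ≟ OTM.reject M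
  ... | yes _ | _ = [] , z≤n , λ _ → s≤s z≤n
  pathQueries t c () | no _ | yes _
  pathQueries zero c () | no _ | no _
  pathQueries (suc t) c@(config q w o) p | no _ | no _ with q ≟ OTM.query M
  ... | no _ with pathQueriesAll t (succs M c) p
  ...   | qs , l , r = qs , ℕₚ.m≤n⇒m≤1+n l , r
  pathQueries (suc t) c@(config q w o) p | no _ | no _ | yes _ with pathQueries t (queryStep M A c) p
  ...   | qs , l , r = symsToWord (contents o) ∷ qs , s≤s l , λ { {A'} (e ∷ es) →
      subst (λ c → 0 < countAcc M A' t c) (queryStep-cong {A'} q w o e) (r es) }

  pathQueriesAll t (c ∷ cs) p with countAcc M A t c in e
  ... | zero with pathQueriesAll t cs p
  ...   | qs , l , r = qs , l , λ {A'} es → ℕₚ.≤-trans (r es) (ℕₚ.m≤n+m (countAll M A' t cs) (countAcc M A' t c))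
  pathQueriesAll t (c ∷ cs) p | suc n with pathQueries t c (subst (0 <_) (sym e) (s≤s z≤n))
  ...   | qs , l , r = qs , l , λ {A'} es → ℕₚ.≤-trans (r es) (ℕₚ.m≤m+n (countAcc M A' t c) (countAll M A' t cs))

tailsOf : Bool → List Word → List Word
tailsOf b [] = []
tailsOf b ([] ∷ qs) = tailsOf b qs
tailsOf true ((true ∷ q) ∷ qs) = q ∷ tailsOf true qs
tailsOf true ((false ∷ q) ∷ qs) = tailsOf true qs
tailsOf false ((true ∷ q) ∷ qs) = tailsOf false qs
tailsOf false ((false ∷ q) ∷ qs) = q ∷ tailsOf false qs

length-tailsOf : ∀ qs → length (tailsOf false qs) + length (tailsOf true qs) ≤ length qs
length-tailsOf [] = z≤n
length-tailsOf ([] ∷ qs) = ℕₚ.m≤n⇒m≤1+n (length-tailsOf qs)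
length-tailsOf ((true ∷ q) ∷ qs) = subst (_≤ suc (length qs)) (sym (ℕₚ.+-suc _ _)) (s≤s (length-tailsOf qs))
length-tailsOf ((false ∷ q) ∷ qs) = s≤s (length-tailsOf qs)

avoid-tails : ∀ b {u} qs → All (u ≢_) (tailsOf b qs) → All (b ∷ u ≢_) qs
avoid-tails b [] ns = []
avoid-tails b ([] ∷ qs) ns = (λ ()) ∷ avoid-tails b qs ns
avoid-tails true ((true ∷ q) ∷ qs) (n ∷ ns) = (λ e → n (Listₚ.∷-injectiveʳ e)) ∷ avoid-tails true qs ns
avoid-tails true ((false ∷ q) ∷ qs) ns = (λ ()) ∷ avoid-tails true qs ns
avoid-tails false ((true ∷ q) ∷ qs) ns = (λ ()) ∷ avoid-tails false qs ns
avoid-tails false ((false ∷ q) ∷ qs) (n ∷ ns) = (λ e → n (Listₚ.∷-injectiveʳ e)) ∷ avoid-tails false qs ns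

-- The words that start with false and those that start with true cannot both number `2 ^ n` or
-- more, so one of the two halves has room for a new word.
fresh : ∀ n qs → length qs < 2 ^ n → Σ Word λ u → length u ≡ n × All (u ≢_) qs
fresh zero [] _ = [] , refl , []
fresh zero (q ∷ qs) (s≤s ())
fresh (suc n) qs p with length (tailsOf false qs) <? 2 ^ n
... | yes q with fresh n (tailsOf false qs) q
...   | u , l , ns = false ∷ u , cong suc l , avoid-tails false qs ns
fresh (suc n) qs p | no nq with fresh n (tailsOf true qs) room
  where
  room : length (tailsOf true qs) < 2 ^ n
  room = ℕₚ.+-cancelˡ-< (2 ^ n) _ _ (ℕₚ.≤-<-trans (ℕₚ.+-monoˡ-≤ (length (tailsOf true qs)) (ℕₚ.≮⇒≥ nq))
    (ℕₚ.≤-<-trans (length-tailsOf qs) (subst (length qs <_) (cong (2 ^ n +_) (ℕₚ.+-identityʳ (2 ^ n))) p)))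
... | u , l , ns = true ∷ u , cong suc l , avoid-tails true qs ns

n<2^n : ∀ n → n < 2 ^ n
n<2^n zero = s≤s z≤n
n<2^n (suc n) = ℕₚ.≤-trans (s≤s (n<2^n n)) (ℕₚ.≤-trans (ℕₚ.+-monoˡ-≤ (2 ^ n) (ℕₚ.m^n>0 2 n)) (ℕₚ.+-monoʳ-≤ (2 ^ n) (ℕₚ.≤-reflexive (sym (ℕₚ.+-identityʳ (2 ^ n))))))

-- At n = s (k + 1) the bound c (n + 1) ^ k is at most c (k + 2) ^ k 2 ^ (s k), to be compared with 2 ^ s 2 ^ (s k).
outgrown : ∀ {τ} → PolyBounded τ → ∀ r → Σ ℕ λ n → r ≤ n × τ n < 2 ^ n
outgrown {τ} (c , k , bound) r = n , r≤n , (begin-strict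
  τ n ≤⟨ bound n ⟩
  c * suc n ^ k ≤⟨ ℕₚ.*-monoʳ-≤ c (ℕₚ.^-monoˡ-≤ k sucn≤) ⟩
  c * ((2 + k) * 2 ^ s) ^ k ≡⟨ cong (c *_) (^-distribʳ-* (2 + k) (2 ^ s) k) ⟩
  c * ((2 + k) ^ k * (2 ^ s) ^ k) ≡⟨ ℕₚ.*-assoc c ((2 + k) ^ k) ((2 ^ s) ^ k) ⟨
  a * (2 ^ s) ^ k <⟨ ℕₚ.*-monoˡ-< ((2 ^ s) ^ k) {{ℕₚ.m^n≢0 (2 ^ s) k {{ℕₚ.m^n≢0 2 s}}}} (ℕₚ.≤-<-trans (ℕₚ.m≤m+n a r) (n<2^n s)) ⟩
  2 ^ s * (2 ^ s) ^ k ≡⟨ ℕₚ.^-*-assoc 2 s (suc k) ⟩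
  2 ^ n ∎)
  where
  open ℕₚ.≤-Reasoning
  a s n : ℕ
  a = c * (2 + k) ^ k
  s = a + r
  n = s * suc k
  r≤n : r ≤ n
  r≤n = ℕₚ.≤-trans (ℕₚ.m≤n+m r a) (ℕₚ.m≤m*n s (suc k))
  sucn≤ : suc n ≤ (2 + k) * 2 ^ s
  sucn≤ = ℕₚ.+-mono-≤ (ℕₚ.m^n>0 2 s) (subst (n ≤_) (ℕₚ.*-comm (2 ^ s) (suc k)) (ℕₚ.*-monoˡ-≤ (suc k) (ℕₚ.<⇒≤ (n<2^n s))))

_∪_ : Language → Word → Language
(B ∪ u) v = does (Listₚ.≡-dec Bool._≟_ v u) ∨ B v

count-point : ∀ u → count (length u) (λ v → does (Listₚ.≡-dec Bool._≟_ v u)) ≡ 1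
count-point [] = refl
count-point (false ∷ u) = cong₂ _+_ (count-point u) (count-false (length u) λ _ → refl)
count-point (true ∷ u) = cong₂ _+_ (count-false (length u) {λ _ → false} λ _ → refl) (count-point u)

∪-other : ∀ B u v → u ≢ v → (B ∪ u) v ≡ B v
∪-other B u v ne with Listₚ.≡-dec Bool._≟_ v u
... | yes e = ⊥-elim (ne (sym e))
... | no _ = refl

longest : List Word → ℕ
longest [] = 0
longest (q ∷ qs) = length q ⊔ longest qs

agree-short : ∀ {A A'} qs → (∀ v → length v ≤ longest qs → A v ≡ A' v) → Agree A A' qs
agree-short [] e = []
agree-short (q ∷ qs) e = e q (ℕₚ.m≤m⊔n (length q) (longest qs)) ∷ agree-short qs λ v l → e v (ℕₚ.≤-trans l (ℕₚ.m≤n⊔m (length q) (longest qs)))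

count-cong : ∀ n {A A' : Language} → (∀ v → length v ≡ n → A v ≡ A' v) → count n A ≡ count n A'
count-cong n e = sumBits-cong n λ v l → cong 𝟙 (e v l)

unary : ℕ → Word
unary n = replicate n true

-- The polynomial is 1 at census 0 and 0 at census 1, so either case refutes `M` on a single input.
-- No time bound is assumed, since `accPaths` carries its own clock.
Defeated : OTM → ℕ → ℕ → Language → Set
Defeated M c k A = Σ ℕ λ n → (count n A ≡ 0 × accPaths M A c k (unary n) ≡ 0) ⊎ (count n A ≡ 1 × 0 < accPaths M A c k (unary n))

record Stage : Set where
  field
    members : Language
    height  : ℕ
    bounded : ∀ v → height ≤ length v → members v ≡ false

open Stage

-- `goal` covers every oracle that agrees with the new stage below its height. As later stages
-- change only longer words, what a stage achieves is never undone.
record Extends (s : Stage) (Goal : Language → Set) : Set where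
  field
    stage  : Stage
    higher : height s < height stage
    stable : ∀ v → length v < height s → members stage v ≡ members s v
    goal   : ∀ A → (∀ v → length v < height stage → members stage v ≡ A v) → Goal A

open Extends

idle : ∀ s → Extends s (λ _ → ⊤)
idle s .stage = record { members = members s ; height = suc (height s) ; bounded = λ v l → bounded s v (ℕₚ.<⇒≤ l) }
idle s .higher = ℕₚ.≤-refl
idle s .stable v l = refl
idle s .goal A e = tt

module Defeat (M : OTM) (c k : ℕ) (s : Stage) (n : ℕ) (high : height s ≤ n) (small : poly c k n < 2 ^ n) where

  t : ℕ
  t = poly c k (length (unary n))

  t<2^n : t < 2 ^ n
  t<2^n = subst (λ m → poly c k m < 2 ^ n) (sym (Listₚ.length-replicate n)) small

  module Settled (B : Language) where

    asked : List Word
    asked = proj₁ (queries M B t (initConfig M (unary n)))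

    top : ℕ
    top = suc (n ⊔ longest asked)

    paths-stable : ∀ A → (∀ v → length v < top → B v ≡ A v) → accPaths M B c k (unary n) ≡ accPaths M A c k (unary n)
    paths-stable A e = proj₂ (queries M B t (initConfig M (unary n))) (agree-short asked λ v l → e v (s≤s (ℕₚ.≤-trans l (ℕₚ.m≤n⊔m n (longest asked)))))

    census-stable : ∀ A → (∀ v → length v < top → B v ≡ A v) → count n A ≡ count n B
    census-stable A e = count-cong n λ v l → sym (e v (s≤s (subst (_≤ n ⊔ longest asked) (sym l) (ℕₚ.m≤m⊔n n (longest asked)))))

    higher-top : height s < top
    higher-top = s≤s (ℕₚ.≤-trans high (ℕₚ.m≤m⊔n n (longest asked)))

  empty : ∀ v → length v ≡ n → members s v ≡ false
  empty v l = bounded s v (subst (height s ≤_) (sym l) high)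

  leave : accPaths M (members s) c k (unary n) ≡ 0 → Extends s (Defeated M c k)
  leave none = record
    { stage = record { members = members s ; height = top ; bounded = λ v l → bounded s v (ℕₚ.≤-trans (ℕₚ.<⇒≤ higher-top) l) }
    ; higher = higher-top
    ; stable = λ v l → refl
    ; goal = λ A e → n , inj₁ (trans (census-stable A e) (trans (count-cong n empty) (sumBits-zero n)) , trans (sym (paths-stable A e)) none) }
    where open Settled (members s)

  insert : 0 < accPaths M (members s) c k (unary n) → Extends s (Defeated M c k)
  insert some with pathQueries M (members s) t (initConfig M (unary n)) some
  ... | qs , few , survive with fresh n qs (ℕₚ.≤-<-trans few t<2^n)
  ...   | u , l , new = record
    { stage = record { members = B ; height = top ; bounded = bounded-B }
    ; higher = higher-top
    ; stable = λ v l' → ∪-other (members s) u v λ { refl → ℕₚ.<⇒≱ l' (subst (height s ≤_) (sym l) high) }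
    ; goal = λ A e → n , inj₂ (trans (census-stable A e) one , subst (0 <_) (paths-stable A e)
        (survive (All.map (λ {q} ne → sym (∪-other (members s) u q ne)) new))) }
    where
    B : Language
    B = members s ∪ u
    -- The new height must clear the words asked relative to the enlarged oracle, which may differ
    -- from those asked relative to `members s`.
    open Settled B
    bounded-B : ∀ v → top ≤ length v → B v ≡ false
    bounded-B v l' = trans (∪-other (members s) u v λ { refl → ℕₚ.<⇒≱ (ℕₚ.≤-trans (s≤s (ℕₚ.m≤m⊔n n (longest asked))) l') (ℕₚ.≤-reflexive l) })
      (bounded s v (ℕₚ.≤-trans (ℕₚ.<⇒≤ higher-top) l'))
    one : count n B ≡ 1
    one = trans (count-cong n λ v l' → trans (cong (does (Listₚ.≡-dec Bool._≟_ v u) ∨_) (empty v l')) (Boolₚ.∨-identityʳ _))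
      (subst (λ n → count n (λ v → does (Listₚ.≡-dec Bool._≟_ v u)) ≡ 1) l (count-point u))

  defeat : Extends s (Defeated M c k)
  defeat with accPaths M (members s) c k (unary n) in e
  ... | zero = leave e
  ... | suc m = insert (subst (0 <_) (sym e) (s≤s z≤n))

Clocked : Set
Clocked = Machines × ℕ × ℕ

abstract
  Clocked-countable : Countable Clocked
  Clocked-countable = Σ-countable Machines-countable λ _ → Σ-countable ℕ-countable λ _ → ℕ-countable

GoalAt : Maybe Clocked → Language → Set
GoalAt nothing A = ⊤
GoalAt (just (m , c , k)) A = Defeated (toMachine m) c k A

extend : ∀ x s → Extends s (GoalAt x)
extend nothing s = idle s
extend (just (m , c , k)) s with outgrown (pb-poly c k) (height s)
... | n , high , small = Defeat.defeat (toMachine m) c k s n high small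

stages : ℕ → Stage
stages zero = record { members = ∅L ; height = 0 ; bounded = λ _ _ → refl }
stages (suc i) = stage (extend (Countable.decode Clocked-countable i) (stages i))

-- Heights increase strictly, so stage `suc (length v)` is already higher than the length of `v`,
-- and membership of `v` is settled there.
diagonal : Language
diagonal v = members (stages (suc (length v))) v

height-grows : ∀ i → i ≤ height (stages i)
height-grows zero = z≤n
height-grows (suc i) = ℕₚ.≤-<-trans (height-grows i) (higher (extend (Countable.decode Clocked-countable i) (stages i)))

height-mono : ∀ d i → height (stages i) ≤ height (stages (d + i))
height-mono zero i = ℕₚ.≤-refl
height-mono (suc d) i = ℕₚ.≤-trans (height-mono d i) (ℕₚ.<⇒≤ (higher (extend (Countable.decode Clocked-countable (d + i)) (stages (d + i)))))

stages-stable : ∀ d i v → length v < height (stages i) → members (stages (d + i)) v ≡ members (stages i) v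
stages-stable zero i v l = refl
stages-stable (suc d) i v l = trans
  (stable (extend (Countable.decode Clocked-countable (d + i)) (stages (d + i))) v (ℕₚ.≤-trans l (height-mono d i)))
  (stages-stable d i v l)

-- Either stage may come first, so both are compared with the stage whose number is the sum of
-- theirs.
diagonal-stage : ∀ i v → length v < height (stages i) → members (stages i) v ≡ diagonal v
diagonal-stage i v l = trans (sym (stages-stable (suc (length v)) i v l))
  (trans (cong (λ j → members (stages j) v) (ℕₚ.+-comm (suc (length v)) i))
    (stages-stable i (suc (length v)) v (height-grows (suc (length v)))))

diagonal-defeats : ∀ M c k → Defeated M c k diagonal
diagonal-defeats M c k = transfer (subst (λ x → GoalAt x diagonal) (Countable.decode-code Clocked-countable (describe M , c , k))
  (goal (extend (Countable.decode Clocked-countable i) (stages i)) diagonal (diagonal-stage (suc i))))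
  where
  i = Countable.code Clocked-countable (describe M , c , k)
  same : ∀ w → accPaths (toMachine (describe M)) diagonal c k w ≡ accPaths M diagonal c k w
  same w = countAcc-cong M _ (λ q a b → trans (cong (λ r → lookup (lookup r a) b) (Vecₚ.lookup∘tabulate (λ q → tabulate λ x → tabulate λ y → OTM.δ M q x y) q))
    (trans (cong (λ r → lookup r b) (Vecₚ.lookup∘tabulate (λ x → tabulate λ y → OTM.δ M q x y) a)) (Vecₚ.lookup∘tabulate (OTM.δ M q a) b)))
    diagonal (poly c k (length w)) (OTM.start M) (inputTape w) emptyTape
  transfer : Defeated (toMachine (describe M)) c k diagonal → Defeated M c k diagonal
  transfer (n , inj₁ (p , q)) = n , inj₁ (p , trans (sym (same (unary n))) q)
  transfer (n , inj₂ (p , q)) = n , inj₂ (p , subst (0 <_) (same (unary n)) q)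

-- The contradiction

not-relativizing : ∀ A → (∀ M c k → Defeated M c k A) → ¬ Relativizes decrementSquareℚ
not-relativizing A defeats rel = go (rel A (λ w → count (length w) A) (census-SharpP^ A))
  where
  contradict : ∀ {m a} → decrementSquare m ≡ a → (m ≡ 0 × a ≡ 0) ⊎ (m ≡ 1 × 0 < a) → ⊥
  contradict e (inj₁ (refl , refl)) with () ← e
  contradict e (inj₂ (refl , p)) = ℕₚ.<⇒≢ p e
  go : ComposeIn A decrementSquareℚ (λ w → count (length w) A) → ⊥
  go (g , (M , c , k , _ , counts) , values) with defeats M c k
  ... | n , defeated = contradict value defeated
    where
    value : decrementSquare (count n A) ≡ accPaths M A c k (unary n)
    value = trans (trans (cong (λ m → decrementSquare (count m A)) (sym (Listₚ.length-replicate n)))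
      (toℚ-injective (trans (sym (evalQ-decrementSquare (count (length (unary n)) A))) (values (unary n))))) (sym (counts (unary n)))

closure-property : (∀ {f} → SharpP f → SharpP (λ w → decrementSquare (f w))) → IsClosureProperty decrementSquareℚ
closure-property closed f p = (λ w → decrementSquare (f w)) , closed p , λ w → evalQ-decrementSquare (f w)

theorem4p7 : UnivariateBinomialBasisConjecture →
    (¬ (∀ (f : Word → ℕ) → SharpP f ⇔ SharpP^NP f)) × (¬ (∀ (L : Language) → P L ⇔ NP L))
theorem4p7 conjecture =
  (λ collapse → refute λ p → let (A , np , s , _) = decrementSquare-SharpP^ p in Equivalence.from (collapse _) (A , np , s)) ,
  -- Here `P = NP` is applied to the one language that the program for `f` queries, and its decider
  -- is inlined; the collapse of the counting classes is not derived.
  (λ collapse → refute λ p → let (A , np , _ , inP) = decrementSquare-SharpP^ p in inP (Equivalence.from (collapse A) np))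
  where
  refute : ¬ (∀ {f} → SharpP f → SharpP (λ w → decrementSquare (f w)))
  refute closed = not-relativizing diagonal diagonal-defeats (conjecture decrementSquareℚ (closure-property closed))
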